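{- Let $p$ be a prime with $p\equiv1\pmod 4$, and write $p=c^2+d^2$ with $c,d\in\mathbb Z$ and $2\mid d$. Let $b,m\in\mathbb Z$ with $\gcd(b,m)=1$ and $p\nmid m(b^2+4m^2)$. Then $$\Big(\frac mp\Big)\sum_{k=0}^{(p-1)/4}\binom{4k}{2k}\Big(-\frac{b^2}{64m^2}\Big)^k\equiv\Big(\frac bp\Big)\sum_{k=0}^{(p-1)/4}\binom{4k}{2k}\Big(-\frac{m^2}{4b^2}\Big)^k$$ $$\equiv\begin{cases}\Big(\frac{bc+2md}{b^2+4m^2}\Big)\pmod p&\text{if }2\nmid b\text{ and }\big(\frac{b^2+4m^2}{p}\big)=1,\\[2pt] (-1)^{\frac{((b/2)c+md)^2-1}{8}+\frac d2}\Big(\frac{(b/2)c+md}{((b/2)^2+m^2)/2}\Big)\pmod p&\text{if }2\,\|\,b\text{ and }\big(\frac{b^2+4m^2}{p}\big)=1,\\[2pt] \Big(\frac{mc-(b/2)d}{b^2/4+m^2}\Big)\pmod p&\text{if }4\mid b\text{ and }\big(\frac{b^2+4m^2}{p}\big)=1,\\[2pt] 0\pmod p&\text{if }\big(\frac{b^2+4m^2}{p}\big)=-1.\end{cases}$$ In particular, for $a\in\mathbb Z$ with $p\nmid 16a^2+1$, $$\sum_{k=0}^{(p-1)/4}\binom{4k}{2k}(-a^2)^k\equiv\Big(\frac{2a}p\Big)\sum_{k=0}^{(p-1)/4}\binom{4k}{2k}\frac1{(-256a^2)^k}\equiv\begin{cases}\Big(\frac{c-4ad}{16a^2+1}\Big)\pmod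 p&\text{if }\big(\frac{16a^2+1}p\big)=1,\\ 0\pmod p&\text{if }\big(\frac{16a^2+1}p\big)=-1.\end{cases}$$
   Context: For rational numbers whose denominators are prime to $p$, congruences modulo $p$ are understood in the ring of such rationals. $\big(\frac{x}{n}\big)$ denotes the Legendre–Jacobi symbol (for odd positive $n$); $\big(\frac{x}{p}\big)$ for such a rational $x$ means the Legendre symbol of its residue mod $p$. $2\,\|\,b$ means $2\mid b$ but $4\nmid b$.
   Formalization: The congruence for the second sum, with factor (b/p), is asserted only when p∤b, and in the "in particular" part, with factor (2a/p), only when p∤a, since otherwise its terms are not p-integral; the first sum's congruence is proved in all cases. -}

module Defs where

open import Data.Nat as ℕ using (ℕ; zero; suc)
import Data.Nat.Divisibility as ℕD
open import Data.Integer as ℤ using (ℤ; +_; -[1+_])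
open import Data.Integer.Divisibility as ℤD using ()
open import Data.Rational as ℚ using (ℚ; ↥_; ↧ₙ_; 0ℚ; 1ℚ)
open import Data.Bool using (Bool; true; false; if_then_else_)
open import Data.Product using (_×_)
open import Relation.Nullary using (¬_; does)

-- Total fraction n/d of integers as a rational (junk value 0 when d = 0;
-- in the theorem every denominator is nonzero under the hypotheses).
infixl 7 _//_
_//_ : ℤ → ℤ → ℚ
n // (+ zero)   = 0ℚ
n // (+ suc k)  = n ℚ./ suc k
n // -[1+ k ]   = (ℤ.- n) ℚ./ suc k

infixr 8 _^ℚ_
_^ℚ_ : ℚ → ℕ → ℚ
x ^ℚ zero  = 1ℚ
x ^ℚ suc n = x ℚ.* (x ^ℚ n)

sumTo : ℕ → (ℕ → ℚ) → ℚ
sumTo zero    f = f 0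
sumTo (suc N) f = sumTo N f ℚ.+ f (suc N)

_≡ℚ_[mod_] : ℚ → ℚ → ℕ → Set
x ≡ℚ y [mod p ] =
  (¬ (p ℕD.∣ ↧ₙ x)) × (¬ (p ℕD.∣ ↧ₙ y)) × ((+ p) ℤD.∣ ↥ (x ℚ.- y))

private
  anySq : ℕ → ℕ → ℕ → Bool
  anySq q r zero      = false
  anySq q r (suc y)   =
    if does (q ℕD.∣? (y ℕ.* y ℕ.+ (q ℕ.∸ r)))  -- y² - r ≡ 0 mod q  (r < q)
    then true else anySq q r y

-- Legendre symbol (x / q) for a prime q: 0 if q ∣ x, 1 if x is a nonzero
-- square mod q, -1 otherwise.  (Junk value 0 for q = 0.)
legendre : ℤ → ℕ → ℤ
legendre x zero = + 0
legendre x q@(suc k) with x ℤ.%ℕ q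
... | zero      = + 0
... | r@(suc _) = if anySq q r q then + 1 else -[1+ 0 ]

private
  leastDivFrom : ℕ → ℕ → ℕ → ℕ
  leastDivFrom zero       d n = n
  leastDivFrom (suc fuel) d n =
    if does (d ℕD.∣? n) then d else leastDivFrom fuel (suc d) n

minPrimeFactor : ℕ → ℕ
minPrimeFactor n = leastDivFrom n 2 n

private
  divℕ : ℕ → ℕ → ℕ
  divℕ n zero    = 0
  divℕ n (suc k) = n ℕ./ suc k

  jacobiFuel : ℕ → ℤ → ℕ → ℤ
  jacobiFuel zero       x n = + 1
  jacobiFuel (suc fuel) x zero = + 1
  jacobiFuel (suc fuel) x (suc zero) = + 1
  jacobiFuel (suc fuel) x n@(suc (suc _)) =
    let q = minPrimeFactor n in
    legendre x q ℤ.* jacobiFuel fuel x (divℕ n q)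

-- Jacobi symbol (x / n) = ∏ (x / qᵢ) over the prime factorisation
-- n = ∏ qᵢ (with multiplicity); (x / 1) = 1.  Meaningful for odd n ≥ 1.
jacobi : ℤ → ℕ → ℤ
jacobi x n = jacobiFuel n x n

negOnePow : ℤ → ℤ
negOnePow e with ℤ.∣ e ∣ ℕ.% 2
... | zero = + 1
... | suc _ = -[1+ 0 ]

toℚ : ℤ → ℚ
toℚ n = n ℚ./ 1

{-# OPTIONS --safe #-}
module Submission where

-- Put n = (p − 1)/2.  Since C(2j, j) ≡ (−4)^j C(n, j) mod p, the sum Σ C(4k, 2k) x^k is the even part
-- of a binomial expansion: it is ≡ ((1 + y)^n + (1 − y)^n)/2 when y² = 16x.  As −1 ≡ (c/d)² mod p, both
-- sums of the theorem have such a y, namely bc/(2md) and 2md/(bc), so by Euler's criterion both sides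
-- equal half of (t/p) + (t'/p) with t = bc + 2md, t' = ±(bc − 2md) and (t t'/p) = ((b² + 4m²)/p); here
-- (c/p) = (2d/p) = 1 is used.  Finally t² + s² = p (b² + 4m²) with s = 2mc − bd, and reciprocity of
-- Jacobi symbols moves t from modulus p to modulus b² + 4m².
--
-- Jacobi symbols are handled through Gauss's sign product J(a, n) = ∏ sgn(a k), k ≤ (n − 1)/2, which makes
-- sense for every odd n.  It is multiplicative in a because multiplication by a permutes {±1, …, ±(n − 1)/2}.
-- Kronecker's double product of the signs of (i n − k a)(2 k a + 2 i n − a n) gives reciprocity for arbitrary
-- coprime odd a and n, and multiplicativity in n then follows from reciprocity.

open import Defs
open import Data.Nat as ℕ using (ℕ; zero; suc; z≤n; s≤s)
import Data.Nat.Properties as ℕₚ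
import Data.Nat.DivMod as ℕDM
import Data.Nat.Divisibility as ℕD
import Data.Nat.Coprimality as Coprimality
import Data.Nat.Tactic.RingSolver as ℕ-Solver
open import Data.Nat.GCD using (module Bézout)
open import Data.Nat.Primality using (Prime; prime⇒nonTrivial; prime⇒irreducible; ¬prime[0]; ¬prime[1]; _Rough_; 2-rough; ∤⇒rough-suc; rough∧∣⇒prime)
open import Data.Nat.Combinatorics using (_C_; nCk+nC[k+1]≡[n+1]C[k+1]; k>n⇒nCk≡0)
open import Data.Integer as ℤ using (ℤ; +_; -[1+_]; -_; _+_; _-_; _*_; _^_; _/_; ∣_∣)
import Data.Integer.Properties as ℤₚ
import Data.Integer.DivMod as ℤDM
open import Data.Integer.Divisibility using (_∣_)
import Data.Integer.Divisibility.Signed as ℤS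
open import Data.Integer.GCD using (gcd)
open import Data.Integer.Tactic.RingSolver using (solve-∀)
open import Data.Rational as ℚ using (ℚ; ↥_; ↧_; ↧ₙ_)
import Data.Rational.Properties as ℚₚ
open import Data.Fin as Fin using (Fin; toℕ; fromℕ<)
import Data.Fin.Properties as Finₚ
open import Data.Fin.Permutation using (Permutation; permutation)
open import Data.Vec using (Vec; []; _∷_; replicate)
open import Data.Sign.Base using (Sign) renaming (+ to ⊕; - to ⊖; _*_ to _·_)
import Data.Sign.Properties as Signₚ
import Algebra.Properties.CommutativeMonoid.Sum as Sum
open import Algebra.Properties.CommutativeSemigroup Signₚ.*-commutativeSemigroup using (interchange)
open import Data.Bool using (Bool; true; false; if_then_else_)
open import Data.Product using (Σ; _×_; _,_; proj₁; proj₂)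
open import Data.Sum using (_⊎_; inj₁; inj₂; [_,_]′)
open import Data.Empty using (⊥; ⊥-elim)
open import Function using (_∘_)
open import Relation.Nullary using (¬_; yes; no; Dec; does)
open import Relation.Binary.Definitions using (tri<; tri≈; tri>)
open import Relation.Binary.PropositionalEquality hiding (J)

-- Congruences and units

-- Reciprocity needs an odd numerator, whereas t = bc + 2md is even for even b. Then t = 2τ with τ =
-- (b/2)c + md, and the norm b² + 4m² loses a factor 4. If 2 divides b exactly, τ is odd but (b/2)²
-- + m² is twice an odd number; the symbols of 2 modulo |τ| and modulo p make up the sign in the
-- second case. If 4 divides b, τ is even as well; multiplied by c/d, a root of -1 modulo p, it
-- becomes the odd number mc - (b/2)d, whence the third case. In all cases p and the odd part of the
-- norm are ≡ 1 mod 4, so they are written `odd (double w)`: reciprocity then has no sign, and the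
-- sign of t is irrelevant. With symbols defined as sign products, prime factorisations enter only
-- once, in the comparison with the Jacobi symbol.

infix 4 _≅_mod_
-- With the quotient as data, a congruence is a polynomial identity for the ring solver. The modulus
-- is any integer, because t, possibly negative, also serves as a modulus.
record _≅_mod_ (x y n : ℤ) : Set where
  constructor by
  field
    quot : ℤ
    eq   : x ≡ y + quot * n

≅-refl : ∀ {n x} → x ≅ x mod n
≅-refl {n} {x} = by (+ 0) (lem x n)
  where lem : ∀ x n → x ≡ x + + 0 * n
        lem = solve-∀

≅-reflexive : ∀ {n x y} → x ≡ y → x ≅ y mod n
≅-reflexive refl = ≅-refl

≅-sym : ∀ {n x y} → x ≅ y mod n → y ≅ x mod n
≅-sym {n} {y = y} (by k refl) = by (- k) (lem y k n)
  where lem : ∀ y k n → y ≡ (y + k * n) + (- k) * n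
        lem = solve-∀

≅-trans : ∀ {n x y z} → x ≅ y mod n → y ≅ z mod n → x ≅ z mod n
≅-trans {n} {z = z} (by k refl) (by l refl) = by (k + l) (lem z k l n)
  where lem : ∀ z k l n → (z + l * n) + k * n ≡ z + (k + l) * n
        lem = solve-∀

+-cong : ∀ {n x y z w} → x ≅ y mod n → z ≅ w mod n → x + z ≅ y + w mod n
+-cong {n} {y = y} {w = w} (by k refl) (by l refl) = by (k + l) (lem y w k l n)
  where lem : ∀ y w k l n → (y + k * n) + (w + l * n) ≡ (y + w) + (k + l) * n
        lem = solve-∀

*-cong : ∀ {n x y z w} → x ≅ y mod n → z ≅ w mod n → x * z ≅ y * w mod n
*-cong {n} {y = y} {w = w} (by k refl) (by l refl) = by (k * w + y * l + k * l * n) (lem y w k l n)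
  where lem : ∀ y w k l n → (y + k * n) * (w + l * n) ≡ (y * w) + (k * w + y * l + k * l * n) * n
        lem = solve-∀

neg-cong : ∀ {n x y} → x ≅ y mod n → - x ≅ - y mod n
neg-cong {n} {y = y} (by k refl) = by (- k) (lem y k n)
  where lem : ∀ y k n → - (y + k * n) ≡ - y + (- k) * n
        lem = solve-∀

^-cong : ∀ {n x y} k → x ≅ y mod n → x ^ k ≅ y ^ k mod n
^-cong zero    e = ≅-refl
^-cong (suc k) e = *-cong e (^-cong k e)

*-congˡ : ∀ {n z w} x → z ≅ w mod n → x * z ≅ x * w mod n
*-congˡ x = *-cong (≅-refl {x = x})

*-congʳ : ∀ {n x y} z → x ≅ y mod n → x * z ≅ y * z mod n
*-congʳ z e = *-cong e (≅-refl {x = z})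

module ≅-Reasoning (n : ℤ) where
  infix  1 begin_
  infixr 2 _≅⟨_⟩_ _≡⟨_⟩_
  infix  3 _∎
  begin_ : ∀ {x y} → x ≅ y mod n → x ≅ y mod n
  begin e = e
  _≅⟨_⟩_ : ∀ x {y z} → x ≅ y mod n → y ≅ z mod n → x ≅ z mod n
  _ ≅⟨ e ⟩ f = ≅-trans e f
  _≡⟨_⟩_ : ∀ x {y z} → x ≡ y → y ≅ z mod n → x ≅ z mod n
  _ ≡⟨ refl ⟩ f = f
  _∎ : ∀ x → x ≅ x mod n
  _ ∎ = ≅-refl

≅-weaken : ∀ {n x y} m → x ≅ y mod (m * n) → x ≅ y mod n
≅-weaken {n} {y = y} m (by k refl) = by (k * m) (cong (_+_ y) (sym (ℤₚ.*-assoc k m n)))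

n≅0 : ∀ n → n ≅ + 0 mod n
n≅0 n = by (+ 1) (lem n)
  where lem : ∀ n → n ≡ + 0 + + 1 * n
        lem = solve-∀

∣⇒≅0 : ∀ {n x} → n ∣ x → x ≅ + 0 mod n
∣⇒≅0 {n} {x} d with ℤS.∣ᵤ⇒∣ d
... | ℤS.divides q eq = by q (trans eq (sym (ℤₚ.+-identityˡ _)))

≅0⇒∣ : ∀ {n x} → x ≅ + 0 mod n → n ∣ x
≅0⇒∣ (by q eq) = ℤS.∣⇒∣ᵤ (ℤS.divides q (trans eq (ℤₚ.+-identityˡ _)))

≅⇒-≅0 : ∀ {n x y} → x ≅ y mod n → x - y ≅ + 0 mod n
≅⇒-≅0 {n} {y = y} (by k refl) = by k (lem y k n)
  where lem : ∀ y k n → (y + k * n) - y ≡ + 0 + k * n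
        lem = solve-∀

-≅0⇒≅ : ∀ {n x y} → x - y ≅ + 0 mod n → x ≅ y mod n
-≅0⇒≅ {n} {x} {y} (by k e) = by k (trans (lem x y) (trans (cong (_+_ y) e) (cong (_+_ y) (ℤₚ.+-identityˡ _))))
  where lem : ∀ x y → x ≡ y + (x - y)
        lem = solve-∀

remainder-unique : ∀ {n r s} → + r ≅ + s mod + n → r ℕ.< n → s ℕ.< n → r ≡ s
remainder-unique {n} {r} {s} (by (+ zero) e) r<n s<n = ℤₚ.+-injective (trans e (ℤₚ.+-identityʳ (+ s)))
remainder-unique {n} {r} {s} (by (+ suc k) e) r<n s<n =
  ⊥-elim (ℕₚ.<⇒≱ r<n (subst (n ℕ.≤_) (sym r≡) (ℕₚ.≤-trans (ℕₚ.m≤m+n n (k ℕ.* n)) (ℕₚ.m≤n+m _ s))))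
  where r≡ : r ≡ s ℕ.+ suc k ℕ.* n
        r≡ = ℤₚ.+-injective (trans e (cong (_+_ (+ s)) (sym (ℤₚ.pos-* (suc k) n))))
remainder-unique {n} {r} {s} (by -[1+ k ] e) r<n s<n =
  ⊥-elim (ℕₚ.<⇒≱ s<n (subst (n ℕ.≤_) (sym s≡) (ℕₚ.≤-trans (ℕₚ.m≤m+n n (k ℕ.* n)) (ℕₚ.m≤n+m _ r))))
  where lem : ∀ s k n → s ≡ (s + (- k) * n) + k * n
        lem = solve-∀
        s≡ : s ≡ r ℕ.+ suc k ℕ.* n
        s≡ = ℤₚ.+-injective (trans (lem (+ s) (+ suc k) (+ n))
               (trans (cong (_+ + suc k * + n) (sym e)) (cong (_+_ (+ r)) (sym (ℤₚ.pos-* (suc k) n)))))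

%ℕ-≅ : ∀ x n .{{_ : ℕ.NonZero n}} → x ≅ + (x ℤ.%ℕ n) mod + n
%ℕ-≅ x n = by (x ℤ./ℕ n) (ℤDM.a≡a%ℕn+[a/ℕn]*n x n)

%ℕ-unique : ∀ {x n r} .{{_ : ℕ.NonZero n}} → x ≅ + r mod + n → r ℕ.< n → x ℤ.%ℕ n ≡ r
%ℕ-unique {x} {n} e r<n = remainder-unique (≅-trans (≅-sym (%ℕ-≅ x n)) e) (ℤDM.n%ℕd<d x n) r<n

-- Coprimality as a Bézout relation: it can be read modulo either argument and passes to factors of
-- both without any gcd.
record Unit (a n : ℤ) : Set where
  constructor _,_
  field
    inv  : ℤ
    inv≅ : a * inv ≅ + 1 mod n

Unit-sym : ∀ {a n} → Unit a n → Unit n a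
Unit-sym {a} {n} (e , by k eq) = - k , by (- e) (trans (lem₁ n k) (trans (cong (λ z → + 1 - z) (sym eq)) (lem₂ a e)))
  where
    lem₁ : ∀ n k → n * (- k) ≡ + 1 - (+ 1 + k * n)
    lem₁ = solve-∀
    lem₂ : ∀ a e → + 1 - a * e ≡ + 1 + (- e) * a
    lem₂ = solve-∀

Unit-1 : ∀ n → Unit (+ 1) n
Unit-1 n = + 1 , ≅-refl

Unit-neg : ∀ {a n} → Unit a n → Unit (- a) n
Unit-neg {a} {n} (e , q) = - e , ≅-trans (≅-reflexive (lem a e)) q
  where lem : ∀ a e → - a * - e ≡ a * e
        lem = solve-∀

Unit-* : ∀ {a b n} → Unit a n → Unit b n → Unit (a * b) n
Unit-* {a} {b} {n} (e , p) (f , q) = e * f , ≅-trans (≅-reflexive (lem a b e f)) (*-cong p q)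
  where lem : ∀ a b e f → a * b * (e * f) ≡ (a * e) * (b * f)
        lem = solve-∀

Unit-factorˡ : ∀ {a b n} → Unit (a * b) n → Unit a n
Unit-factorˡ {a} {b} (e , p) = b * e , ≅-trans (≅-reflexive (sym (ℤₚ.*-assoc a b e))) p

Unit-factorʳ : ∀ {a b n} → Unit (a * b) n → Unit b n
Unit-factorʳ {a} {b} {n} u = Unit-factorˡ {b} {a} (subst (λ z → Unit z n) (ℤₚ.*-comm a b) u)

Unit-≅ : ∀ {a b n} → a ≅ b mod n → Unit a n → Unit b n
Unit-≅ q (e , p) = e , ≅-trans (*-congʳ e (≅-sym q)) p

Unit-mod-factorʳ : ∀ {a m n} → Unit a (m * n) → Unit a n
Unit-mod-factorʳ {m = m} (e , p) = e , ≅-weaken m p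

Unit-mod-factorˡ : ∀ {a m n} → Unit a (m * n) → Unit a m
Unit-mod-factorˡ {a} {m} {n} u = Unit-mod-factorʳ {m = n} (subst (Unit a) (ℤₚ.*-comm m n) u)

Unit-cancelˡ : ∀ {a x y n} → Unit a n → a * x ≅ a * y mod n → x ≅ y mod n
Unit-cancelˡ {a} {x} {y} {n} (e , p) q = begin
  x               ≡⟨ sym (ℤₚ.*-identityˡ x) ⟩
  + 1 * x         ≅⟨ *-congʳ x (≅-sym p) ⟩
  a * e * x       ≡⟨ lem a e x ⟩
  e * (a * x)     ≅⟨ *-congˡ e q ⟩
  e * (a * y)     ≡⟨ sym (lem a e y) ⟩
  a * e * y       ≅⟨ *-congʳ y p ⟩
  + 1 * y         ≡⟨ ℤₚ.*-identityˡ y ⟩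
  y ∎
  where
    open ≅-Reasoning n
    lem : ∀ a e x → a * e * x ≡ e * (a * x)
    lem = solve-∀

Unit-abs : ∀ {a n} → Unit a n → Unit (+ ∣ a ∣) n
Unit-abs {+ _}      u = u
Unit-abs { -[1+ _ ]} u = Unit-neg u

Unit-sign : ∀ a {n} → Unit (+ ∣ a ∣) n → Unit a n
Unit-sign (+ _)    u = u
Unit-sign -[1+ _ ] u = Unit-neg u

Unit-mod-sign : ∀ n {a} → Unit a (+ ∣ n ∣) → Unit a n
Unit-mod-sign n u = Unit-sym (Unit-sign n (Unit-sym u))

coprime⇒Unitℕ : ∀ {a n} → Coprimality.Coprime a n → Unit (+ a) (+ n)
coprime⇒Unitℕ {a} {n} c with Coprimality.coprime-Bézout c
... | Bézout.+- x y eq = + x , by (+ y) (trans (cast x a) (trans (cong +_ (sym eq)) (cong (_+_ (+ 1)) (ℤₚ.pos-* y n))))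
  where cast : ∀ x a → + a * + x ≡ + (x ℕ.* a)
        cast x a = trans (ℤₚ.*-comm (+ a) (+ x)) (sym (ℤₚ.pos-* x a))
... | Bézout.-+ x y eq = - + x , by (- + y) (trans (lem₁ (+ a) (+ x)) (trans (cong (λ z → + 1 - z) eq′) (lem₂ (+ y) (+ n))))
  where eq′ : + 1 + + x * + a ≡ + y * + n
        eq′ = trans (cong (_+_ (+ 1)) (sym (ℤₚ.pos-* x a))) (trans (cong +_ eq) (ℤₚ.pos-* y n))
        lem₁ : ∀ a x → a * (- x) ≡ + 1 - (+ 1 + x * a)
        lem₁ = solve-∀
        lem₂ : ∀ y n → + 1 - y * n ≡ + 1 + (- y) * n
        lem₂ = solve-∀

coprime⇒Unit : ∀ {a n} → Coprimality.Coprime ∣ a ∣ ∣ n ∣ → Unit a n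
coprime⇒Unit {a} {n} c = Unit-mod-sign n (Unit-sign a (coprime⇒Unitℕ c))

prime∤⇒Unit : ∀ {p a} → Prime p → ¬ (+ p ∣ a) → Unit a (+ p)
prime∤⇒Unit {p} {a} pr p∤a = coprime⇒Unit cop
  where
    cop : Coprimality.Coprime ∣ a ∣ p
    cop {zero} (d∣a , d∣p) = ⊥-elim (p∤a (ℕD.∣-trans (subst (ℕD._∣ 0) refl (p ℕD.∣0)) d∣a))
    cop {suc zero} _ = refl
    cop {suc (suc d)} (d∣a , d∣p) = [ (λ ()) , (λ e → ⊥-elim (p∤a (subst (ℕD._∣ ∣ a ∣) e d∣a))) ]′ (prime⇒irreducible pr d∣p)

Unit⇒∤ : ∀ {p a} → Prime p → Unit a (+ p) → ¬ (a ≅ + 0 mod + p)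
Unit⇒∤ {p} {a} pr (e , q) a≅0 = ¬prime[1] (subst Prime (ℕD.∣1⇒≡1 (≅0⇒∣ {+ p} {+ 1} one≅0)) pr)
  where
    open ≅-Reasoning (+ p)
    one≅0 : + 1 ≅ + 0 mod + p
    one≅0 = begin
      + 1     ≅⟨ ≅-sym q ⟩
      a * e   ≅⟨ *-congʳ e a≅0 ⟩
      + 0 * e ≡⟨ ℤₚ.*-zeroˡ e ⟩
      + 0 ∎

prime∤⇒Unit′ : ∀ {p a} → Prime p → ¬ (a ≅ + 0 mod + p) → Unit a (+ p)
prime∤⇒Unit′ pr ¬a = prime∤⇒Unit pr (¬a ∘ ∣⇒≅0)

-- The Gauss symbol

open module ∏ˢ = Sum Signₚ.*-commutativeMonoid using () renaming (sum to ∏ˢ)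
open module ∏ᶻ = Sum ℤₚ.*-1-commutativeMonoid using () renaming (sum to ∏ᶻ)

⟦_⟧ : Sign → ℤ
⟦ ⊕ ⟧ = + 1
⟦ ⊖ ⟧ = -[1+ 0 ]

⟦⟧-· : ∀ s t → ⟦ s · t ⟧ ≡ ⟦ s ⟧ * ⟦ t ⟧
⟦⟧-· ⊕ ⊕ = refl
⟦⟧-· ⊕ ⊖ = refl
⟦⟧-· ⊖ ⊕ = refl
⟦⟧-· ⊖ ⊖ = refl

⟦⟧-sq : ∀ s → ⟦ s ⟧ * ⟦ s ⟧ ≡ + 1
⟦⟧-sq ⊕ = refl
⟦⟧-sq ⊖ = refl

odd : ℕ → ℕ
odd h = suc (h ℕ.+ h)

-- The sign of the absolutely least residue modulo 2h + 1: the remainders h + 1, ..., 2h stand for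
-- -h, ..., -1.
sgn : ℕ → ℤ → Sign
sgn h x = if does (x ℤ.%ℕ odd h ℕ.≤? h) then ⊕ else ⊖

if-yes : ∀ {P A : Set} {a b : A} (d : Dec P) → P → (if does d then a else b) ≡ a
if-yes (yes _) p = refl
if-yes (no ¬p) p = ⊥-elim (¬p p)

if-no : ∀ {P A : Set} {a b : A} (d : Dec P) → ¬ P → (if does d then a else b) ≡ b
if-no (yes p) ¬p = ⊥-elim (¬p p)
if-no (no _)  ¬p = refl

≤⇒sgn : ∀ h {x r} → x ℤ.%ℕ odd h ≡ r → r ℕ.≤ h → sgn h x ≡ ⊕
≤⇒sgn h {x} refl r≤h = if-yes (x ℤ.%ℕ odd h ℕ.≤? h) r≤h

>⇒sgn : ∀ h {x r} → x ℤ.%ℕ odd h ≡ r → h ℕ.< r → sgn h x ≡ ⊖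
>⇒sgn h {x} refl r>h = if-no (x ℤ.%ℕ odd h ℕ.≤? h) (ℕₚ.<⇒≱ r>h)

sgn-cong : ∀ h {x y} → x ≅ y mod + odd h → sgn h x ≡ sgn h y
sgn-cong h {x} {y} e = cong (λ r → if does (r ℕ.≤? h) then ⊕ else ⊖)
  (%ℕ-unique {x} {odd h} (≅-trans e (%ℕ-≅ y (odd h))) (ℤDM.n%ℕd<d y (odd h)))

∣_∣₁ : ∀ {h} → Fin h → ℤ
∣ i ∣₁ = + suc (toℕ i)

-- Turns the sign into something read off from a congruence, so that later arguments need not look
-- at remainders.
sgn-unique : ∀ h {x} s (i : Fin h) → x ≅ ⟦ s ⟧ * ∣ i ∣₁ mod + odd h → sgn h x ≡ s
sgn-unique h {x} ⊕ i e = ≤⇒sgn h {x} (%ℕ-unique {x} {odd h} (≅-trans e (≅-reflexive (ℤₚ.*-identityˡ _)))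
  (s≤s (ℕₚ.≤-trans (Finₚ.toℕ<n i) (ℕₚ.m≤m+n h h)))) (Finₚ.toℕ<n i)
sgn-unique h {x} ⊖ i e = >⇒sgn h {x} (%ℕ-unique {x} {odd h} {odd h ℕ.∸ k} x≅ (s≤s (ℕₚ.m∸n≤m (h ℕ.+ h) (toℕ i))))
    (ℕₚ.m+n≤o⇒m≤o∸n (suc h) (s≤s (ℕₚ.+-monoʳ-≤ h (Finₚ.toℕ<n i))))
  where
    k = suc (toℕ i)
    lem : ∀ a b → -[1+ 0 ] * b ≡ (a - b) + -[1+ 0 ] * a
    lem = solve-∀
    n-k : + odd h - + k ≡ + (odd h ℕ.∸ k)
    n-k = trans (ℤₚ.m-n≡m⊖n (odd h) k) (ℤₚ.⊖-≥ (s≤s (ℕₚ.≤-trans (ℕₚ.<⇒≤ (Finₚ.toℕ<n i)) (ℕₚ.m≤m+n h h))))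
    x≅ : x ≅ + (odd h ℕ.∸ k) mod + odd h
    x≅ = ≅-trans e (by -[1+ 0 ] (trans (lem (+ odd h) (+ k)) (cong (_+ -[1+ 0 ] * + odd h) n-k)))

index : ∀ h {x} → ¬ (x ≅ + 0 mod + odd h) → Σ (Fin h) λ i → x ≅ ⟦ sgn h x ⟧ * ∣ i ∣₁ mod + odd h
index h {x} x≇0 = go (x ℤ.%ℕ odd h) refl
  where
    x≅ : ∀ {r} → x ℤ.%ℕ odd h ≡ r → x ≅ + r mod + odd h
    x≅ eq = subst (λ r → x ≅ + r mod + odd h) eq (%ℕ-≅ x (odd h))
    lem : ∀ r n → r ≡ -[1+ 0 ] * (n - r) + + 1 * n
    lem = solve-∀
    go : ∀ r → x ℤ.%ℕ odd h ≡ r → Σ (Fin h) λ i → x ≅ ⟦ sgn h x ⟧ * ∣ i ∣₁ mod + odd h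
    go zero eq = ⊥-elim (x≇0 (x≅ eq))
    go (suc r) eq with suc r ℕ.≤? h
    ... | yes r<h = fromℕ< r<h , subst (λ s → x ≅ ⟦ s ⟧ * ∣ fromℕ< r<h ∣₁ mod + odd h) (sym (≤⇒sgn h {x} eq r<h))
          (≅-trans (x≅ eq) (≅-reflexive (trans (cong (λ j → + suc j) (sym (Finₚ.toℕ-fromℕ< r<h))) (sym (ℤₚ.*-identityˡ _)))))
    ... | no r≮h = fromℕ< j<h , subst (λ s → x ≅ ⟦ s ⟧ * ∣ fromℕ< j<h ∣₁ mod + odd h) (sym (>⇒sgn h {x} eq (ℕₚ.≰⇒> r≮h)))
          (≅-trans (x≅ eq) (by (+ 1) (trans (lem (+ suc r) (+ odd h))
            (cong (λ z → -[1+ 0 ] * z + + 1 * + odd h) (trans n-r (cong (λ j → + suc j) (sym (Finₚ.toℕ-fromℕ< j<h))))))))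
      where
        r<n : suc r ℕ.< odd h
        r<n = subst (ℕ._< odd h) eq (ℤDM.n%ℕd<d x (odd h))
        j = h ℕ.+ h ℕ.∸ suc r
        j<h : j ℕ.< h
        j<h = ℕₚ.+-cancelʳ-≤ r (suc j) h (ℕₚ.≤-trans
          (ℕₚ.≤-reflexive (trans (sym (ℕₚ.+-suc j r)) (ℕₚ.m∸n+n≡m (ℕₚ.≤-pred r<n))))
          (ℕₚ.+-monoʳ-≤ h (ℕₚ.≤-pred (ℕₚ.≰⇒> r≮h))))
        n-r : + odd h - + suc r ≡ + suc j
        n-r = trans (ℤₚ.m-n≡m⊖n (odd h) (suc r)) (trans (ℤₚ.⊖-≥ (ℕₚ.<⇒≤ r<n)) (cong +_ (ℕₚ.+-∸-assoc 1 (ℕₚ.≤-pred r<n))))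

index-unique : ∀ h {x} s t (i j : Fin h) → x ≅ ⟦ s ⟧ * ∣ i ∣₁ mod + odd h → x ≅ ⟦ t ⟧ * ∣ j ∣₁ mod + odd h → i ≡ j
index-unique h {x} s t i j e f with trans (sym (sgn-unique h {x} s i e)) (sgn-unique h {x} t j f)
... | refl = Finₚ.toℕ-injective (ℕₚ.suc-injective (remainder-unique i≅j (bound i) (bound j)))
  where
    bound : ∀ (i : Fin h) → suc (toℕ i) ℕ.< odd h
    bound i = s≤s (ℕₚ.≤-trans (Finₚ.toℕ<n i) (ℕₚ.m≤m+n h h))
    sq : ∀ k → ⟦ s ⟧ * (⟦ s ⟧ * k) ≡ k
    sq k = trans (sym (ℤₚ.*-assoc ⟦ s ⟧ ⟦ s ⟧ k)) (trans (cong (_* k) (⟦⟧-sq s)) (ℤₚ.*-identityˡ k))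
    i≅j : ∣ i ∣₁ ≅ ∣ j ∣₁ mod + odd h
    i≅j = subst₂ (λ a b → a ≅ b mod + odd h) (sq ∣ i ∣₁) (sq ∣ j ∣₁) (*-congˡ ⟦ s ⟧ (≅-trans (≅-sym e) f))

-- J a h is the symbol (a / 2h+1): the second argument is not the modulus but its half.
J : ℤ → ℕ → Sign
J a h = ∏ˢ {h} (λ i → sgn h (a * ∣ i ∣₁))

J-cong : ∀ h {a b} → a ≅ b mod + odd h → J a h ≡ J b h
J-cong h {a} {b} e = ∏ˢ.sum-cong-≗ {h} (λ i → sgn-cong h {a * ∣ i ∣₁} (*-congʳ ∣ i ∣₁ e))

module Multiplier (h : ℕ) where
  n = + odd h

  nonzero : ∀ {a} → Unit a n → (i : Fin h) → ¬ (a * ∣ i ∣₁ ≅ + 0 mod n)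
  nonzero {a} u i e with remainder-unique {odd h} {suc (toℕ i)} {0}
      (Unit-cancelˡ u (≅-trans e (≅-reflexive (sym (ℤₚ.*-zeroʳ a)))))
      (s≤s (ℕₚ.≤-trans (Finₚ.toℕ<n i) (ℕₚ.m≤m+n h h))) (s≤s z≤n)
  ... | ()

  -- Multiplication by a on 1, ..., h with the signs forgotten; the next lemmas show that it is a
  -- permutation.
  π : ∀ {a} → Unit a n → Fin h → Fin h
  π {a} u i = proj₁ (index h {a * ∣ i ∣₁} (nonzero u i))

  π-≅ : ∀ {a} (u : Unit a n) i → a * ∣ i ∣₁ ≅ ⟦ sgn h (a * ∣ i ∣₁) ⟧ * ∣ π u i ∣₁ mod n
  π-≅ {a} u i = proj₂ (index h {a * ∣ i ∣₁} (nonzero u i))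

  composite : ∀ {a b} (u : Unit a n) i → b * a * ∣ i ∣₁ ≅ ⟦ sgn h (a * ∣ i ∣₁) ⟧ * (b * ∣ π u i ∣₁) mod n
  composite {a} {b} u i = ≅-trans (≅-reflexive (ℤₚ.*-assoc b a ∣ i ∣₁))
    (≅-trans (*-congˡ b (π-≅ u i)) (≅-reflexive (lem b ⟦ sgn h (a * ∣ i ∣₁) ⟧ ∣ π u i ∣₁)))
    where lem : ∀ b s k → b * (s * k) ≡ s * (b * k)
          lem = solve-∀

  -- Signs multiply along a composition. This cocycle relation yields both the bijectivity of `π`
  -- and the multiplicativity of `J`.
  π-composite : ∀ {a b} (u : Unit a n) (v : Unit b n) i →
    b * a * ∣ i ∣₁ ≅ ⟦ sgn h (a * ∣ i ∣₁) · sgn h (b * ∣ π u i ∣₁) ⟧ * ∣ π v (π u i) ∣₁ mod n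
  π-composite {a} {b} u v i = ≅-trans (composite {a} {b} u i) (≅-trans (*-congˡ s (π-≅ v (π u i)))
      (≅-reflexive (trans (sym (ℤₚ.*-assoc s t _)) (cong (_* ∣ π v (π u i) ∣₁) (sym (⟦⟧-· (sgn h (a * ∣ i ∣₁)) _))))))
    where s = ⟦ sgn h (a * ∣ i ∣₁) ⟧
          t = ⟦ sgn h (b * ∣ π u i ∣₁) ⟧

  π-inverse : ∀ {a b} (u : Unit a n) (v : Unit b n) → b * a ≅ + 1 mod n → ∀ i → π v (π u i) ≡ i
  π-inverse {a} {b} u v e i = index-unique h {∣ i ∣₁} s ⊕ (π v (π u i)) i
      (≅-trans (≅-sym (≅-trans (*-congʳ ∣ i ∣₁ e) (≅-reflexive (ℤₚ.*-identityˡ ∣ i ∣₁)))) (π-composite u v i))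
      (≅-reflexive (sym (ℤₚ.*-identityˡ ∣ i ∣₁)))
    where s = sgn h (a * ∣ i ∣₁) · sgn h (b * ∣ π u i ∣₁)

  Unit-inv : ∀ {a} (u : Unit a n) → Unit (Unit.inv u) n
  Unit-inv {a} (e , q) = a , ≅-trans (≅-reflexive (ℤₚ.*-comm e a)) q

  π-perm : ∀ {a} → Unit a n → Permutation h h
  π-perm {a} u@(e , q) = permutation (π u) (π v)
      (λ i → π-inverse v u q i)
      (λ i → π-inverse u v (≅-trans (≅-reflexive (ℤₚ.*-comm e a)) q) i)
    where v = Unit-inv u

  -- The sign of bak is that of ak times that of b·π(k); over all k the second factors give `J b h`
  -- reindexed by the permutation.
  J-* : ∀ {a b} → Unit a n → Unit b n → J (b * a) h ≡ J a h · J b h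
  J-* {a} {b} u v = begin
    J (b * a) h
      ≡⟨ ∏ˢ.sum-cong-≗ {h} (λ i → sgn-unique h {b * a * ∣ i ∣₁} _ (π v (π u i)) (π-composite u v i)) ⟩
    ∏ˢ {h} (λ i → sgn h (a * ∣ i ∣₁) · sgn h (b * ∣ π u i ∣₁))
      ≡⟨ ∏ˢ.∑-distrib-+ {h} (λ i → sgn h (a * ∣ i ∣₁)) (λ i → sgn h (b * ∣ π u i ∣₁)) ⟩
    J a h · ∏ˢ {h} (λ i → sgn h (b * ∣ π u i ∣₁))
      ≡⟨ cong (J a h ·_) (sym (∏ˢ.sum-permute (λ i → sgn h (b * ∣ i ∣₁)) (π-perm u))) ⟩
    J a h · J b h ∎
    where open ≡-Reasoning

  ∏ᶻ-cong : ∀ k {f g : Fin k → ℤ} → (∀ i → f i ≅ g i mod n) → ∏ᶻ f ≅ ∏ᶻ g mod n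
  ∏ᶻ-cong zero e = ≅-refl
  ∏ᶻ-cong (suc k) e = *-cong (e Fin.zero) (∏ᶻ-cong k (e ∘ Fin.suc))

  ∏ᶻ-sign : ∀ k (f : Fin k → Sign) → ∏ᶻ (λ i → ⟦ f i ⟧) ≡ ⟦ ∏ˢ f ⟧
  ∏ᶻ-sign zero f = refl
  ∏ᶻ-sign (suc k) f = trans (cong (⟦ f Fin.zero ⟧ *_) (∏ᶻ-sign k (f ∘ Fin.suc))) (sym (⟦⟧-· (f Fin.zero) _))

  ∏ᶻ-const : ∀ k a → ∏ᶻ {k} (λ _ → a) ≡ a ^ k
  ∏ᶻ-const zero a = refl
  ∏ᶻ-const (suc k) a = cong (a *_) (∏ᶻ-const k a)

  ∏ᶻ-unit : ∀ k {f : Fin k → ℤ} → (∀ i → Unit (f i) n) → Unit (∏ᶻ f) n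
  ∏ᶻ-unit zero us = Unit-1 n
  ∏ᶻ-unit (suc k) us = Unit-* (us Fin.zero) (∏ᶻ-unit k (us ∘ Fin.suc))

  -- Gauss's lemma: the product of all ak is a^h · h!, and also the product of the signs times h! in
  -- permuted order. For prime modulus h! can be cancelled.
  gauss : Prime (odd h) → ∀ {a} → Unit a n → a ^ h ≅ ⟦ J a h ⟧ mod n
  gauss pr {a} u = Unit-cancelˡ {h!} (∏ᶻ-unit h (λ i → prime∤⇒Unit′ pr (λ e → nonzero (Unit-1 n) i (≅-trans (≅-reflexive (ℤₚ.*-identityˡ _)) e)))) (begin
    h! * a ^ h                                     ≡⟨ ℤₚ.*-comm h! (a ^ h) ⟩
    a ^ h * h!                                     ≡⟨ cong (_* h!) (sym (∏ᶻ-const h a)) ⟩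
    ∏ᶻ {h} (λ _ → a) * h!                          ≡⟨ sym (∏ᶻ.∑-distrib-+ {h} (λ _ → a) ∣_∣₁) ⟩
    ∏ᶻ {h} (λ i → a * ∣ i ∣₁)                      ≅⟨ ∏ᶻ-cong h (π-≅ u) ⟩
    ∏ᶻ {h} (λ i → ⟦ sgn h (a * ∣ i ∣₁) ⟧ * ∣ π u i ∣₁) ≡⟨ ∏ᶻ.∑-distrib-+ {h} (λ i → ⟦ sgn h (a * ∣ i ∣₁) ⟧) (λ i → ∣ π u i ∣₁) ⟩
    ∏ᶻ {h} (λ i → ⟦ sgn h (a * ∣ i ∣₁) ⟧) * ∏ᶻ {h} (λ i → ∣ π u i ∣₁)
      ≡⟨ cong₂ _*_ (∏ᶻ-sign h (λ i → sgn h (a * ∣ i ∣₁))) (sym (∏ᶻ.sum-permute ∣_∣₁ (π-perm u))) ⟩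
    ⟦ J a h ⟧ * h!                                 ≡⟨ ℤₚ.*-comm ⟦ J a h ⟧ h! ⟩
    h! * ⟦ J a h ⟧ ∎)
    where
      open ≅-Reasoning n
      h! = ∏ᶻ {h} ∣_∣₁

open Multiplier using (gauss)

J-* : ∀ h {a b} → Unit a (+ odd h) → Unit b (+ odd h) → J (a * b) h ≡ J a h · J b h
J-* h {a} {b} u v = trans (Multiplier.J-* h v u) (Signₚ.*-comm (J b h) (J a h))

J-square : ∀ h {a} → Unit a (+ odd h) → J (a * a) h ≡ ⊕
J-square h {a} u = trans (J-* h u u) (Signₚ.s*s≡+ (J a h))

par : ℕ → Sign
par zero    = ⊕
par (suc k) = ⊖ · par k

par-+ : ∀ j k → par (j ℕ.+ k) ≡ par j · par k
par-+ zero k = refl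
par-+ (suc j) k = trans (cong (⊖ ·_) (par-+ j k)) (sym (Signₚ.*-assoc ⊖ (par j) (par k)))

par-double : ∀ k → par (k ℕ.+ k) ≡ ⊕
par-double k = trans (par-+ k k) (Signₚ.s*s≡+ (par k))

∏ˢ-⊖ : ∀ k → ∏ˢ {k} (λ _ → ⊖) ≡ par k
∏ˢ-⊖ zero = refl
∏ˢ-⊖ (suc k) = cong (⊖ ·_) (∏ˢ-⊖ k)

∏ˢ-⊕ : ∀ k → ∏ˢ {k} (λ _ → ⊕) ≡ ⊕
∏ˢ-⊕ zero = refl
∏ˢ-⊕ (suc k) = ∏ˢ-⊕ k

J-1 : ∀ h → J (+ 1) h ≡ ⊕
J-1 h = trans (∏ˢ.sum-cong-≗ {h} (λ i → sgn-unique h {+ 1 * ∣ i ∣₁} ⊕ i ≅-refl)) (∏ˢ-⊕ h)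

J-minus-1 : ∀ h → J -[1+ 0 ] h ≡ par h
J-minus-1 h = trans (∏ˢ.sum-cong-≗ {h} (λ i → sgn-unique h { -[1+ 0 ] * ∣ i ∣₁} ⊖ i ≅-refl)) (∏ˢ-⊖ h)

-- Reciprocity

-- The sign of x - y without subtraction; a tie counts as ⊕, and `lt-swap` excludes ties.
lt : ℕ → ℕ → Sign
lt x y = if does (x ℕ.<? y) then ⊖ else ⊕

<⇒lt : ∀ {x y} → x ℕ.< y → lt x y ≡ ⊖
<⇒lt {x} {y} = if-yes (x ℕ.<? y)

≥⇒lt : ∀ {x y} → y ℕ.≤ x → lt x y ≡ ⊕
≥⇒lt {x} {y} y≤x = if-no (x ℕ.<? y) (ℕₚ.≤⇒≯ y≤x)

lt-swap : ∀ {x y} → x ≢ y → lt x y ≡ ⊖ · lt y x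
lt-swap {x} {y} x≢y with ℕₚ.<-cmp x y
... | tri< x<y _ _ = trans (<⇒lt x<y) (cong (⊖ ·_) (sym (≥⇒lt (ℕₚ.<⇒≤ x<y))))
... | tri≈ _ x≡y _ = ⊥-elim (x≢y x≡y)
... | tri> _ _ x>y = trans (≥⇒lt (ℕₚ.<⇒≤ x>y)) (cong (⊖ ·_) (sym (<⇒lt x>y)))

∏ˢ-threshold : ∀ u (f : ℕ → Sign) g → g ℕ.≤ u → (∀ l → l ℕ.< g → f l ≡ ⊖) → (∀ l → g ℕ.≤ l → f l ≡ ⊕) →
  ∏ˢ {u} (f ∘ toℕ) ≡ par g
∏ˢ-threshold u f zero g≤u below above = trans (∏ˢ.sum-cong-≗ {u} (λ i → above (toℕ i) z≤n)) (∏ˢ-⊕ u)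
∏ˢ-threshold (suc u) f (suc g) (s≤s g≤u) below above = cong₂ _·_ (below 0 (s≤s z≤n))
  (∏ˢ-threshold u (f ∘ suc) g g≤u (λ l l<g → below (suc l) (s≤s l<g)) (λ l g≤l → above (suc l) (s≤s g≤l)))

double : ℕ → ℕ
double x = x ℕ.+ x

double-mono : ∀ {x y} → x ℕ.≤ y → double x ℕ.≤ double y
double-mono x≤y = ℕₚ.+-mono-≤ x≤y x≤y

double-cancel-≤ : ∀ {x y} → double x ℕ.≤ suc (double y) → x ℕ.≤ y
double-cancel-≤ {x} {y} le = ℕₚ.≮⇒≥ λ y<x →
  ℕₚ.<⇒≱ (s≤s (ℕₚ.≤-trans (ℕₚ.≤-reflexive (sym (ℕₚ.+-suc y y))) (ℕₚ.+-monoʳ-≤ y (ℕₚ.≤-refl {suc y}))))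
    (ℕₚ.≤-trans (double-mono y<x) le)

-- With (k+1)a = r + f n, the sign s₁ is negative for exactly f values of l, and s₂ for u − f or u − f − 1
-- of them according as r < n/2 or r > n/2; so the row product detects in which half r lies.
module Row (u h k : ℕ) (k<h : k ℕ.< h) (r f : ℕ) (z≡ : suc k ℕ.* odd u ≡ r ℕ.+ f ℕ.* odd h) (r>0 : 0 ℕ.< r) (r<n : r ℕ.< odd h) where
  n = odd h
  z = suc k ℕ.* odd u

  s₁ s₂ : ℕ → Sign
  s₁ l = lt (suc l ℕ.* n) z
  s₂ l = lt (double (z ℕ.+ suc l ℕ.* n)) (odd u ℕ.* n)

  -- As k + 1 ≤ h, twice z is at most (n - 1) · `odd u`. This keeps both thresholds within the u
  -- cells of the row.
  2z< : double z ℕ.< odd u ℕ.* n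
  2z< = ℕₚ.<-≤-trans (ℕₚ.≤-<-trans (double-mono (ℕₚ.*-monoˡ-≤ (odd u) k<h)) (ℕₚ.m≤n+m (suc (double (h ℕ.* odd u))) (u ℕ.+ u)))
     (ℕₚ.≤-reflexive (lem u h))
    where lem : ∀ u h → (u ℕ.+ u) ℕ.+ suc (h ℕ.* suc (u ℕ.+ u) ℕ.+ h ℕ.* suc (u ℕ.+ u)) ≡ suc (u ℕ.+ u) ℕ.* suc (h ℕ.+ h)
          lem = ℕ-Solver.solve-∀

  f*n≤z : f ℕ.* n ℕ.≤ z
  f*n≤z = ℕₚ.≤-trans (ℕₚ.m≤n+m (f ℕ.* n) r) (ℕₚ.≤-reflexive (sym z≡))

  f≤u : f ℕ.≤ u
  f≤u = double-cancel-≤ (ℕₚ.<⇒≤ (ℕₚ.*-cancelʳ-< n (double f) (odd u)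
    (ℕₚ.≤-<-trans (ℕₚ.≤-trans (ℕₚ.≤-reflexive (ℕₚ.*-distribʳ-+ n f f)) (double-mono f*n≤z)) 2z<)))

  ∏s₁ : ∏ˢ {u} (s₁ ∘ toℕ) ≡ par f
  ∏s₁ = ∏ˢ-threshold u s₁ f f≤u
    (λ l l<f → <⇒lt (ℕₚ.≤-<-trans (ℕₚ.*-monoˡ-≤ n l<f) (ℕₚ.<-≤-trans (ℕₚ.m<n+m (f ℕ.* n) r>0) (ℕₚ.≤-reflexive (sym z≡)))))
    (λ l f≤l → ≥⇒lt (ℕₚ.≤-trans (ℕₚ.≤-reflexive z≡) (ℕₚ.≤-trans (ℕₚ.+-monoˡ-≤ (f ℕ.* n) (ℕₚ.<⇒≤ r<n)) (ℕₚ.*-monoˡ-≤ n (s≤s f≤l)))))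

  z+ : ∀ l → double (z ℕ.+ suc l ℕ.* n) ≡ double r ℕ.+ double ((suc (f ℕ.+ l)) ℕ.* n)
  z+ l = trans (cong (λ z → double (z ℕ.+ suc l ℕ.* n)) z≡) (lem r f l n)
    where lem : ∀ r f l n → (r ℕ.+ f ℕ.* n ℕ.+ suc l ℕ.* n) ℕ.+ (r ℕ.+ f ℕ.* n ℕ.+ suc l ℕ.* n) ≡ (r ℕ.+ r) ℕ.+ (suc (f ℕ.+ l) ℕ.* n ℕ.+ suc (f ℕ.+ l) ℕ.* n)
          lem = ℕ-Solver.solve-∀

  an : odd u ℕ.* n ≡ n ℕ.+ double (u ℕ.* n)
  an = cong (n ℕ.+_) (ℕₚ.*-distribʳ-+ n u u)

  -- The factor is negative when 2r + 2(f + l + 1)n < n + 2un. Since 2r < n, this means f + l + 1 ≤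
  -- u.
  ∏s₂-≤ : r ℕ.≤ h → ∏ˢ {u} (s₂ ∘ toℕ) ≡ par (u ℕ.∸ f)
  ∏s₂-≤ r≤h = ∏ˢ-threshold u s₂ (u ℕ.∸ f) (ℕₚ.m∸n≤m u f)
    (λ l l<e → <⇒lt (subst₂ ℕ._<_ (sym (z+ l)) (sym an)
       (ℕₚ.+-mono-<-≤ (s≤s (double-mono r≤h)) (double-mono (ℕₚ.*-monoˡ-≤ n (small l l<e))))))
    (λ l e≤l → ≥⇒lt (subst₂ ℕ._≤_ (sym an) (sym (z+ l))
       (ℕₚ.≤-trans (ℕₚ.+-monoˡ-≤ _ (ℕₚ.m≤m+n n n)) (ℕₚ.≤-trans (ℕₚ.≤-reflexive (lem n u))
         (ℕₚ.≤-trans (double-mono (ℕₚ.*-monoˡ-≤ n (s≤s (ℕₚ.≤-trans (ℕₚ.m≤n+m∸n u f) (ℕₚ.+-monoʳ-≤ f e≤l))))) (ℕₚ.m≤n+m _ (double r)))))))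
    where
      small : ∀ l → l ℕ.< u ℕ.∸ f → suc (f ℕ.+ l) ℕ.≤ u
      small l l<e = subst₂ ℕ._≤_ (ℕₚ.+-suc f l) (ℕₚ.m+[n∸m]≡n f≤u) (ℕₚ.+-monoʳ-≤ f l<e)
      lem : ∀ n u → (n ℕ.+ n) ℕ.+ (u ℕ.* n ℕ.+ u ℕ.* n) ≡ suc u ℕ.* n ℕ.+ suc u ℕ.* n
      lem = ℕ-Solver.solve-∀

  -- Here 2r > n, so f ≥ u would give 2z ≥ n + 2un, against `2z<`. Hence u - f - 1 is not truncated.
  f<u : h ℕ.< r → f ℕ.< u
  f<u h<r = ℕₚ.≰⇒> λ u≤f → ℕₚ.<⇒≱ 2z< (subst₂ ℕ._≤_ (sym an) (sym 2z)
      (ℕₚ.+-mono-≤ (n≤2r h<r) (double-mono (ℕₚ.*-monoˡ-≤ n u≤f))))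
    where
      n≤2r : h ℕ.< r → n ℕ.≤ double r
      n≤2r h<r = ℕₚ.≤-trans (s≤s (ℕₚ.+-monoʳ-≤ h (ℕₚ.n≤1+n h))) (double-mono h<r)
      lem : ∀ a b → (a ℕ.+ b) ℕ.+ (a ℕ.+ b) ≡ (a ℕ.+ a) ℕ.+ (b ℕ.+ b)
      lem = ℕ-Solver.solve-∀
      2z : double z ≡ double r ℕ.+ double (f ℕ.* n)
      2z = trans (cong double z≡) (lem r (f ℕ.* n))

  ∏s₂-> : h ℕ.< r → ∏ˢ {u} (s₂ ∘ toℕ) ≡ par (u ℕ.∸ suc f)
  ∏s₂-> h<r = ∏ˢ-threshold u s₂ (u ℕ.∸ suc f) (ℕₚ.m∸n≤m u (suc f))
    (λ l l<e → <⇒lt (subst₂ ℕ._<_ (sym (z+ l)) (sym an)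
       (s≤s (ℕₚ.≤-trans (ℕₚ.+-monoˡ-≤ _ (double-mono (ℕₚ.<⇒≤ r<n)))
         (ℕₚ.≤-trans (ℕₚ.≤-reflexive (lem n (suc (f ℕ.+ l)))) (ℕₚ.≤-trans (double-mono (ℕₚ.*-monoˡ-≤ n (small l l<e))) (ℕₚ.m≤n+m _ (h ℕ.+ h))))))))
    (λ l e≤l → ≥⇒lt (subst₂ ℕ._≤_ (sym an) (sym (z+ l))
       (ℕₚ.+-mono-≤ (ℕₚ.≤-trans (s≤s (ℕₚ.+-monoʳ-≤ h (ℕₚ.n≤1+n h))) (double-mono h<r)) (double-mono (ℕₚ.*-monoˡ-≤ n (ℕₚ.≤-trans (ℕₚ.m≤n+m∸n u (suc f)) (ℕₚ.+-monoʳ-≤ (suc f) e≤l)))))))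
    where
      small : ∀ l → l ℕ.< u ℕ.∸ suc f → suc (suc (f ℕ.+ l)) ℕ.≤ u
      small l l<e = subst₂ ℕ._≤_ (ℕₚ.+-suc (suc f) l) (ℕₚ.m+[n∸m]≡n (f<u h<r)) (ℕₚ.+-monoʳ-≤ (suc f) l<e)
      lem : ∀ n g → (n ℕ.+ n) ℕ.+ (g ℕ.* n ℕ.+ g ℕ.* n) ≡ suc g ℕ.* n ℕ.+ suc g ℕ.* n
      lem = ℕ-Solver.solve-∀

  row : ∏ˢ {u} (λ i → s₁ (toℕ i) · s₂ (toℕ i)) ≡ par u · sgn h (+ z)
  row with r ℕ.≤? h
  ... | yes r≤h = trans (∏ˢ.∑-distrib-+ {u} (s₁ ∘ toℕ) (s₂ ∘ toℕ)) (trans (cong₂ _·_ ∏s₁ (∏s₂-≤ r≤h))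
        (trans (sym (par-+ f (u ℕ.∸ f))) (trans (cong par (ℕₚ.m+[n∸m]≡n f≤u))
        (trans (sym (Signₚ.*-identityʳ (par u))) (cong (par u ·_) (sym (≤⇒sgn h {+ z} z%n r≤h)))))))
    where z%n : (+ z) ℤ.%ℕ n ≡ r
          z%n = %ℕ-unique {+ z} {n} (by (+ f) (trans (cong +_ z≡) (cong (_+_ (+ r)) (ℤₚ.pos-* f n)))) r<n
  ... | no r≰h = trans (∏ˢ.∑-distrib-+ {u} (s₁ ∘ toℕ) (s₂ ∘ toℕ)) (trans (cong₂ _·_ ∏s₁ (∏s₂-> (ℕₚ.≰⇒> r≰h)))
        (trans (sym (par-+ f (u ℕ.∸ suc f))) (trans (sgn-flip (f ℕ.+ (u ℕ.∸ suc f)))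
        (trans (cong (λ w → ⊖ · par w) (ℕₚ.m+[n∸m]≡n (f<u (ℕₚ.≰⇒> r≰h)))) (trans (Signₚ.*-comm ⊖ (par u)) (cong (par u ·_) (sym (>⇒sgn h {+ z} z%n (ℕₚ.≰⇒> r≰h)))))))))
    where z%n : (+ z) ℤ.%ℕ n ≡ r
          z%n = %ℕ-unique {+ z} {n} (by (+ f) (trans (cong +_ z≡) (cong (_+_ (+ r)) (ℤₚ.pos-* f n)))) r<n
          sgn-flip : ∀ w → par w ≡ ⊖ · par (suc w)
          sgn-flip w = trans (sym (cong (_· par w) (Signₚ.s*s≡+ ⊖))) (Signₚ.*-assoc ⊖ ⊖ (par w))

module _ (u h : ℕ) (unit : Unit (+ odd u) (+ odd h)) where
  private
    a = odd u
    n = odd h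
    K*a : Fin h → ℕ
    K*a k = suc (toℕ k) ℕ.* a

  K*a≡ : ∀ k → + K*a k ≡ + a * ∣ k ∣₁
  K*a≡ k = trans (ℤₚ.pos-* (suc (toℕ k)) a) (ℤₚ.*-comm (+ suc (toℕ k)) (+ a))

  K*a%n>0 : ∀ k → 0 ℕ.< K*a k ℕ.% n
  K*a%n>0 k with K*a k ℕ.% n in eq
  ... | suc _ = s≤s z≤n
  ... | zero = ⊥-elim (Multiplier.nonzero h unit k (subst (λ x → x ≅ + 0 mod + n) (K*a≡ k)
                 (subst (λ r → + K*a k ≅ + r mod + n) eq (%ℕ-≅ (+ K*a k) n))))

  -- Each row contributes the constant `par u` besides its Gauss sign. The lemma is used twice in
  -- `reciprocity`, with u and h exchanged.
  grid : ∏ˢ {h} (λ k → ∏ˢ {u} (λ i → lt (suc (toℕ i) ℕ.* n) (K*a k) · lt (double (K*a k ℕ.+ suc (toℕ i) ℕ.* n)) (a ℕ.* n)))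
       ≡ par (h ℕ.* u) · J (+ a) h
  grid = begin
    _ ≡⟨ ∏ˢ.sum-cong-≗ {h} (λ k → trans (Row.row u h (toℕ k) (Finₚ.toℕ<n k) (K*a k ℕ.% n) (K*a k ℕ./ n)
            (ℕDM.m≡m%n+[m/n]*n (K*a k) n) (K*a%n>0 k) (ℕDM.m%n<n (K*a k) n)) (cong (λ x → par u · sgn h x) (K*a≡ k))) ⟩
    ∏ˢ {h} (λ k → par u · sgn h (+ a * ∣ k ∣₁))  ≡⟨ ∏ˢ.∑-distrib-+ {h} (λ _ → par u) (λ k → sgn h (+ a * ∣ k ∣₁)) ⟩
    ∏ˢ {h} (λ _ → par u) · J (+ a) h  ≡⟨ cong (_· J (+ a) h) (const h) ⟩
    par (h ℕ.* u) · J (+ a) h ∎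
    where
      open ≡-Reasoning
      const : ∀ h → ∏ˢ {h} (λ _ → par u) ≡ par (h ℕ.* u)
      const zero = refl
      const (suc h) = trans (cong (par u ·_) (const h)) (sym (par-+ u (h ℕ.* u)))

-- Transposing the grid leaves the second factor of a cell unchanged and reverses the sign of in -
-- ka, which is never 0. So the grids of (a, n) and (n, a) differ by one sign for each of the u·h
-- cells.
reciprocity : ∀ u h → Unit (+ odd u) (+ odd h) → J (+ odd u) h ≡ par (u ℕ.* h) · J (+ odd h) u
reciprocity u h unit = Signₚ.*-cancelˡ-≡ (par (h ℕ.* u)) _ _ (begin
  par (h ℕ.* u) · J (+ a) h
    ≡⟨ sym (grid u h unit) ⟩
  ∏ˢ {h} (λ k → ∏ˢ {u} (λ i → lt (N i) (A k) · lt (double (A k ℕ.+ N i)) (a ℕ.* n)))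
    ≡⟨ ∏ˢ.∑-comm {h} {u} _ ⟩
  ∏ˢ {u} (λ i → ∏ˢ {h} (λ k → lt (N i) (A k) · lt (double (A k ℕ.+ N i)) (a ℕ.* n)))
    ≡⟨ ∏ˢ.sum-cong-≗ {u} (λ i → ∏ˢ.sum-cong-≗ {h} (λ k → cell i k)) ⟩
  ∏ˢ {u} (λ i → ∏ˢ {h} (λ k → ⊖ · (lt (A k) (N i) · lt (double (N i ℕ.+ A k)) (n ℕ.* a))))
    ≡⟨ ∏ˢ.sum-cong-≗ {u} (λ i → trans (∏ˢ.∑-distrib-+ {h} (λ _ → ⊖) (λ k → lt (A k) (N i) · lt (double (N i ℕ.+ A k)) (n ℕ.* a))) (cong (_· ∏ˢ {h} (λ k → lt (A k) (N i) · lt (double (N i ℕ.+ A k)) (n ℕ.* a))) (∏ˢ-⊖ h))) ⟩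
  ∏ˢ {u} (λ i → par h · ∏ˢ {h} (λ k → lt (A k) (N i) · lt (double (N i ℕ.+ A k)) (n ℕ.* a)))
    ≡⟨ ∏ˢ.∑-distrib-+ {u} (λ _ → par h) (λ i → ∏ˢ {h} (λ k → lt (A k) (N i) · lt (double (N i ℕ.+ A k)) (n ℕ.* a))) ⟩
  ∏ˢ {u} (λ _ → par h) · ∏ˢ {u} (λ i → ∏ˢ {h} (λ k → lt (A k) (N i) · lt (double (N i ℕ.+ A k)) (n ℕ.* a)))
    ≡⟨ cong₂ _·_ (const u) (grid h u (Unit-sym unit)) ⟩
  par (u ℕ.* h) · (par (u ℕ.* h) · J (+ n) u)
    ≡⟨ cong (λ m → par m · (par (u ℕ.* h) · J (+ n) u)) (ℕₚ.*-comm u h) ⟩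
  par (h ℕ.* u) · (par (u ℕ.* h) · J (+ n) u) ∎)
  where
    open ≡-Reasoning
    a = odd u
    n = odd h
    A : Fin h → ℕ
    A k = suc (toℕ k) ℕ.* a
    N : Fin u → ℕ
    N i = suc (toℕ i) ℕ.* n
    N≢A : ∀ i k → N i ≢ A k
    N≢A i k eq = Multiplier.nonzero h unit k (subst (λ x → x ≅ + 0 mod + n) (K*a≡ u h unit k)
      (subst (λ x → + x ≅ + 0 mod + n) eq (by ∣ i ∣₁ (trans (ℤₚ.pos-* (suc (toℕ i)) n) (sym (ℤₚ.+-identityˡ _))))))
    cell : ∀ i k → lt (N i) (A k) · lt (double (A k ℕ.+ N i)) (a ℕ.* n) ≡ ⊖ · (lt (A k) (N i) · lt (double (N i ℕ.+ A k)) (n ℕ.* a))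
    cell i k = trans (cong₂ _·_ (lt-swap (N≢A i k)) (cong₂ (λ x y → lt (double x) y) (ℕₚ.+-comm (A k) (N i)) (ℕₚ.*-comm a n)))
                     (Signₚ.*-assoc ⊖ (lt (A k) (N i)) _)
    const : ∀ u → ∏ˢ {u} (λ _ → par h) ≡ par (u ℕ.* h)
    const zero = refl
    const (suc u) = trans (cong (par h ·_) (const u)) (sym (par-+ h (u ℕ.* h)))

-- The symbol of 2

Unit-2 : ∀ h → Unit (+ 2) (+ odd h)
Unit-2 h = + suc h , by (+ 1) (trans (sym (ℤₚ.pos-* 2 (suc h))) (trans (cong +_ (lem h)) (cong (_+_ (+ 1)) (sym (ℤₚ.*-identityˡ (+ odd h))))))
  where lem : ∀ h → 2 ℕ.* suc h ≡ 1 ℕ.+ suc (h ℕ.+ h)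
        lem = ℕ-Solver.solve-∀

odd-suc : ∀ h → odd (suc h) ≡ 2 ℕ.+ odd h
odd-suc h = cong (suc ∘ suc) (ℕₚ.+-suc h h)

-- This is h(h + 1)/2 = (n² - 1)/8 for n = 2h + 1, the exponent in the supplementary law.
triangle : ℕ → ℕ
triangle zero    = zero
triangle (suc h) = suc h ℕ.+ triangle h

par-*-suc : ∀ h → par (h ℕ.* suc h) ≡ ⊕
par-*-suc zero = refl
par-*-suc (suc h) = trans (cong par (lem h)) (trans (par-+ (h ℕ.* suc h) (suc h ℕ.+ suc h)) (cong₂ _·_ (par-*-suc h) (par-double (suc h))))
  where lem : ∀ h → suc h ℕ.* suc (suc h) ≡ h ℕ.* suc h ℕ.+ (suc h ℕ.+ suc h)
        lem = ℕ-Solver.solve-∀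

-- Quadratic reciprocity for the pair (n − 2, n) turns the symbol of 2 modulo n into its symbol modulo n − 2.
J-2 : ∀ h → J (+ 2) h ≡ par (triangle h)
J-2 zero = refl
J-2 (suc h) = begin
  J (+ 2) (suc h)                               ≡⟨ J-cong (suc h) {+ 2} { -[1+ 0 ] * + odd h} 2≅ ⟩
  J (-[1+ 0 ] * + odd h) (suc h)                ≡⟨ J-* (suc h) (Unit-neg (Unit-1 _)) unit ⟩
  J -[1+ 0 ] (suc h) · J (+ odd h) (suc h)      ≡⟨ cong₂ _·_ (J-minus-1 (suc h)) (reciprocity h (suc h) unit) ⟩
  par (suc h) · (par (h ℕ.* suc h) · J (+ odd (suc h)) h)
    ≡⟨ cong (par (suc h) ·_) (cong₂ _·_ (par-*-suc h) (trans (J-cong h n≅2) (J-2 h))) ⟩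
  par (suc h) · par (triangle h)                ≡⟨ sym (par-+ (suc h) (triangle h)) ⟩
  par (triangle (suc h)) ∎
  where
    open ≡-Reasoning
    n≡ : + odd (suc h) ≡ + 2 + + odd h
    n≡ = cong +_ (odd-suc h)
    n≅2 : + odd (suc h) ≅ + 2 mod + odd h
    n≅2 = by (+ 1) (trans n≡ (cong (_+_ (+ 2)) (sym (ℤₚ.*-identityˡ (+ odd h)))))
    unit : Unit (+ odd h) (+ odd (suc h))
    unit = Unit-sym (Unit-≅ (≅-sym n≅2) (Unit-2 h))
    lem : ∀ m → + 2 ≡ -[1+ 0 ] * m + + 1 * (+ 2 + m)
    lem = solve-∀
    2≅ : + 2 ≅ -[1+ 0 ] * + odd h mod + odd (suc h)
    2≅ = by (+ 1) (trans (lem (+ odd h)) (cong (λ z → -[1+ 0 ] * + odd h + + 1 * z) (sym n≡)))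

-- Multiplicativity in the modulus

infixl 7 _⊛_
-- The product of odd numbers in terms of their halves, since `J` takes the half of its modulus.
_⊛_ : ℕ → ℕ → ℕ
g ⊛ h = g ℕ.+ h ℕ.+ double (g ℕ.* h)

odd-⊛ : ∀ g h → odd (g ⊛ h) ≡ odd g ℕ.* odd h
odd-⊛ = lem
  where lem : ∀ g h → suc ((g ℕ.+ h ℕ.+ (g ℕ.* h ℕ.+ g ℕ.* h)) ℕ.+ (g ℕ.+ h ℕ.+ (g ℕ.* h ℕ.+ g ℕ.* h))) ≡ suc (g ℕ.+ g) ℕ.* suc (h ℕ.+ h)
        lem = ℕ-Solver.solve-∀

+odd-⊛ : ∀ g h → + odd (g ⊛ h) ≡ + odd g * + odd h
+odd-⊛ g h = trans (cong +_ (odd-⊛ g h)) (ℤₚ.pos-* (odd g) (odd h))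

data Parity : ℕ → Set where
  isEven : ∀ w → Parity (double w)
  isOdd  : ∀ w → Parity (odd w)

parity : ∀ n → Parity n
parity zero = isEven zero
parity (suc n) with parity n
... | isEven w = isOdd w
... | isOdd w = subst Parity (cong suc (ℕₚ.+-suc w w)) (isEven (suc w))

-- Prepares a for `reciprocity`: an even remainder becomes odd when the odd modulus is added.
odd-representative : ∀ a h → Σ ℕ λ u → a ≅ + odd u mod + odd h
odd-representative a h = go (a ℤ.%ℕ odd h) (parity _) (%ℕ-≅ a (odd h))
  where
    lem : ∀ w h → (w ℕ.+ w) ℕ.+ suc (h ℕ.+ h) ≡ suc ((w ℕ.+ h) ℕ.+ (w ℕ.+ h))
    lem = ℕ-Solver.solve-∀
    go : ∀ r → Parity r → a ≅ + r mod + odd h → Σ ℕ λ u → a ≅ + odd u mod + odd h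
    go _ (isOdd w) e = w , e
    go _ (isEven w) e = w ℕ.+ h , ≅-trans e (≅-sym (by (+ 1) (trans (cong +_ (sym (lem w h))) (cong (_+_ (+ double w)) (sym (ℤₚ.*-identityˡ (+ odd h)))))))

-- After reciprocity the product of the moduli stands in the numerator, where `J-*` splits it; each
-- factor is then moved back. The signs match because u(g ⊛ h) and ug + uh differ by an even number.
J-⊛ : ∀ g h {a} → Unit a (+ odd (g ⊛ h)) → J a (g ⊛ h) ≡ J a g · J a h
J-⊛ g h {a} unit with odd-representative a (g ⊛ h)
... | u , a≅u = begin
  J a (g ⊛ h)                                  ≡⟨ J-cong (g ⊛ h) a≅u ⟩
  J (+ odd u) (g ⊛ h)                          ≡⟨ reciprocity u (g ⊛ h) unitᵘ ⟩
  par (u ℕ.* (g ⊛ h)) · J (+ odd (g ⊛ h)) u    ≡⟨ cong₂ _·_ par≡ (trans (cong (λ z → J z u) (+odd-⊛ g h)) (J-* u (Unit-sym unitᵍ) (Unit-sym unitʰ))) ⟩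
  (par (u ℕ.* g) · par (u ℕ.* h)) · (J (+ odd g) u · J (+ odd h) u)
                                               ≡⟨ interchange (par (u ℕ.* g)) (par (u ℕ.* h)) (J (+ odd g) u) (J (+ odd h) u) ⟩
  (par (u ℕ.* g) · J (+ odd g) u) · (par (u ℕ.* h) · J (+ odd h) u)
                                               ≡⟨ cong₂ _·_ (sym (reciprocity u g unitᵍ)) (sym (reciprocity u h unitʰ)) ⟩
  J (+ odd u) g · J (+ odd u) h                ≡⟨ cong₂ _·_ (sym (J-cong g (≅-weaken (+ odd h) (a≅gh (trans (+odd-⊛ g h) (ℤₚ.*-comm (+ odd g) (+ odd h))))))) (sym (J-cong h (≅-weaken (+ odd g) (a≅gh (+odd-⊛ g h))))) ⟩
  J a g · J a h ∎
  where
    open ≡-Reasoning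
    a≅gh : ∀ {m} → + odd (g ⊛ h) ≡ m → a ≅ + odd u mod m
    a≅gh refl = a≅u
    unitᵘ : Unit (+ odd u) (+ odd (g ⊛ h))
    unitᵘ = Unit-≅ a≅u unit
    unitᵍ : Unit (+ odd u) (+ odd g)
    unitᵍ = Unit-mod-factorˡ {m = + odd g} {+ odd h} (subst (Unit (+ odd u)) (+odd-⊛ g h) unitᵘ)
    unitʰ : Unit (+ odd u) (+ odd h)
    unitʰ = Unit-mod-factorʳ {m = + odd g} {+ odd h} (subst (Unit (+ odd u)) (+odd-⊛ g h) unitᵘ)
    lem : ∀ u g h → u ℕ.* (g ℕ.+ h ℕ.+ (g ℕ.* h ℕ.+ g ℕ.* h)) ≡ (u ℕ.* g ℕ.+ u ℕ.* h) ℕ.+ (u ℕ.* (g ℕ.* h) ℕ.+ u ℕ.* (g ℕ.* h))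
    lem = ℕ-Solver.solve-∀
    par≡ : par (u ℕ.* (g ⊛ h)) ≡ par (u ℕ.* g) · par (u ℕ.* h)
    par≡ = begin
      par (u ℕ.* (g ⊛ h)) ≡⟨ cong par (lem u g h) ⟩
      par (u ℕ.* g ℕ.+ u ℕ.* h ℕ.+ double (u ℕ.* (g ℕ.* h))) ≡⟨ par-+ (u ℕ.* g ℕ.+ u ℕ.* h) _ ⟩
      par (u ℕ.* g ℕ.+ u ℕ.* h) · par (double (u ℕ.* (g ℕ.* h))) ≡⟨ cong₂ _·_ (par-+ (u ℕ.* g) (u ℕ.* h)) (par-double (u ℕ.* (g ℕ.* h))) ⟩
      (par (u ℕ.* g) · par (u ℕ.* h)) · ⊕ ≡⟨ Signₚ.*-identityʳ _ ⟩
      par (u ℕ.* g) · par (u ℕ.* h) ∎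

-- Moduli congruent to 1 modulo 4

J-neg : ∀ w {a} → Unit a (+ odd (double w)) → J (- a) (double w) ≡ J a (double w)
J-neg w {a} unit = begin
  J (- a) (double w)                     ≡⟨ cong (λ z → J z (double w)) (sym (ℤₚ.-1*i≡-i a)) ⟩
  J (-[1+ 0 ] * a) (double w)            ≡⟨ J-* (double w) (Unit-neg (Unit-1 _)) unit ⟩
  J -[1+ 0 ] (double w) · J a (double w) ≡⟨ cong (_· J a (double w)) (trans (J-minus-1 (double w)) (par-double w)) ⟩
  J a (double w) ∎
  where open ≡-Reasoning

J-abs : ∀ w a → Unit a (+ odd (double w)) → J (+ ∣ a ∣) (double w) ≡ J a (double w)
J-abs w (+ _)    unit = refl
J-abs w -[1+ k ] unit = J-neg w unit

reciprocity-1mod4 : ∀ w u a → ∣ a ∣ ≡ odd u → Unit a (+ odd (double w)) → J a (double w) ≡ J (+ odd (double w)) u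
reciprocity-1mod4 w u a a≡ unit = begin
  J a (double w)                                       ≡⟨ sym (J-abs w a unit) ⟩
  J (+ ∣ a ∣) (double w)                               ≡⟨ cong (λ z → J (+ z) (double w)) a≡ ⟩
  J (+ odd u) (double w)                               ≡⟨ reciprocity u (double w) (subst (λ z → Unit (+ z) (+ odd (double w))) a≡ (Unit-abs unit)) ⟩
  par (u ℕ.* double w) · J (+ odd (double w)) u        ≡⟨ cong (_· J (+ odd (double w)) u) (trans (cong par (ℕₚ.*-distribˡ-+ u w w)) (par-double (u ℕ.* w))) ⟩
  J (+ odd (double w)) u ∎
  where open ≡-Reasoning

-- By reciprocity the left side is the symbol of PB modulo |t|. As ePB is a square modulo t, that
-- symbol equals the one of e. The applications have e = 1, or e = 2 when the norm is twice an odd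
-- number.
square-relation : ∀ v w u {t s e} → ∣ t ∣ ≡ odd u → Unit t (+ odd (double v)) → Unit t (+ odd (double w)) → Unit e t →
  s * s ≅ e * (+ odd (double v) * + odd (double w)) mod t → J t (double v) · J t (double w) ≡ J e u
square-relation v w u {t} {s} {e} t≡ unitᵛ unitʷ unitᵉ s≅ = begin
  J t (double v) · J t (double w)     ≡⟨ cong₂ _·_ (reciprocity-1mod4 v u t t≡ unitᵛ) (reciprocity-1mod4 w u t t≡ unitʷ) ⟩
  J P u · J B u                       ≡⟨ sym (J-* u P-unit B-unit) ⟩
  J (P * B) u                         ≡⟨ sym (Signₚ.*-identityʳ _) ⟩
  J (P * B) u · ⊕                     ≡⟨ cong (J (P * B) u ·_) (sym (Signₚ.s*s≡+ (J e u))) ⟩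
  J (P * B) u · (J e u · J e u)       ≡⟨ sym (Signₚ.*-assoc (J (P * B) u) (J e u) (J e u)) ⟩
  (J (P * B) u · J e u) · J e u       ≡⟨ cong (_· J e u) (trans (Signₚ.*-comm (J (P * B) u) (J e u)) (sym (J-* u e-unit PB-unit))) ⟩
  J (e * (P * B)) u · J e u           ≡⟨ cong (_· J e u) (trans (J-cong u (toU (≅-sym s≅))) (J-square u s-unit)) ⟩
  J e u ∎
  where
    open ≡-Reasoning
    P = + odd (double v)
    B = + odd (double w)
    toU : ∀ {x y} → x ≅ y mod t → x ≅ y mod + odd u
    toU {x} {y} q = subst (λ m → x ≅ y mod + m) t≡ (sign t q)
      where sign : ∀ t → x ≅ y mod t → x ≅ y mod + ∣ t ∣
            sign (+ _) q = q
            sign -[1+ k ] (by c eq) = by (- c) (trans eq (cong (_+_ y) (flip c (+ suc k))))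
              where flip : ∀ c k → c * - k ≡ - c * k
                    flip = solve-∀
    Unit-toU : ∀ {x} → Unit x t → Unit x (+ odd u)
    Unit-toU (i , q) = i , toU q
    P-unit = Unit-toU (Unit-sym unitᵛ)
    B-unit = Unit-toU (Unit-sym unitʷ)
    e-unit = Unit-toU unitᵉ
    PB-unit : Unit (P * B) (+ odd u)
    PB-unit = Unit-* P-unit B-unit
    s-unit : Unit s (+ odd u)
    s-unit = Unit-factorˡ {s} {s} (Unit-≅ (≅-sym (toU s≅)) (Unit-* e-unit PB-unit))

-- Euler's criterion, and agreement with the Legendre and Jacobi symbols

-- The coefficient list [c₀, …, c_{d-1}] stands for the monic polynomial c₀ + c₁x + … + x^d.
eval : ∀ {d} → Vec ℤ d → ℤ → ℤ
eval []       x = + 1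
eval (c ∷ cs) x = c + x * eval cs x

-- Synthetic division by x - r: the coefficients are the values at r of the tails of the polynomial,
-- as in Horner's scheme.
quotient : ∀ {d} → ℤ → Vec ℤ (suc d) → Vec ℤ d
quotient r (c ∷ [])          = []
quotient r (c ∷ cs@(_ ∷ _)) = eval cs r ∷ quotient r cs

quotient-correct : ∀ {d} r (f : Vec ℤ (suc d)) x → eval f x ≡ eval f r + (x - r) * eval (quotient r f) x
quotient-correct r (c ∷ []) x = lem c r x
  where lem : ∀ c r x → c + x * + 1 ≡ (c + r * + 1) + (x - r) * + 1
        lem = solve-∀
quotient-correct r (c ∷ cs@(_ ∷ _)) x =
  trans (cong (λ z → c + x * z) (quotient-correct r cs x)) (lem c r x (eval cs r) (eval (quotient r cs) x))
  where lem : ∀ c r x g q → c + x * (g + (x - r) * q) ≡ (c + r * g) + (x - r) * (g + x * q)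
        lem = solve-∀

-- Dividing out the first root lowers the degree by one, and the other roots remain roots because
-- their differences to the first are units.
lagrange : ∀ {p} → Prime p → ∀ d (f : Vec ℤ d) (r : Fin (suc d) → ℤ) →
  (∀ {i j} → r i ≅ r j mod + p → i ≡ j) → (∀ i → eval f (r i) ≅ + 0 mod + p) → ⊥
lagrange {p} pr zero [] r inj root = Unit⇒∤ pr (Unit-1 (+ p)) (root Fin.zero)
lagrange {p} pr (suc d) f r inj root = lagrange pr d g (r ∘ Fin.suc) (Finₚ.suc-injective ∘ inj) root′
  where
    r₀ = r Fin.zero
    g = quotient r₀ f
    root′ : ∀ i → eval g (r (Fin.suc i)) ≅ + 0 mod + p
    root′ i = Unit-cancelˡ {x - r₀} (prime∤⇒Unit′ pr (λ e → Finₚ.0≢1+n (sym (inj (-≅0⇒≅ e))))) (begin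
        (x - r₀) * eval g x   ≡⟨ trans (lem (eval f r₀) _) (cong (_- eval f r₀) (sym (quotient-correct r₀ f x))) ⟩
        eval f x - eval f r₀  ≅⟨ +-cong (root (Fin.suc i)) (neg-cong (root Fin.zero)) ⟩
        + 0 + - + 0           ≡⟨ sym (ℤₚ.*-zeroʳ (x - r₀)) ⟩
        (x - r₀) * + 0 ∎)
      where
        open ≅-Reasoning (+ p)
        x = r (Fin.suc i)
        lem : ∀ a b → b ≡ (a + b) - a
        lem = solve-∀

-- From (i - j)(i + j) ≡ 0 and 0 < i + j < n, with both numbers counted from 1.
squares-distinct : ∀ {h} → Prime (odd h) → ∀ (i j : Fin h) → ∣ i ∣₁ * ∣ i ∣₁ ≅ ∣ j ∣₁ * ∣ j ∣₁ mod + odd h → i ≡ j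
squares-distinct {h} pr i j e with i Fin.≟ j
... | yes i≡j = i≡j
... | no i≢j = ⊥-elim (ℕₚ.1+n≢0 (remainder-unique {odd h} {suc (toℕ i) ℕ.+ suc (toℕ j)} {0}
      (Unit-cancelˡ {∣ i ∣₁ - ∣ j ∣₁} (prime∤⇒Unit′ pr i≇j) prod)
      (s≤s (ℕₚ.+-mono-≤ (Finₚ.toℕ<n i) (Finₚ.toℕ<n j))) (s≤s z≤n)))
  where
    bound : ∀ (i : Fin h) → suc (toℕ i) ℕ.< odd h
    bound i = s≤s (ℕₚ.≤-trans (Finₚ.toℕ<n i) (ℕₚ.m≤m+n h h))
    i≇j : ¬ (∣ i ∣₁ - ∣ j ∣₁ ≅ + 0 mod + odd h)
    i≇j q = i≢j (Finₚ.toℕ-injective (ℕₚ.suc-injective (remainder-unique (-≅0⇒≅ q) (bound i) (bound j))))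
    lem : ∀ a b → (a - b) * (a + b) ≡ a * a - b * b
    lem = solve-∀
    prod : (∣ i ∣₁ - ∣ j ∣₁) * (∣ i ∣₁ + ∣ j ∣₁) ≅ (∣ i ∣₁ - ∣ j ∣₁) * + 0 mod + odd h
    prod = ≅-trans (≅-reflexive (lem ∣ i ∣₁ ∣ j ∣₁)) (≅-trans (≅⇒-≅0 e) (≅-reflexive (sym (ℤₚ.*-zeroʳ (∣ i ∣₁ - ∣ j ∣₁)))))

-- Otherwise x^h ≡ 1, and x together with the squares of 1, ..., h would be h + 1 roots of X^h - 1.
nonsquare⇒J : ∀ h → Prime (odd h) → ∀ {x} → Unit x (+ odd h) →
  (∀ (i : Fin h) → ¬ (x ≅ ∣ i ∣₁ * ∣ i ∣₁ mod + odd h)) → J x h ≡ ⊖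
nonsquare⇒J zero pr u nonsq = ⊥-elim (¬prime[1] pr)
nonsquare⇒J h@(suc h′) pr {x} u nonsq with J x h in Jx
... | ⊖ = refl
... | ⊕ = ⊥-elim (lagrange pr h f r inj root)
  where
    f : Vec ℤ h
    f = -[1+ 0 ] ∷ replicate h′ (+ 0)
    eval-power : ∀ k x → eval (replicate k (+ 0)) x ≡ x ^ k
    eval-power zero x = refl
    eval-power (suc k) x = trans (ℤₚ.+-identityˡ _) (cong (x *_) (eval-power k x))
    J⇒root : ∀ {x} → Unit x (+ odd h) → J x h ≡ ⊕ → eval f x ≅ + 0 mod + odd h
    J⇒root {x} u Jx = ≅-trans (≅-reflexive (cong (λ z → -[1+ 0 ] + x * z) (eval-power h′ x)))
      (+-cong (≅-refl {x = -[1+ 0 ]}) (subst (λ s → x ^ h ≅ ⟦ s ⟧ mod + odd h) Jx (gauss h pr u)))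
    r : Fin (suc h) → ℤ
    r Fin.zero    = x
    r (Fin.suc i) = ∣ i ∣₁ * ∣ i ∣₁
    inj : ∀ {i j} → r i ≅ r j mod + odd h → i ≡ j
    inj {Fin.zero}  {Fin.zero}  e = refl
    inj {Fin.zero}  {Fin.suc j} e = ⊥-elim (nonsq j e)
    inj {Fin.suc i} {Fin.zero}  e = ⊥-elim (nonsq i (≅-sym e))
    inj {Fin.suc i} {Fin.suc j} e = cong Fin.suc (squares-distinct pr i j e)
    root : ∀ i → eval f (r i) ≅ + 0 mod + odd h
    root Fin.zero    = J⇒root u Jx
    root (Fin.suc i) = J⇒root (Unit-* ui ui) (J-square h ui)
      where ui = prime∤⇒Unit′ pr (λ e → Multiplier.nonzero h (Unit-1 _) i (≅-trans (≅-reflexive (ℤₚ.*-identityˡ ∣ i ∣₁)) e))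

-- A value whose only content is its index: giving it poses the equation between the unfolded index
-- and a displayed term. In the solutions below, `with` turns compound arguments into distinct
-- variables, so that the unknown function is determined.
data Phantom {A : Set} : A → Set where
  phantom : ∀ v → Phantom v

-- The recursive helpers of the symbols are private to Defs; each is recovered here as
-- the unique solution of a unification problem posed by unfolding the public function.
mutual
  anySquare : ℕ → ℕ → ℕ → Bool
  anySquare = _

  anySquare-solution : ∀ x k → Phantom (legendre x (suc k))
  anySquare-solution x k with x ℤ.%ℕ suc k
  ... | zero = phantom _
  ... | suc r with suc k
  ...   | q = phantom (if (if does (suc k ℕD.∣? (k ℕ.* k ℕ.+ (k ℕ.∸ r))) then true else anySquare q r k) then + 1 else -[1+ 0 ])

mutual
  leastDivisor : ℕ → ℕ → ℕ → ℕ
  leastDivisor = _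

  leastDivisor-solution : ∀ k → Phantom (minPrimeFactor (suc k))
  leastDivisor-solution k with 3 | suc k
  ... | e | n = phantom (if does (2 ℕD.∣? suc k) then 2 else leastDivisor k e n)

mutual
  jacobiRec : ℕ → ℤ → ℕ → ℤ
  jacobiRec = _

  jacobiRec-solution : ∀ x m → Phantom (jacobi x (suc (suc m)))
  jacobiRec-solution x m with minPrimeFactor (suc (suc m))
  ... | zero = phantom _
  ... | suc q with suc (suc m) ℕ./ suc q
  ...   | N = phantom (legendre x (suc q) * jacobiRec m x N)

if-∨-true : ∀ {P : Set} (d : Dec P) {b} → (if does d then true else b) ≡ true → P ⊎ b ≡ true
if-∨-true (yes p) _ = inj₁ p
if-∨-true (no _)  e = inj₂ e

if-∨-false : ∀ {P : Set} (d : Dec P) {b} → (if does d then true else b) ≡ false → (¬ P) × b ≡ false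
if-∨-false (no ¬p) e = ¬p , e

anySquare-true : ∀ q r f → anySquare q r f ≡ true → Σ ℕ λ y → q ℕD.∣ y ℕ.* y ℕ.+ (q ℕ.∸ suc r)
anySquare-true q r (suc f) e with if-∨-true (q ℕD.∣? (f ℕ.* f ℕ.+ (q ℕ.∸ suc r))) e
... | inj₁ d = f , d
... | inj₂ e′ = anySquare-true q r f e′

anySquare-false : ∀ q r f → anySquare q r f ≡ false → ∀ y → y ℕ.< f → ¬ (q ℕD.∣ y ℕ.* y ℕ.+ (q ℕ.∸ suc r))
anySquare-false q r (suc f) e y (s≤s y≤f) with if-∨-false (q ℕD.∣? (f ℕ.* f ℕ.+ (q ℕ.∸ suc r))) e | ℕₚ.m≤n⇒m<n∨m≡n y≤f
... | ¬d , e′ | inj₁ y<f = anySquare-false q r f e′ y y<f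
... | ¬d , e′ | inj₂ refl = ¬d

legendre-nonzero : ∀ x k r → x ℤ.%ℕ suc k ≡ suc r → legendre x (suc k) ≡ (if anySquare (suc k) r (suc k) then + 1 else -[1+ 0 ])
legendre-nonzero x k r e rewrite e = refl

-- A successful search exhibits x as a square, whose symbol is ⊕. A failed one excludes the squares
-- of 1, ..., h, as `nonsquare⇒J` requires.
legendre≡J : ∀ h → Prime (odd h) → ∀ {x} → Unit x (+ odd h) → legendre x (odd h) ≡ ⟦ J x h ⟧
legendre≡J h pr {x} u = go (x ℤ.%ℕ odd h) refl
  where
    q = odd h
    x≅ : ∀ {r} → x ℤ.%ℕ q ≡ r → x ≅ + r mod + q
    x≅ e = subst (λ r → x ≅ + r mod + q) e (%ℕ-≅ x q)
    go : ∀ r → x ℤ.%ℕ q ≡ r → legendre x q ≡ ⟦ J x h ⟧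
    go zero    e = ⊥-elim (Unit⇒∤ pr u (x≅ e))
    go (suc r) e = trans (legendre-nonzero x (h ℕ.+ h) r e) (decide (anySquare q r q) refl)
      where
        r<q : suc r ℕ.< q
        r<q = subst (ℕ._< q) e (ℤDM.n%ℕd<d x q)
        -- The search tests whether q divides y² + (q - r); as r < q the natural subtraction is
        -- exact, so this means y² ≡ r.
        shift : ∀ y → + (y ℕ.* y ℕ.+ (q ℕ.∸ suc r)) ≡ (+ y * + y - + suc r) + + 1 * + q
        shift y = trans (cong₂ _+_ (ℤₚ.pos-* y y) (trans (sym (ℤₚ.⊖-≥ (ℕₚ.<⇒≤ r<q))) (sym (ℤₚ.m-n≡m⊖n q (suc r))))) (lem (+ y) (+ suc r) (+ q))
          where lem : ∀ y r q → y * y + (q - r) ≡ (y * y - r) + + 1 * q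
                lem = solve-∀
        to : ∀ y → q ℕD.∣ y ℕ.* y ℕ.+ (q ℕ.∸ suc r) → x ≅ + y * + y mod + q
        to y d = ≅-trans (x≅ e) (≅-sym (-≅0⇒≅ (≅-trans (≅-sym (by (+ 1) (shift y))) (∣⇒≅0 {+ q} d))))
        from : ∀ y → x ≅ + y * + y mod + q → q ℕD.∣ y ℕ.* y ℕ.+ (q ℕ.∸ suc r)
        from y x≅y² = ≅0⇒∣ {+ q} {+ (y ℕ.* y ℕ.+ (q ℕ.∸ suc r))}
          (≅-trans (by (+ 1) (shift y)) (≅⇒-≅0 (≅-trans (≅-sym x≅y²) (x≅ e))))
        decide : ∀ b → anySquare q r q ≡ b → (if b then + 1 else -[1+ 0 ]) ≡ ⟦ J x h ⟧
        decide true eq with anySquare-true q r q eq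
        ... | y , d = cong ⟦_⟧ (sym (trans (J-cong h (to y d)) (J-square h (Unit-factorˡ {+ y} {+ y} (Unit-≅ (to y d) u)))))
        decide false eq = cong ⟦_⟧ (sym (nonsquare⇒J h pr u λ i x≅i² →
          anySquare-false q r q eq (suc (toℕ i)) (s≤s (ℕₚ.≤-trans (Finₚ.toℕ<n i) (ℕₚ.m≤m+n h h))) (from (suc (toℕ i)) x≅i²)))

if-elim : ∀ {P A : Set} (Q : A → Set) (d : Dec P) {a b : A} → (P → Q a) → (¬ P → Q b) → Q (if does d then a else b)
if-elim Q (yes p) f g = f p
if-elim Q (no ¬p) f g = g ¬p

-- The bound n ≤ e + fuel ensures that when the fuel is exhausted no candidate below n is left; n is
-- then rough itself, and returning it is right.
leastDivisor-spec : ∀ fuel e n → 2 ℕ.≤ e → 2 ℕ.≤ n → e Rough n → n ℕ.≤ e ℕ.+ fuel →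
  let q = leastDivisor fuel e n in 2 ℕ.≤ q × q Rough n × q ℕD.∣ n
leastDivisor-spec zero e n 2≤e 2≤n rough n≤e = 2≤n , (λ { (ℕD.hasNonTrivialDivisor d<n d∣n) → rough (ℕD.hasNonTrivialDivisor (ℕₚ.<-≤-trans d<n (subst (n ℕ.≤_) (ℕₚ.+-identityʳ e) n≤e)) d∣n) }) , ℕD.∣-refl
leastDivisor-spec (suc fuel) e n 2≤e 2≤n rough n≤ =
  if-elim (λ q → 2 ℕ.≤ q × q Rough n × q ℕD.∣ n) (e ℕD.∣? n)
    (λ e∣n → 2≤e , rough , e∣n)
    (λ e∤n → leastDivisor-spec fuel (suc e) n (ℕₚ.m≤n⇒m≤1+n 2≤e) 2≤n (∤⇒rough-suc e∤n rough) (subst (n ℕ.≤_) (ℕₚ.+-suc e fuel) n≤))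

minPrimeFactor-spec : ∀ n → 2 ℕ.≤ n → Prime (minPrimeFactor n) × minPrimeFactor n ℕD.∣ n
minPrimeFactor-spec n 2≤n with leastDivisor-spec n 2 n ℕₚ.≤-refl 2≤n 2-rough (ℕₚ.m≤n+m n 2)
... | 2≤q , rough , q∣n = rough∧∣⇒prime {{ℕ.n>1⇒nonTrivial 2≤q}} rough q∣n , q∣n

jacobiRec-step : ∀ f x m q → minPrimeFactor (2 ℕ.+ m) ≡ suc q →
  jacobiRec (suc f) x (2 ℕ.+ m) ≡ legendre x (suc q) * jacobiRec f x ((2 ℕ.+ m) ℕ./ suc q)
jacobiRec-step f x m q e rewrite e = refl

double≢odd : ∀ m n → double m ≢ odd n
double≢odd (suc m) zero e with ℕₚ.suc-injective e
... | e′ with trans (sym (ℕₚ.+-suc m m)) e′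
... | ()
double≢odd (suc m) (suc n) e = double≢odd m n (ℕₚ.suc-injective (ℕₚ.suc-injective (trans (cong suc (sym (ℕₚ.+-suc m m))) (trans e (odd-suc n)))))

odd-injective : ∀ {m n} → odd m ≡ odd n → m ≡ n
odd-injective {m} {n} e = ℕₚ.≤-antisym (cancel (ℕₚ.≤-reflexive e)) (cancel (ℕₚ.≤-reflexive (sym e)))
  where cancel : ∀ {m n} → odd m ℕ.≤ odd n → m ℕ.≤ n
        cancel le = double-cancel-≤ (ℕₚ.m≤n⇒m≤1+n (ℕₚ.≤-pred le))

odd-factorˡ : ∀ {q N g} → q ℕ.* N ≡ odd g → Σ ℕ λ a → q ≡ odd a
odd-factorˡ {q} {N} {g} e with parity q
... | isOdd a  = a , refl
... | isEven a = ⊥-elim (double≢odd (a ℕ.* N) g (trans (sym (ℕₚ.*-distribʳ-+ N a a)) e))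

-- Dividing by the least prime factor at least halves n, so one unit of fuel per prime suffices;
-- `J-⊛` recombines the two symbols. Modulus 1 gives the empty product.
jacobiRec≡J : ∀ f g {x} → odd g ℕ.≤ suc f → Unit x (+ odd g) → jacobiRec f x (odd g) ≡ ⟦ J x g ⟧
jacobiRec≡J f zero le u = refl
jacobiRec≡J zero (suc g) (s≤s ()) u
jacobiRec≡J (suc f) (suc g) {x} le u = go (minPrimeFactor n) refl (minPrimeFactor-spec n (s≤s (s≤s z≤n)))
  where
    n = odd (suc g)
    go : ∀ q → minPrimeFactor n ≡ q → Prime q × q ℕD.∣ n → jacobiRec (suc f) x n ≡ ⟦ J x (suc g) ⟧
    go (suc q) mpf (pr , q∣n) = step (odd-factorˡ {suc q} {N} {suc g} qN≡n) (odd-factorˡ {N} {suc q} {suc g} (trans (ℕₚ.*-comm N (suc q)) qN≡n))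
      where
        N = n ℕ./ suc q
        qN≡n : suc q ℕ.* N ≡ n
        qN≡n = ℕDM.m*[n/m]≡n q∣n
        N≤ : N ℕ.≤ suc f
        N≤ = ℕₚ.≤-pred (ℕₚ.≤-trans (ℕDM.m/n<m n (suc q) (ℕ.nonTrivial⇒n>1 (suc q) {{prime⇒nonTrivial pr}})) le)
        step : (Σ ℕ λ a → suc q ≡ odd a) → (Σ ℕ λ b → N ≡ odd b) → jacobiRec (suc f) x n ≡ ⟦ J x (suc g) ⟧
        step (a , q≡) (b , N≡) = begin
          jacobiRec (suc f) x n                     ≡⟨ jacobiRec-step f x _ q mpf ⟩
          legendre x (suc q) * jacobiRec f x N      ≡⟨ cong₂ (λ q N → legendre x q * jacobiRec f x N) q≡ N≡ ⟩
          legendre x (odd a) * jacobiRec f x (odd b) ≡⟨ cong₂ _*_ (legendre≡J a (subst Prime q≡ pr) unitᵃ) (jacobiRec≡J f b (subst (ℕ._≤ suc f) N≡ N≤) unitᵇ) ⟩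
          ⟦ J x a ⟧ * ⟦ J x b ⟧                     ≡⟨ sym (⟦⟧-· (J x a) (J x b)) ⟩
          ⟦ J x a · J x b ⟧                         ≡⟨ cong ⟦_⟧ (sym (J-⊛ a b (subst (λ m → Unit x (+ odd m)) g≡ u))) ⟩
          ⟦ J x (a ⊛ b) ⟧                           ≡⟨ cong (λ m → ⟦ J x m ⟧) (sym g≡) ⟩
          ⟦ J x (suc g) ⟧ ∎
          where
            open ≡-Reasoning
            g≡ : suc g ≡ a ⊛ b
            g≡ = odd-injective (trans (sym qN≡n) (trans (cong₂ ℕ._*_ q≡ N≡) (sym (odd-⊛ a b))))
            unit : Unit x (+ odd a * + odd b)
            unit = subst (Unit x) (trans (cong (λ m → + odd m) g≡) (+odd-⊛ a b)) u
            unitᵃ : Unit x (+ odd a)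
            unitᵃ = Unit-mod-factorˡ {m = + odd a} {+ odd b} unit
            unitᵇ : Unit x (+ odd b)
            unitᵇ = Unit-mod-factorʳ {m = + odd a} {+ odd b} unit
    go zero _ (pr , _) = ⊥-elim (¬prime[0] pr)

jacobi≡J : ∀ g {x} → Unit x (+ odd g) → jacobi x (odd g) ≡ ⟦ J x g ⟧
jacobi≡J g u = jacobiRec≡J (g ℕ.+ g) g ℕₚ.≤-refl u

-- The sums modulo p

C-absorb : ∀ n k → suc k ℕ.* (suc n C suc k) ≡ suc n ℕ.* (n C k)
C-absorb zero zero = refl
C-absorb zero (suc k) = trans (cong (suc (suc k) ℕ.*_) (k>n⇒nCk≡0 {1} {suc (suc k)} (s≤s (s≤s z≤n))))
  (trans (ℕₚ.*-zeroʳ (suc (suc k))) (sym (cong (1 ℕ.*_) (k>n⇒nCk≡0 {0} {suc k} (s≤s z≤n)))))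
C-absorb (suc n) zero = trans (cong (1 ℕ.*_) (sym (nCk+nC[k+1]≡[n+1]C[k+1] (suc n) 0)))
  (trans (lem (suc n C 1)) (trans (cong suc (C-absorb n 0)) (lem₂ n)))
  where lem : ∀ c → 1 ℕ.* (1 ℕ.+ c) ≡ suc (1 ℕ.* c)
        lem = ℕ-Solver.solve-∀
        lem₂ : ∀ n → suc (suc n ℕ.* 1) ≡ suc (suc n) ℕ.* 1
        lem₂ = ℕ-Solver.solve-∀
C-absorb (suc n) (suc k) = begin
  suc (suc k) ℕ.* (suc (suc n) C suc (suc k))
    ≡⟨ cong (suc (suc k) ℕ.*_) (sym (nCk+nC[k+1]≡[n+1]C[k+1] (suc n) (suc k))) ⟩
  suc (suc k) ℕ.* (x ℕ.+ (suc n C suc (suc k)))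
    ≡⟨ lem₁ (suc k) x (suc n C suc (suc k)) ⟩
  x ℕ.+ (suc k ℕ.* x ℕ.+ suc (suc k) ℕ.* (suc n C suc (suc k)))
    ≡⟨ cong (x ℕ.+_) (cong₂ ℕ._+_ (C-absorb n k) (C-absorb n (suc k))) ⟩
  x ℕ.+ (suc n ℕ.* (n C k) ℕ.+ suc n ℕ.* (n C suc k))
    ≡⟨ cong (x ℕ.+_) (trans (sym (ℕₚ.*-distribˡ-+ (suc n) (n C k) (n C suc k))) (cong (suc n ℕ.*_) (nCk+nC[k+1]≡[n+1]C[k+1] n k))) ⟩
  suc (suc n) ℕ.* x ∎
  where
    open ≡-Reasoning
    x = suc n C suc k
    lem₁ : ∀ k x y → suc k ℕ.* (x ℕ.+ y) ≡ x ℕ.+ (k ℕ.* x ℕ.+ suc k ℕ.* y)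
    lem₁ = ℕ-Solver.solve-∀

-- The ratio of neighbours, (k + 1) C(n, k + 1) = (n - k) C(n, k), written without subtraction.
C-next : ∀ n k → suc k ℕ.* (n C suc k) ℕ.+ suc k ℕ.* (n C k) ≡ suc n ℕ.* (n C k)
C-next n k = trans (sym (ℕₚ.*-distribˡ-+ (suc k) (n C suc k) (n C k)))
  (trans (cong (suc k ℕ.*_) (trans (ℕₚ.+-comm (n C suc k) (n C k)) (nCk+nC[k+1]≡[n+1]C[k+1] n k))) (C-absorb n k))

C-central : ∀ j → suc j ℕ.* ((2 ℕ.* suc j) C suc j) ≡ 2 ℕ.* suc (2 ℕ.* j) ℕ.* ((2 ℕ.* j) C j)
C-central j = begin
  suc j ℕ.* ((2 ℕ.* suc j) C suc j)          ≡⟨ cong (λ n → suc j ℕ.* (n C suc j)) (lem₁ j) ⟩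
  suc j ℕ.* (suc (suc (2 ℕ.* j)) C suc j)    ≡⟨ C-absorb (suc (2 ℕ.* j)) j ⟩
  suc (suc (2 ℕ.* j)) ℕ.* y                  ≡⟨ lem₂ j y ⟩
  2 ℕ.* (suc j ℕ.* y)                        ≡⟨ cong (2 ℕ.*_) (sym x≡y) ⟩
  2 ℕ.* (suc j ℕ.* x)                        ≡⟨ cong (2 ℕ.*_) (C-absorb (2 ℕ.* j) j) ⟩
  2 ℕ.* (suc (2 ℕ.* j) ℕ.* ((2 ℕ.* j) C j))  ≡⟨ sym (ℕₚ.*-assoc 2 (suc (2 ℕ.* j)) _) ⟩
  2 ℕ.* suc (2 ℕ.* j) ℕ.* ((2 ℕ.* j) C j) ∎
  where
    open ≡-Reasoning
    x = suc (2 ℕ.* j) C suc j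
    y = suc (2 ℕ.* j) C j
    lem₁ : ∀ j → 2 ℕ.* suc j ≡ suc (suc (2 ℕ.* j))
    lem₁ = ℕ-Solver.solve-∀
    lem₂ : ∀ j y → suc (suc (2 ℕ.* j)) ℕ.* y ≡ 2 ℕ.* (suc j ℕ.* y)
    lem₂ = ℕ-Solver.solve-∀
    lem₃ : ∀ j y → suc (suc (2 ℕ.* j)) ℕ.* y ≡ suc j ℕ.* y ℕ.+ suc j ℕ.* y
    lem₃ = ℕ-Solver.solve-∀
    -- Symmetry of the two middle entries of row 2j + 1, obtained from their ratio.
    x≡y : suc j ℕ.* x ≡ suc j ℕ.* y
    x≡y = ℕₚ.+-cancelʳ-≡ (suc j ℕ.* y) _ _ (trans (C-next (suc (2 ℕ.* j)) j) (lem₃ j y))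

-- C(2j, j) = (−4)^j C(−1/2, j), and (p − 1)/2 ≡ −1/2 mod p.
C-central-≅ : ∀ h → Prime (odd h) → ∀ j → j ℕ.≤ h → + ((2 ℕ.* j) C j) ≅ (- + 4) ^ j * + (h C j) mod + odd h
C-central-≅ h pr zero _ = ≅-refl
C-central-≅ h pr (suc j) j<h = Unit-cancelˡ {+ suc j} unit (begin
  + suc j * + ((2 ℕ.* suc j) C suc j)
    ≡⟨ trans (sym (ℤₚ.pos-* (suc j) _)) (trans (cong +_ (C-central j)) (trans (ℤₚ.pos-* (2 ℕ.* suc (2 ℕ.* j)) _) (cong (_* + ((2 ℕ.* j) C j)) 4j+2))) ⟩
  (+ 4 * + j + + 2) * + ((2 ℕ.* j) C j)
    ≅⟨ *-congˡ (+ 4 * + j + + 2) (C-central-≅ h pr j (ℕₚ.<⇒≤ j<h)) ⟩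
  (+ 4 * + j + + 2) * (e * + (h C j))
    -- Here 4j + 2 = -4(h - j) + 2(2h + 1), which makes `C-next` for row h applicable.
    ≅⟨ by (+ 2 * (e * + (h C j))) (trans (lem₁ (+ j) (+ h) (e * + (h C j))) (cong (λ z → (- + 4) * (+ h - + j) * (e * + (h C j)) + + 2 * (e * + (h C j)) * z) (sym n≡))) ⟩
  (- + 4) * (+ h - + j) * (e * + (h C j))
    ≡⟨ lem₂ (+ h) (+ j) e (+ (h C j)) ⟩
  (- + 4) * e * ((+ 1 + + h) * + (h C j) - (+ 1 + + j) * + (h C j))
    ≡⟨ cong (λ z → (- + 4) * e * z) (trans (cong (_- (+ 1 + + j) * + (h C j)) next) (lem₃ (+ suc j * + (h C suc j)) ((+ 1 + + j) * + (h C j)))) ⟩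
  (- + 4) * e * (+ suc j * + (h C suc j))
    ≡⟨ lem₄ (- + 4) e (+ suc j) (+ (h C suc j)) ⟩
  + suc j * ((- + 4) * e * + (h C suc j)) ∎)
  where
    open ≅-Reasoning (+ odd h)
    e = (- + 4) ^ j
    unit : Unit (+ suc j) (+ odd h)
    unit = prime∤⇒Unit′ pr (λ q → ℕₚ.1+n≢0 (remainder-unique {odd h} {suc j} {0} q (s≤s (ℕₚ.≤-trans j<h (ℕₚ.m≤m+n h h))) (s≤s z≤n)))
    n≡ : + odd h ≡ + 1 + (+ h + + h)
    n≡ = refl
    4j+2 : + (2 ℕ.* suc (2 ℕ.* j)) ≡ + 4 * + j + + 2
    4j+2 = trans (cong +_ (lem j)) (cong (_+ + 2) (ℤₚ.pos-* 4 j))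
      where lem : ∀ j → 2 ℕ.* suc (2 ℕ.* j) ≡ 4 ℕ.* j ℕ.+ 2
            lem = ℕ-Solver.solve-∀
    next : (+ 1 + + h) * + (h C j) ≡ + suc j * + (h C suc j) + (+ 1 + + j) * + (h C j)
    next = trans (sym (ℤₚ.pos-* (suc h) (h C j))) (trans (cong +_ (sym (C-next h j))) (cong₂ _+_ (ℤₚ.pos-* (suc j) (h C suc j)) (ℤₚ.pos-* (suc j) (h C j))))
    lem₁ : ∀ j h x → (+ 4 * j + + 2) * x ≡ (- + 4) * (h - j) * x + + 2 * x * (+ 1 + (h + h))
    lem₁ = solve-∀
    lem₂ : ∀ h j e c → (- + 4) * (h - j) * (e * c) ≡ (- + 4) * e * ((+ 1 + h) * c - (+ 1 + j) * c)
    lem₂ = solve-∀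
    lem₃ : ∀ x y → (x + y) - y ≡ x
    lem₃ = solve-∀
    lem₄ : ∀ f e s c → f * e * (s * c) ≡ s * (f * e * c)
    lem₄ = solve-∀

-- Integer sums and the even part of a binomial expansion

∑ : ℕ → (ℕ → ℤ) → ℤ
∑ zero    f = f 0
∑ (suc N) f = ∑ N f + f (suc N)

∑-cong : ∀ {n} N {f g : ℕ → ℤ} → (∀ k → k ℕ.≤ N → f k ≅ g k mod n) → ∑ N f ≅ ∑ N g mod n
∑-cong zero e = e 0 z≤n
∑-cong (suc N) e = +-cong (∑-cong N (λ k k≤N → e k (ℕₚ.m≤n⇒m≤1+n k≤N))) (e (suc N) ℕₚ.≤-refl)

∑-cong-≡ : ∀ N {f g : ℕ → ℤ} → (∀ k → f k ≡ g k) → ∑ N f ≡ ∑ N g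
∑-cong-≡ zero e = e 0
∑-cong-≡ (suc N) e = cong₂ _+_ (∑-cong-≡ N e) (e (suc N))

∑-+ : ∀ N f g → ∑ N (λ k → f k + g k) ≡ ∑ N f + ∑ N g
∑-+ zero f g = refl
∑-+ (suc N) f g = trans (cong (_+ (f (suc N) + g (suc N))) (∑-+ N f g)) (lem (∑ N f) (∑ N g) (f (suc N)) (g (suc N)))
  where lem : ∀ a b c d → (a + b) + (c + d) ≡ (a + c) + (b + d)
        lem = solve-∀

∑-*ˡ : ∀ N a f → ∑ N (λ k → a * f k) ≡ a * ∑ N f
∑-*ˡ zero a f = refl
∑-*ˡ (suc N) a f = trans (cong (_+ a * f (suc N)) (∑-*ˡ N a f)) (sym (ℤₚ.*-distribˡ-+ a (∑ N f) (f (suc N))))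

∑-shift : ∀ N f → ∑ (suc N) f ≡ f 0 + ∑ N (f ∘ suc)
∑-shift zero f = refl
∑-shift (suc N) f = trans (cong (_+ f (suc (suc N))) (∑-shift N f)) (ℤₚ.+-assoc (f 0) (∑ N (f ∘ suc)) (f (suc (suc N))))

binomial-theorem : ∀ n y → (+ 1 + y) ^ n ≡ ∑ n (λ j → + (n C j) * y ^ j)
binomial-theorem zero y = refl
binomial-theorem (suc n) y = sym (begin
  ∑ (suc n) (λ j → + (suc n C j) * y ^ j)   ≡⟨ ∑-shift n (λ j → + (suc n C j) * y ^ j) ⟩
  + 1 + ∑ n (λ j → + (suc n C suc j) * y ^ suc j)
    ≡⟨ cong (_+_ (+ 1)) (trans (∑-cong-≡ n pascal) (∑-+ n (λ j → y * c j) (c ∘ suc))) ⟩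
  + 1 + (∑ n (λ j → y * c j) + ∑ n (c ∘ suc))   ≡⟨ cong (λ z → + 1 + (z + ∑ n (c ∘ suc))) (∑-*ˡ n y c) ⟩
  + 1 + (y * ∑ n c + ∑ n (c ∘ suc))             ≡⟨ lem (y * ∑ n c) (∑ n (c ∘ suc)) ⟩
  y * ∑ n c + (+ 1 + ∑ n (c ∘ suc))             ≡⟨ cong (_+_ (y * ∑ n c)) (sym (∑-shift n c)) ⟩
  y * ∑ n c + (∑ n c + c (suc n))               ≡⟨ cong (λ z → y * ∑ n c + (∑ n c + z)) c≡0 ⟩
  y * ∑ n c + (∑ n c + + 0)                     ≡⟨ lem₂ y (∑ n c) ⟩
  (+ 1 + y) * ∑ n c                             ≡⟨ cong ((+ 1 + y) *_) (sym (binomial-theorem n y)) ⟩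
  (+ 1 + y) ^ suc n ∎)
  where
    open ≡-Reasoning
    c : ℕ → ℤ
    c j = + (n C j) * y ^ j
    c≡0 : c (suc n) ≡ + 0
    c≡0 = trans (cong (λ x → + x * y ^ suc n) (k>n⇒nCk≡0 (ℕₚ.n<1+n n))) (ℤₚ.*-zeroˡ (y ^ suc n))
    pascal : ∀ j → + (suc n C suc j) * y ^ suc j ≡ y * c j + c (suc j)
    pascal j = trans (cong (λ x → + x * y ^ suc j) (sym (nCk+nC[k+1]≡[n+1]C[k+1] n j))) (lem₃ (+ (n C j)) (+ (n C suc j)) y (y ^ j))
      where lem₃ : ∀ a b y z → (a + b) * (y * z) ≡ y * (a * z) + b * (y * z)
            lem₃ = solve-∀
    lem : ∀ a b → + 1 + (a + b) ≡ a + (+ 1 + b)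
    lem = solve-∀
    lem₂ : ∀ y s → y * s + (s + + 0) ≡ (+ 1 + y) * s
    lem₂ = solve-∀

^-double : ∀ y k → y ^ double k ≡ (y * y) ^ k
^-double y zero = refl
^-double y (suc k) = trans (cong (λ j → y * y ^ j) (ℕₚ.+-suc k k)) (trans (sym (ℤₚ.*-assoc y y _)) (cong (y * y *_) (^-double y k)))

∑-even-part : ∀ N (c : ℕ → ℤ) y → ∑ (double N) (λ j → c j * y ^ j) + ∑ (double N) (λ j → c j * (- y) ^ j) ≡ + 2 * ∑ N (λ k → c (double k) * (y * y) ^ k)
∑-even-part zero c y = lem (c 0)
  where lem : ∀ c → c * + 1 + c * + 1 ≡ + 2 * (c * + 1)
        lem = solve-∀
∑-even-part (suc N) c y = begin
  ∑ (double (suc N)) f + ∑ (double (suc N)) g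
    ≡⟨ cong (λ j → ∑ j f + ∑ j g) (cong suc (ℕₚ.+-suc N N)) ⟩
  (∑ (double N) f + f n₁ + f (suc n₁)) + (∑ (double N) g + g n₁ + g (suc n₁))
    ≡⟨ lem₁ (∑ (double N) f) (∑ (double N) g) (f n₁) (g n₁) (f (suc n₁)) (g (suc n₁)) ⟩
  (∑ (double N) f + ∑ (double N) g) + (f n₁ + g n₁) + (f (suc n₁) + g (suc n₁))
    ≡⟨ cong₂ _+_ (cong₂ _+_ (∑-even-part N c y) odd-part) even-part ⟩
  + 2 * ∑ N e + + 0 + + 2 * e (suc N)
    ≡⟨ lem₂ (∑ N e) (e (suc N)) ⟩
  + 2 * ∑ (suc N) e ∎
  where
    open ≡-Reasoning
    n₁ = suc (double N)
    f g e : ℕ → ℤ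
    f j = c j * y ^ j
    g j = c j * (- y) ^ j
    e k = c (double k) * (y * y) ^ k
    sq : (- y) * (- y) ≡ y * y
    sq = lem y
      where lem : ∀ y → (- y) * (- y) ≡ y * y
            lem = solve-∀
    -^ : (- y) ^ double N ≡ y ^ double N
    -^ = trans (^-double (- y) N) (trans (cong (_^ N) sq) (sym (^-double y N)))
    odd-part : f n₁ + g n₁ ≡ + 0
    odd-part = trans (cong (λ z → f n₁ + c n₁ * (- y * z)) -^) (lem (c n₁) y (y ^ double N))
      where lem : ∀ c y z → c * (y * z) + c * (- y * z) ≡ + 0
            lem = solve-∀
    even-part : f (suc n₁) + g (suc n₁) ≡ + 2 * e (suc N)
    even-part = begin
      f (suc n₁) + g (suc n₁)  ≡⟨ cong (λ z → f (suc n₁) + c (suc n₁) * (- y * (- y * z))) -^ ⟩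
      c (suc n₁) * (y * (y * y ^ double N)) + c (suc n₁) * (- y * (- y * y ^ double N)) ≡⟨ lem (c (suc n₁)) y (y ^ double N) ⟩
      + 2 * (c (suc n₁) * (y * y * y ^ double N)) ≡⟨ cong₂ (λ j z → + 2 * (c j * (y * y * z))) (cong suc (sym (ℕₚ.+-suc N N))) (^-double y N) ⟩
      + 2 * e (suc N) ∎
      where lem : ∀ c y z → c * (y * (y * z)) + c * (- y * (- y * z)) ≡ + 2 * (c * (y * y * z))
            lem = solve-∀
    lem₁ : ∀ a b c d e f → (a + c + e) + (b + d + f) ≡ (a + b) + (c + d) + (e + f)
    lem₁ = solve-∀
    lem₂ : ∀ s e → + 2 * s + + 0 + + 2 * e ≡ + 2 * (s + e)
    lem₂ = solve-∀

-- The sum of the theorem with an integer z standing for the residue of its rational argument.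
S : ℕ → ℤ → ℤ
S N z = ∑ N (λ k → + ((4 ℕ.* k) C (2 ℕ.* k)) * z ^ k)

^-distrib-* : ∀ x y k → (x * y) ^ k ≡ x ^ k * y ^ k
^-distrib-* x y zero = refl
^-distrib-* x y (suc k) = trans (cong (x * y *_) (^-distrib-* x y k)) (lem x y (x ^ k) (y ^ k))
  where lem : ∀ x y a b → x * y * (a * b) ≡ (x * a) * (y * b)
        lem = solve-∀

module Series (N : ℕ) (pr : Prime (odd (double N))) where
  h = double N
  p = + odd h

  -- The case j = 2k of `C-central-≅`; the 16 in y² ≡ 16z is (-4)².
  coefficient : ∀ k → k ℕ.≤ N → + ((4 ℕ.* k) C (2 ℕ.* k)) ≅ (+ 16) ^ k * + (h C double k) mod p
  coefficient k k≤N = begin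
    + ((4 ℕ.* k) C (2 ℕ.* k))            ≡⟨ cong₂ (λ a b → + (a C b)) (lem k) (lem₂ k) ⟩
    + ((2 ℕ.* double k) C double k)      ≅⟨ C-central-≅ h pr (double k) (double-mono k≤N) ⟩
    (- + 4) ^ double k * + (h C double k) ≡⟨ cong (_* + (h C double k)) (^-double (- + 4) k) ⟩
    (+ 16) ^ k * + (h C double k) ∎
    where
      open ≅-Reasoning p
      lem : ∀ k → 4 ℕ.* k ≡ 2 ℕ.* (k ℕ.+ k)
      lem = ℕ-Solver.solve-∀
      lem₂ : ∀ k → 2 ℕ.* k ≡ k ℕ.+ k
      lem₂ = ℕ-Solver.solve-∀

  S-≅ : ∀ {z y} → + 16 * z ≅ y * y mod p → + 2 * S N z ≅ (+ 1 + y) ^ h + (+ 1 - y) ^ h mod p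
  S-≅ {z} {y} e = begin
    + 2 * S N z
      ≅⟨ *-congˡ (+ 2) (∑-cong N term) ⟩
    + 2 * ∑ N (λ k → + (h C double k) * (y * y) ^ k)
      ≡⟨ sym (∑-even-part N (λ j → + (h C j)) y) ⟩
    ∑ h (λ j → + (h C j) * y ^ j) + ∑ h (λ j → + (h C j) * (- y) ^ j)
      ≡⟨ cong₂ _+_ (sym (binomial-theorem h y)) (sym (binomial-theorem h (- y))) ⟩
    (+ 1 + y) ^ h + (+ 1 - y) ^ h ∎
    where
      open ≅-Reasoning p
      lem : ∀ a b c → a * b * c ≡ b * (a * c)
      lem = solve-∀
      term : ∀ k → k ℕ.≤ N → + ((4 ℕ.* k) C (2 ℕ.* k)) * z ^ k ≅ + (h C double k) * (y * y) ^ k mod p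
      term k k≤N = begin
        + ((4 ℕ.* k) C (2 ℕ.* k)) * z ^ k        ≅⟨ *-congʳ (z ^ k) (coefficient k k≤N) ⟩
        (+ 16) ^ k * + (h C double k) * z ^ k      ≡⟨ lem ((+ 16) ^ k) (+ (h C double k)) (z ^ k) ⟩
        + (h C double k) * ((+ 16) ^ k * z ^ k)    ≡⟨ cong (+ (h C double k) *_) (sym (^-distrib-* (+ 16) z k)) ⟩
        + (h C double k) * (+ 16 * z) ^ k        ≅⟨ *-congˡ (+ (h C double k)) (^-cong k e) ⟩
        + (h C double k) * (y * y) ^ k ∎

  -- For y = β/α the factor α^h clears the denominators of (1 ± y)^h, and `gauss` reads the
  -- resulting h-th powers as symbols.
  S-symbols : ∀ {z α β} → Unit α p → Unit (α + β) p → Unit (α - β) p → α * α * (+ 16 * z) ≅ β * β mod p →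
    + 2 * (⟦ J α h ⟧ * S N z) ≅ ⟦ J (α + β) h ⟧ + ⟦ J (α - β) h ⟧ mod p
  S-symbols {z} {α} {β} u u⁺ u⁻ e = begin
    + 2 * (⟦ J α h ⟧ * S N z)         ≡⟨ lem₁ ⟦ J α h ⟧ (S N z) ⟩
    ⟦ J α h ⟧ * (+ 2 * S N z)         ≅⟨ *-cong (≅-sym (gauss h pr u)) (S-≅ {z} {y} e′) ⟩
    α ^ h * ((+ 1 + y) ^ h + (+ 1 - y) ^ h)      ≡⟨ trans (ℤₚ.*-distribˡ-+ (α ^ h) ((+ 1 + y) ^ h) ((+ 1 - y) ^ h)) (sym (cong₂ _+_ (^-distrib-* α (+ 1 + y) h) (^-distrib-* α (+ 1 - y) h))) ⟩
    (α * (+ 1 + y)) ^ h + (α * (+ 1 - y)) ^ h    ≅⟨ +-cong (^-cong h plus) (^-cong h minus) ⟩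
    (α + β) ^ h + (α - β) ^ h         ≅⟨ +-cong (gauss h pr u⁺) (gauss h pr u⁻) ⟩
    ⟦ J (α + β) h ⟧ + ⟦ J (α - β) h ⟧ ∎
    where
      open ≅-Reasoning p
      i = Unit.inv u
      y = i * β
      lem₁ : ∀ a s → + 2 * (a * s) ≡ a * (+ 2 * s)
      lem₁ = solve-∀
      αy : α * y ≅ β mod p
      αy = ≅-trans (≅-reflexive (sym (ℤₚ.*-assoc α i β))) (≅-trans (*-congʳ β (Unit.inv≅ u)) (≅-reflexive (ℤₚ.*-identityˡ β)))
      e′ : + 16 * z ≅ y * y mod p
      e′ = Unit-cancelˡ {α * α} (Unit-* u u) (≅-trans e (≅-trans (≅-sym (*-cong αy αy)) (≅-reflexive (lem α y))))
        where lem : ∀ a y → a * y * (a * y) ≡ a * a * (y * y)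
              lem = solve-∀
      plus : α * (+ 1 + y) ≅ α + β mod p
      plus = ≅-trans (≅-reflexive (lem α y)) (+-cong (≅-refl {x = α}) αy)
        where lem : ∀ a y → a * (+ 1 + y) ≡ a + a * y
              lem = solve-∀
      minus : α * (+ 1 - y) ≅ α - β mod p
      minus = ≅-trans (≅-reflexive (lem α y)) (+-cong (≅-refl {x = α}) (neg-cong αy))
        where lem : ∀ a y → a * (+ 1 - y) ≡ a - a * y
              lem = solve-∀

-- Reduction of rationals modulo p

module Reduction {p : ℕ} (pr : Prime p) where

  -- The graph of the ring homomorphism from the p-integral rationals to the integers modulo p, with
  -- any representative z allowed.
  record _↦_ (x : ℚ) (z : ℤ) : Set where
    constructor reduces
    field
      unit    : Unit (↧ x) (+ p)
      residue : ↥ x ≅ z * ↧ x mod + p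
  open _↦_

  -- Arithmetic on rationals normalises its result. The cancelled factor g divides the unit d, so it
  -- is a unit too and does not affect the residue.
  fraction : ∀ {x z n d} g → ↥ x * g ≡ n → ↧ x * g ≡ d → Unit d (+ p) → n ≅ z * d mod + p → x ↦ z
  fraction {x} {z} {n} {d} g n≡ d≡ u e = reduces (Unit-factorˡ {↧ x} {g} u′) (Unit-cancelˡ {g} (Unit-factorʳ {↧ x} {g} u′) (begin
    g * ↥ x       ≡⟨ trans (ℤₚ.*-comm g (↥ x)) n≡ ⟩
    n             ≅⟨ e ⟩
    z * d         ≡⟨ trans (cong (z *_) (sym d≡)) (lem z (↧ x) g) ⟩
    g * (z * ↧ x) ∎))
    where
      open ≅-Reasoning (+ p)
      u′ : Unit (↧ x * g) (+ p)
      u′ = subst (λ d → Unit d (+ p)) (sym d≡) u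
      lem : ∀ z d g → z * (d * g) ≡ g * (z * d)
      lem = solve-∀

  ↦-+ : ∀ {x y z w} → x ↦ z → y ↦ w → (x ℚ.+ y) ↦ (z + w)
  ↦-+ {x} {y} {z} {w} (reduces u e) (reduces v f) = fraction _ (ℚₚ.↥-+ x y) (ℚₚ.↧-+ x y) (Unit-* u v)
    (≅-trans (+-cong (*-congʳ (↧ y) e) (*-congʳ (↧ x) f)) (≅-reflexive (lem z w (↧ x) (↧ y))))
    where lem : ∀ z w a b → z * a * b + w * b * a ≡ (z + w) * (a * b)
          lem = solve-∀

  ↦-* : ∀ {x y z w} → x ↦ z → y ↦ w → (x ℚ.* y) ↦ (z * w)
  ↦-* {x} {y} {z} {w} (reduces u e) (reduces v f) = fraction _ (ℚₚ.↥-* x y) (ℚₚ.↧-* x y) (Unit-* u v)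
    (≅-trans (*-cong e f) (≅-reflexive (lem z w (↧ x) (↧ y))))
    where lem : ∀ z w a b → z * a * (w * b) ≡ z * w * (a * b)
          lem = solve-∀

  ↦-neg : ∀ {x z} → x ↦ z → (ℚ.- x) ↦ (- z)
  ↦-neg {x} {z} (reduces u e) = fraction (+ 1) (trans (ℤₚ.*-identityʳ _) (ℚₚ.↥-neg x)) (trans (ℤₚ.*-identityʳ _) (ℚₚ.↧-neg x)) u
    (≅-trans (neg-cong e) (≅-reflexive (ℤₚ.neg-distribˡ-* z (↧ x))))

  ↦-≅ : ∀ {x z w} → z ≅ w mod + p → x ↦ z → x ↦ w
  ↦-≅ {x} q (reduces u e) = reduces u (≅-trans e (*-congʳ (↧ x) q))

  ↦-/ : ∀ n k z → Unit (+ suc k) (+ p) → n ≅ z * + suc k mod + p → (n ℚ./ suc k) ↦ z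
  ↦-/ n k z = fraction (gcd n (+ suc k)) (ℚₚ.↥-/ n (suc k)) (ℚₚ.↧-/ n (suc k))

  ↦-toℚ : ∀ n → toℚ n ↦ n
  ↦-toℚ n = ↦-/ n 0 n (Unit-1 (+ p)) (≅-reflexive (sym (ℤₚ.*-identityʳ n)))

  ↦-// : ∀ n d z → Unit d (+ p) → n ≅ z * d mod + p → (n // d) ↦ z
  ↦-// n (+ zero)  z u e = ⊥-elim (Unit⇒∤ pr u ≅-refl)
  ↦-// n (+ suc k) z u e = ↦-/ n k z u e
  ↦-// n -[1+ k ]  z u e = ↦-/ (- n) k z (Unit-neg u) (≅-trans (neg-cong e) (≅-reflexive (lem z (+ suc k))))
    where lem : ∀ z k → - (z * - k) ≡ z * k
          lem = solve-∀

  ↦-^ : ∀ {x z} k → x ↦ z → (x ^ℚ k) ↦ (z ^ k)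
  ↦-^ zero    r = reduces (Unit-1 (+ p)) ≅-refl
  ↦-^ (suc k) r = ↦-* r (↦-^ k r)

  ↦-sumTo : ∀ N {f g} → (∀ k → f k ↦ g k) → sumTo N f ↦ ∑ N g
  ↦-sumTo zero    r = r 0
  ↦-sumTo (suc N) r = ↦-+ (↦-sumTo N r) (r (suc N))

  ↦-series : ∀ N {x z} → x ↦ z → sumTo N (λ k → toℚ (+ ((4 ℕ.* k) C (2 ℕ.* k))) ℚ.* x ^ℚ k) ↦ S N z
  ↦-series N r = ↦-sumTo N (λ k → ↦-* (↦-toℚ (+ ((4 ℕ.* k) C (2 ℕ.* k)))) (↦-^ k r))

  ↦⇒≡ℚ : ∀ {x y z} → x ↦ z → y ↦ z → x ≡ℚ y [mod p ]
  ↦⇒≡ℚ {x} {y} {z} r s = denominator r , denominator s , ≅0⇒∣ {+ p} (≅-trans (residue r-s) (≅-reflexive (trans (cong (_* ↧ (x ℚ.- y)) (ℤₚ.+-inverseʳ z)) (ℤₚ.*-zeroˡ (↧ (x ℚ.- y))))))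
    where
      denominator : ∀ {x z} → x ↦ z → ¬ (p ℕD.∣ ↧ₙ x)
      denominator {x} r p∣x = Unit⇒∤ pr (unit r) (∣⇒≅0 {+ p} {↧ x} p∣x)
      r-s : (x ℚ.- y) ↦ (z - z)
      r-s = ↦-+ r (↦-neg s)

-- Parity

-- The witness is kept because half of an odd |x| is the second argument of `J` when x becomes the
-- modulus.
Odd Even : ℤ → Set
Odd x  = Σ ℕ λ u → ∣ x ∣ ≡ odd u
Even x = Σ ℕ λ u → ∣ x ∣ ≡ double u

abs-≅ : ∀ x → x ≅ + ∣ x ∣ mod + 2
abs-≅ (+ n)    = ≅-refl
abs-≅ -[1+ n ] = by (- + suc n) (lem (+ suc n))
  where lem : ∀ n → - n ≡ n + (- n) * + 2
        lem = solve-∀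

double≅0 : ∀ w → + double w ≅ + 0 mod + 2
double≅0 w = by (+ w) (trans (ℤₚ.pos-+ w w) (lem (+ w)))
  where lem : ∀ w → w + w ≡ + 0 + w * + 2
        lem = solve-∀

Even⇒≅0 : ∀ {x} → Even x → x ≅ + 0 mod + 2
Even⇒≅0 {x} (w , e) = ≅-trans (abs-≅ x) (≅-trans (≅-reflexive (cong +_ e)) (double≅0 w))

Odd⇒≅1 : ∀ {x} → Odd x → x ≅ + 1 mod + 2
Odd⇒≅1 {x} (w , e) = ≅-trans (abs-≅ x) (≅-trans (≅-reflexive (cong +_ e)) (+-cong (≅-refl {x = + 1}) (double≅0 w)))

1≇0mod2 : ¬ (+ 1 ≅ + 0 mod + 2)
1≇0mod2 e with remainder-unique {2} {1} {0} e (s≤s (s≤s z≤n)) (s≤s z≤n)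
... | ()

parityℤ : ∀ x → Even x ⊎ Odd x
parityℤ x with ∣ x ∣ | parity ∣ x ∣
... | _ | isEven w = inj₁ (w , refl)
... | _ | isOdd w  = inj₂ (w , refl)

≅1⇒Odd : ∀ {x} → x ≅ + 1 mod + 2 → Odd x
≅1⇒Odd {x} e = [ (λ ev → ⊥-elim (1≇0mod2 (≅-trans (≅-sym e) (Even⇒≅0 {x} ev)))) , (λ o → o) ]′ (parityℤ x)

≅0⇒Even : ∀ {x} → x ≅ + 0 mod + 2 → Even x
≅0⇒Even {x} e = [ (λ ev → ev) , (λ o → ⊥-elim (1≇0mod2 (≅-trans (≅-sym (Odd⇒≅1 {x} o)) e))) ]′ (parityℤ x)

Unit-2-Odd : ∀ {x} → Odd x → Unit (+ 2) x
Unit-2-Odd {x} (u , e) = Unit-mod-sign x (subst (λ n → Unit (+ 2) (+ n)) (sym e) (Unit-2 u))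

Unit-2⇒Odd : ∀ {x} → Unit (+ 2) x → Odd x
Unit-2⇒Odd {x} u with parityℤ x
... | inj₂ o  = o
... | inj₁ ev with Unit-sym u
...   | i , q = ⊥-elim (1≇0mod2 (≅-trans (≅-sym q) (≅-trans (*-congʳ i (Even⇒≅0 {x} ev)) (≅-reflexive (ℤₚ.*-zeroˡ i)))))

square-abs : ∀ x → x * x ≡ + (∣ x ∣ ℕ.* ∣ x ∣)
square-abs (+ n)    = sym (ℤₚ.pos-* n n)
square-abs -[1+ n ] = refl

double-triangle : ∀ a → double (triangle a) ≡ a ℕ.* suc a
double-triangle zero = refl
double-triangle (suc a) = trans (lem (suc a) (triangle a)) (trans (cong (suc a ℕ.+ suc a ℕ.+_) (double-triangle a)) (lem₂ a))
  where lem : ∀ s t → (s ℕ.+ t) ℕ.+ (s ℕ.+ t) ≡ (s ℕ.+ s) ℕ.+ (t ℕ.+ t)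
        lem = ℕ-Solver.solve-∀
        lem₂ : ∀ a → suc a ℕ.+ suc a ℕ.+ a ℕ.* suc a ≡ suc a ℕ.* suc (suc a)
        lem₂ = ℕ-Solver.solve-∀

odd-square : ∀ a → odd a ℕ.* odd a ≡ 1 ℕ.+ 8 ℕ.* triangle a
odd-square a = trans (lem a) (trans (cong (λ x → 1 ℕ.+ 4 ℕ.* x) (sym (double-triangle a))) (lem₂ (triangle a)))
  where lem : ∀ a → suc (a ℕ.+ a) ℕ.* suc (a ℕ.+ a) ≡ 1 ℕ.+ 4 ℕ.* (a ℕ.* suc a)
        lem = ℕ-Solver.solve-∀
        lem₂ : ∀ t → 1 ℕ.+ 4 ℕ.* (t ℕ.+ t) ≡ 1 ℕ.+ 8 ℕ.* t
        lem₂ = ℕ-Solver.solve-∀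

Odd-square : ∀ {x} (o : Odd x) → x * x ≡ + (1 ℕ.+ 8 ℕ.* triangle (proj₁ o))
Odd-square {x} (u , e) = trans (square-abs x) (cong +_ (trans (cong₂ ℕ._*_ e e) (odd-square u)))

Even-square : ∀ {x} (e : Even x) → x * x ≡ + (4 ℕ.* (proj₁ e ℕ.* proj₁ e))
Even-square {x} (u , e) = trans (square-abs x) (cong +_ (trans (cong₂ ℕ._*_ e e) (lem u)))
  where lem : ∀ a → (a ℕ.+ a) ℕ.* (a ℕ.+ a) ≡ 4 ℕ.* (a ℕ.* a)
        lem = ℕ-Solver.solve-∀

-- The explicit quotient by 4 is needed: compared with p = 4N + 1 it yields the parity of N in
-- `par-N`.
odd-sum : ∀ {x y} (o : Odd x) (e : Even y) → x * x + y * y ≡ + odd (double (2 ℕ.* triangle (proj₁ o) ℕ.+ proj₁ e ℕ.* proj₁ e))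
odd-sum {x} {y} o e = trans (cong₂ _+_ (Odd-square {x} o) (Even-square {y} e)) (cong +_ (lem (triangle (proj₁ o)) (proj₁ e ℕ.* proj₁ e)))
  where lem : ∀ t s → 1 ℕ.+ 8 ℕ.* t ℕ.+ 4 ℕ.* s ≡ suc ((2 ℕ.* t ℕ.+ s ℕ.+ (2 ℕ.* t ℕ.+ s)) ℕ.+ (2 ℕ.* t ℕ.+ s ℕ.+ (2 ℕ.* t ℕ.+ s)))
        lem = ℕ-Solver.solve-∀

-- Odd squares are ≡ 1 mod 8, so half of the sum is again ≡ 1 mod 4.
even-sum : ∀ {x y} (o : Odd x) (o′ : Odd y) → x * x + y * y ≡ + 2 * + odd (double (triangle (proj₁ o) ℕ.+ triangle (proj₁ o′)))
even-sum {x} {y} o o′ = trans (cong₂ _+_ (Odd-square {x} o) (Odd-square {y} o′))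
  (trans (cong +_ (lem (triangle (proj₁ o)) (triangle (proj₁ o′)))) (ℤₚ.pos-* 2 (odd (double (triangle (proj₁ o) ℕ.+ triangle (proj₁ o′))))))
  where lem : ∀ t s → 1 ℕ.+ 8 ℕ.* t ℕ.+ (1 ℕ.+ 8 ℕ.* s) ≡ 2 ℕ.* suc ((t ℕ.+ s ℕ.+ (t ℕ.+ s)) ℕ.+ (t ℕ.+ s ℕ.+ (t ℕ.+ s)))
        lem = ℕ-Solver.solve-∀

par-square : ∀ k → par (k ℕ.* k) ≡ par k
par-square zero = refl
par-square (suc k) = trans (cong par (lem k)) (trans (par-+ (suc (k ℕ.+ k)) (k ℕ.* k)) (cong₂ _·_ (cong (⊖ ·_) (par-double k)) (par-square k)))
  where lem : ∀ k → suc k ℕ.* suc k ≡ suc (k ℕ.+ k) ℕ.+ k ℕ.* k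
        lem = ℕ-Solver.solve-∀

-- The triangular number of 2N is N(2N + 1).
par-triangle-double : ∀ N → par (triangle (double N)) ≡ par N
par-triangle-double zero = refl
par-triangle-double (suc N) = begin
  par (triangle (suc (N ℕ.+ suc N)))              ≡⟨ cong (par ∘ triangle ∘ suc) (ℕₚ.+-suc N N) ⟩
  par (suc (suc (double N)) ℕ.+ (suc (double N) ℕ.+ triangle (double N)))
    ≡⟨ cong par (lem (double N) (triangle (double N))) ⟩
  par (suc (suc (double N) ℕ.+ suc (double N)) ℕ.+ triangle (double N))
    ≡⟨ par-+ (suc (suc (double N) ℕ.+ suc (double N))) (triangle (double N)) ⟩
  (⊖ · par (double (suc (double N)))) · par (triangle (double N))
    ≡⟨ cong₂ (λ s t → (⊖ · s) · t) (par-double (suc (double N))) (par-triangle-double N) ⟩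
  par (suc N) ∎
  where
    open ≡-Reasoning
    lem : ∀ a t → suc (suc a) ℕ.+ (suc a ℕ.+ t) ≡ suc (suc a ℕ.+ suc a) ℕ.+ t
    lem = ℕ-Solver.solve-∀

prime-square : ∀ {p x} → Prime p → x * x ≅ + 0 mod + p → x ≅ + 0 mod + p
prime-square {p} {x} pr e with p ℕD.∣? ∣ x ∣
... | yes d = ∣⇒≅0 {+ p} {x} d
... | no ¬d = ⊥-elim (Unit⇒∤ pr (Unit-* u u) e)
  where u = prime∤⇒Unit {p} {x} pr ¬d

-- If p divided y it would divide x as well, and then p² would divide p.
∑-squares-nonzero : ∀ {p x y} → Prime p → + p ≡ x * x + y * y → ¬ (y ≅ + 0 mod + p)
∑-squares-nonzero {p} {x} {y} pr e y≅0 = contradict (prime-square {x = x} pr x²≅0) y≅0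
  where
    x²≅0 : x * x ≅ + 0 mod + p
    x²≅0 = ≅-trans (≅-reflexive (trans (lem (x * x) (y * y)) (cong (_- y * y) (sym e)))) (+-cong (n≅0 (+ p)) (neg-cong (*-cong y≅0 y≅0)))
      where lem : ∀ a b → a ≡ (a + b) - b
            lem = solve-∀
    p≢0 : + p ≢ + 0
    p≢0 refl = ¬prime[0] pr
    lem : ∀ k l p → (+ 0 + k * p) * (+ 0 + k * p) + (+ 0 + l * p) * (+ 0 + l * p) ≡ p * (+ 0 + (k * k + l * l) * p)
    lem = solve-∀
    open ≡-Reasoning
    contradict : x ≅ + 0 mod + p → y ≅ + 0 mod + p → ⊥
    contradict (by k x≡) (by l y≡) = Unit⇒∤ pr (Unit-1 (+ p)) (by (k * k + l * l) (ℤₚ.*-cancelˡ-≡ (+ p) _ _ {{ℤ.≢-nonZero p≢0}} (begin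
      + p * + 1                                    ≡⟨ ℤₚ.*-identityʳ (+ p) ⟩
      + p                                          ≡⟨ e ⟩
      x * x + y * y                                ≡⟨ cong₂ (λ x y → x * x + y * y) x≡ y≡ ⟩
      (+ 0 + k * + p) * (+ 0 + k * + p) + (+ 0 + l * + p) * (+ 0 + l * + p) ≡⟨ lem k l (+ p) ⟩
      + p * (+ 0 + (k * k + l * l) * + p) ∎)))

/-exact : ∀ n y → (y * + suc n) ℤ./ + suc n ≡ y
/-exact n y = ℤₚ.*-cancelʳ-≡ _ _ (+ suc n) (sym (trans (ℤDM.a≡a%n+[a/n]*n x (+ suc n))
    (trans (cong (λ r → + r + (x ℤ./ + suc n) * + suc n) (%ℕ-unique {x} {suc n} {0} (by y (sym (ℤₚ.+-identityˡ x))) (s≤s z≤n))) (ℤₚ.+-identityˡ _))))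
  where x = y * + suc n

half : ∀ {x} → + 2 ∣ x → (x ℤ./ + 2) * + 2 ≡ x
half {x} d with ∣⇒≅0 {+ 2} {x} d
... | by q e = trans (cong (λ z → (z ℤ./ + 2) * + 2) x≡) (trans (cong (_* + 2) (/-exact 1 q)) (sym x≡))
  where x≡ : x ≡ q * + 2
        x≡ = trans e (ℤₚ.+-identityˡ (q * + 2))

Even⇒par : ∀ {x} → Even x → par ∣ x ∣ ≡ ⊕
Even⇒par (w , e) = trans (cong par e) (par-double w)

Odd⇒par : ∀ {x} → Odd x → par ∣ x ∣ ≡ ⊖
Odd⇒par (w , e) = trans (cong par e) (cong (⊖ ·_) (par-double w))

par-∣+∣ : ∀ x y → par ∣ x + y ∣ ≡ par ∣ x ∣ · par ∣ y ∣
par-∣+∣ x y with parityℤ x | parityℤ y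
... | inj₁ e | inj₁ f = trans (Even⇒par {x + y} (≅0⇒Even (+-cong (Even⇒≅0 {x} e) (Even⇒≅0 {y} f)))) (sym (cong₂ _·_ (Even⇒par {x} e) (Even⇒par {y} f)))
... | inj₁ e | inj₂ f = trans (Odd⇒par {x + y} (≅1⇒Odd (+-cong (Even⇒≅0 {x} e) (Odd⇒≅1 {y} f)))) (sym (cong₂ _·_ (Even⇒par {x} e) (Odd⇒par {y} f)))
... | inj₂ e | inj₁ f = trans (Odd⇒par {x + y} (≅1⇒Odd (+-cong (Odd⇒≅1 {x} e) (Even⇒≅0 {y} f)))) (sym (cong₂ _·_ (Odd⇒par {x} e) (Even⇒par {y} f)))
... | inj₂ e | inj₂ f = trans (Even⇒par {x + y} (≅0⇒Even (≅-trans (+-cong (Odd⇒≅1 {x} e) (Odd⇒≅1 {y} f)) (n≅0 (+ 2))))) (sym (cong₂ _·_ (Odd⇒par {x} e) (Odd⇒par {y} f)))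

negOnePow-par : ∀ e → negOnePow e ≡ ⟦ par ∣ e ∣ ⟧
negOnePow-par e = go (parityℤ e)
  where
    %2 : ∀ {r} → e ≅ + r mod + 2 → r ℕ.< 2 → ∣ e ∣ ℕ.% 2 ≡ r
    %2 q r<2 = %ℕ-unique {+ ∣ e ∣} {2} (≅-trans (≅-sym (abs-≅ e)) q) r<2
    negOnePow-0 : ∣ e ∣ ℕ.% 2 ≡ 0 → negOnePow e ≡ + 1
    negOnePow-0 q rewrite q = refl
    negOnePow-1 : ∣ e ∣ ℕ.% 2 ≡ 1 → negOnePow e ≡ -[1+ 0 ]
    negOnePow-1 q rewrite q = refl
    go : Even e ⊎ Odd e → negOnePow e ≡ ⟦ par ∣ e ∣ ⟧
    go (inj₁ ev) = trans (negOnePow-0 (%2 (Even⇒≅0 {e} ev) (s≤s z≤n))) (cong ⟦_⟧ (sym (Even⇒par {e} ev)))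
    go (inj₂ o)  = trans (negOnePow-1 (%2 (Odd⇒≅1 {e} o) (s≤s (s≤s z≤n)))) (cong ⟦_⟧ (sym (Odd⇒par {e} o)))

-- Symbols attached to p = c² + d²

signs-agree : ∀ s t → s · t ≡ ⊕ → ⟦ s ⟧ + ⟦ t ⟧ ≡ + 2 * ⟦ s ⟧
signs-agree ⊕ ⊕ _ = refl
signs-agree ⊖ ⊖ _ = refl

signs-differ : ∀ s t → s · t ≡ ⊖ → ⟦ s ⟧ + ⟦ t ⟧ ≡ + 2 * + 0
signs-differ ⊕ ⊖ _ = refl
signs-differ ⊖ ⊕ _ = refl

module TwoSquares (N : ℕ) (pr : Prime (odd (double N))) (c d : ℤ)
  (p≡ : + odd (double N) ≡ c * c + d * d) (2∣d : + 2 ∣ d) where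

  h = double N
  P = + odd h

  d₀ = d ℤ./ + 2

  d≡ : d₀ * + 2 ≡ d
  d≡ = half {d} 2∣d

  d-even : Even d
  d-even = ∣ d₀ ∣ , trans (cong ∣_∣ (sym d≡)) (trans (ℤₚ.abs-* d₀ (+ 2)) (lem ∣ d₀ ∣))
    where lem : ∀ x → x ℕ.* 2 ≡ x ℕ.+ x
          lem = ℕ-Solver.solve-∀

  c-odd : Odd c
  c-odd with parityℤ c
  ... | inj₂ o = o
  ... | inj₁ e = ⊥-elim (1≇0mod2 (≅-trans (≅-sym (Odd⇒≅1 {P} (h , refl))) (≅-trans (≅-reflexive p≡)
                   (+-cong (*-cong (Even⇒≅0 {c} e) (Even⇒≅0 {c} e)) (*-cong (Even⇒≅0 {d} d-even) (Even⇒≅0 {d} d-even))))))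

  d-unit : Unit d P
  d-unit = prime∤⇒Unit′ pr (∑-squares-nonzero {x = c} pr p≡)

  c-unit : Unit c P
  c-unit = prime∤⇒Unit′ pr (∑-squares-nonzero {x = d} pr (trans p≡ (ℤₚ.+-comm (c * c) (d * d))))

  2-unit : Unit (+ 2) P
  2-unit = Unit-2 h

  -- By reciprocity the symbol is that of p modulo |x|, and p ≡ s². In `square-relation` the second
  -- modulus is taken to be 1, whose half is 0.
  J-divisor : ∀ x {s k} → Odd x → Unit x P → s * s ≡ P + k * x → J x h ≡ ⊕
  J-divisor x {s} {k} (u , x≡) unit e = trans (sym (Signₚ.*-identityʳ (J x h)))
    (trans (square-relation N 0 u {x} {s} {+ 1} x≡ unit (+ 0 , by (x * + 0 - + 1) (lem (x * + 0))) (Unit-1 x) (by k (trans e (cong (_+ k * x) (lem₂ P))))) (J-1 u))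
    where lem : ∀ y → y ≡ + 1 + (y - + 1) * + 1
          lem = solve-∀
          lem₂ : ∀ p → p ≡ + 1 * (p * + 1)
          lem₂ = solve-∀

  J-c : J c h ≡ ⊕
  J-c = J-divisor c {d} { - c} c-odd c-unit (trans (lem c d) (cong (_+ - c * c) (sym p≡)))
    where lem : ∀ c d → d * d ≡ (c * c + d * d) + - c * c
          lem = solve-∀

  J-odd-divisor : ∀ x y → Odd x → x * y ≡ d → J x h ≡ ⊕
  J-odd-divisor x y o e = J-divisor x {c} { - (d * y)} o (Unit-factorˡ {x} {y} (subst (λ z → Unit z P) (sym e) d-unit))
    (trans (lem c d) (cong₂ _+_ (sym p≡) (trans (cong (λ z → - (d * z)) (sym e)) (lem₂ d x y))))
    where lem : ∀ c d → c * c ≡ (c * c + d * d) + - (d * d)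
          lem = solve-∀
          lem₂ : ∀ d x y → - (d * (x * y)) ≡ - (d * y) * x
          lem₂ = solve-∀

  -- From p = c² + 4d₀² and c² ≡ 1 mod 8, N ≡ d₀² mod 2.
  par-N : par N ≡ par ∣ d₀ ∣
  par-N = trans (cong par N≡) (trans (par-+ (2 ℕ.* T) (∣ d₀ ∣ ℕ.* ∣ d₀ ∣))
      (cong₂ _·_ (trans (cong par (lem T)) (par-double T)) (par-square ∣ d₀ ∣)))
    where
      T = triangle (proj₁ c-odd)
      lem : ∀ t → 2 ℕ.* t ≡ t ℕ.+ t
      lem = ℕ-Solver.solve-∀
      N≡ : N ≡ 2 ℕ.* T ℕ.+ ∣ d₀ ∣ ℕ.* ∣ d₀ ∣
      N≡ = odd-injective (cong suc (odd-injective (ℤₚ.+-injective (trans p≡ (odd-sum {c} {d} c-odd d-even)))))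

  -- The origin of d/2 in the exponent of the second case.
  J-2-h : J (+ 2) h ≡ par ∣ d₀ ∣
  J-2-h = trans (J-2 h) (trans (par-triangle-double N) par-N)

  -- If 4 ∣ d then 2 is a residue and may be split off from any divisor of d.
  J-all-divisors : J (+ 2) h ≡ ⊕ → ∀ fuel x y → x ℕ.≤ fuel → + x * y ≡ d → J (+ x) h ≡ ⊕
  J-all-divisors J2 zero zero y x≤ e = ⊥-elim (Unit⇒∤ pr d-unit (≅-reflexive (trans (sym e) (ℤₚ.*-zeroˡ y))))
  J-all-divisors J2 (suc fuel) x y x≤ e with parity x
  ... | isOdd w        = J-odd-divisor (+ odd w) y (w , refl) e
  ... | isEven zero    = ⊥-elim (Unit⇒∤ pr d-unit (≅-reflexive (trans (sym e) (ℤₚ.*-zeroˡ y))))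
  ... | isEven (suc w) = trans (cong (λ z → J z h) x≡) (trans (J-* h w-unit 2-unit)
          (cong₂ _·_ (J-all-divisors J2 fuel (suc w) (+ 2 * y) (ℕₚ.≤-trans (ℕₚ.m≤n+m (suc w) w) (ℕₚ.≤-pred x≤)) e′) J2))
    where
      x≡ : + double (suc w) ≡ + suc w * + 2
      x≡ = trans (cong +_ (lem (suc w))) (ℤₚ.pos-* (suc w) 2)
        where lem : ∀ w → w ℕ.+ w ≡ w ℕ.* 2
              lem = ℕ-Solver.solve-∀
      e′ : + suc w * (+ 2 * y) ≡ d
      e′ = trans (sym (ℤₚ.*-assoc (+ suc w) (+ 2) y)) (trans (cong (_* y) (sym x≡)) e)
      w-unit : Unit (+ suc w) P
      w-unit = Unit-factorˡ {+ suc w} {+ 2 * y} (subst (λ z → Unit z P) (sym e′) d-unit)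

  d₀-unit : Unit d₀ P
  d₀-unit = Unit-factorˡ {d₀} {+ 2} (subst (λ z → Unit z P) (sym d≡) d-unit)

  -- An odd d₀ is an odd divisor of d. If d₀ is even, then 2 is a residue and powers of 2 do no
  -- harm.
  J-d₀ : J d₀ h ≡ ⊕
  J-d₀ with parityℤ d₀
  ... | inj₂ o = J-odd-divisor d₀ (+ 2) o d≡
  ... | inj₁ (w , e) = trans (sym (J-abs N d₀ d₀-unit)) (J-all-divisors J2 ∣ d₀ ∣ ∣ d₀ ∣ (proj₁ cofactor) ℕₚ.≤-refl (proj₂ cofactor))
    where
      J2 : J (+ 2) h ≡ ⊕
      J2 = trans J-2-h (trans (cong par e) (par-double w))
      cofactor : Σ ℤ λ y → + ∣ d₀ ∣ * y ≡ d
      cofactor = [ (λ q → + 2 , trans (cong (_* + 2) q) d≡) , (λ q → - + 2 , trans (cong (_* - + 2) q) (trans (lem d₀) d≡)) ]′ (ℤₚ.+∣i∣≡i⊎+∣i∣≡-i d₀)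
        where lem : ∀ x → - x * - + 2 ≡ x * + 2
              lem = solve-∀

  J-4 : ∀ {x} → Unit x P → J (+ 2 * (+ 2 * x)) h ≡ J x h
  J-4 {x} u = trans (J-* h 2-unit (Unit-* 2-unit u)) (trans (cong (J (+ 2) h ·_) (J-* h 2-unit u))
    (trans (sym (Signₚ.*-assoc (J (+ 2) h) (J (+ 2) h) (J x h))) (cong (_· J x h) (Signₚ.s*s≡+ (J (+ 2) h)))))

  -- Here 2d = 4d₀; d itself has the symbol of 2, which may be -1.
  J-2d : J (+ 2 * d) h ≡ ⊕
  J-2d = trans (cong (λ z → J z h) (trans (cong (+ 2 *_) (sym d≡)) (lem d₀))) (trans (J-4 d₀-unit) J-d₀)
    where lem : ∀ x → + 2 * (x * + 2) ≡ + 2 * (+ 2 * x)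
          lem = solve-∀

  open Series N pr using (S-symbols)

  -- The symbols of α + β and α - β have product s: they are equal, and their sum is twice one of
  -- them, or they cancel. The factor 2 is then divided out.
  S-value : ∀ {z α β} s → Unit α P → Unit ((α + β) * (α - β)) P → J ((α + β) * (α - β)) h ≡ s → α * α * (+ 16 * z) ≅ β * β mod P →
    (s ≡ ⊕ → ⟦ J α h ⟧ * S N z ≅ ⟦ J (α + β) h ⟧ mod P) × (s ≡ ⊖ → ⟦ J α h ⟧ * S N z ≅ + 0 mod P)
  S-value {z} {α} {β} s u u± e± e =
      (λ { refl → Unit-cancelˡ 2-unit (≅-trans total (≅-reflexive (signs-agree (J (α + β) h) (J (α - β) h) product))) })
    , (λ { refl → Unit-cancelˡ 2-unit (≅-trans total (≅-reflexive (signs-differ (J (α + β) h) (J (α - β) h) product))) })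
    where
      u⁺ = Unit-factorˡ {α + β} {α - β} u±
      u⁻ = Unit-factorʳ {α + β} {α - β} u±
      total = S-symbols {z} {α} {β} u u⁺ u⁻ e
      product : J (α + β) h · J (α - β) h ≡ s
      product = trans (sym (J-* h u⁺ u⁻)) e±

  module Values (b m : ℤ) (B-unit : Unit (b * b + + 4 * (m * m)) P) where
    B = b * b + + 4 * (m * m)
    t = b * c + + 2 * (m * d)

    d²B-unit : Unit (d * d * B) P
    d²B-unit = Unit-* (Unit-* d-unit d-unit) B-unit

    J-d²B : J (d * d * B) h ≡ J B h
    J-d²B = trans (J-* h (Unit-* d-unit d-unit) B-unit) (cong (_· J B h) (J-square h d-unit))

    -- The choice α = 2dm has the symbol of m by `J-2d`. The minus sign of the argument is absorbed
    -- by (c/d)² ≡ -1, which also turns α² - β² into d²B.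
    S₁-value : ∀ {z} → Unit m P → - (b * b) ≅ z * (+ 64 * (m * m)) mod P →
      (J B h ≡ ⊕ → ⟦ J m h ⟧ * S N z ≅ ⟦ J t h ⟧ mod P) × (J B h ≡ ⊖ → ⟦ J m h ⟧ * S N z ≅ + 0 mod P)
    S₁-value {z} m-unit e = subst₂ (λ s x → (J B h ≡ ⊕ → ⟦ s ⟧ * S N z ≅ ⟦ J x h ⟧ mod P) × (J B h ≡ ⊖ → ⟦ s ⟧ * S N z ≅ + 0 mod P))
        (trans (J-* h (Unit-* 2-unit d-unit) m-unit) (cong (_· J m h) J-2d)) (lem₁ b c d m)
        (S-value {z} {α} {β} (J B h) (Unit-* (Unit-* 2-unit d-unit) m-unit) (Unit-≅ (≅-sym ±≅) d²B-unit) (trans (J-cong h ±≅) J-d²B) hyp)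
      where
        α = + 2 * d * m
        β = b * c
        lem₁ : ∀ b c d m → + 2 * d * m + b * c ≡ b * c + + 2 * (m * d)
        lem₁ = solve-∀
        ±≅ : (α + β) * (α - β) ≅ d * d * B mod P
        ±≅ = by (- (b * b)) (trans (lem b c d m) (cong (λ p → d * d * B + - (b * b) * p) (sym p≡)))
          where lem : ∀ b c d m → (+ 2 * d * m + b * c) * (+ 2 * d * m - b * c) ≡ d * d * (b * b + + 4 * (m * m)) + - (b * b) * (c * c + d * d)
                lem = solve-∀
        hyp : α * α * (+ 16 * z) ≅ β * β mod P
        hyp = begin
          α * α * (+ 16 * z)                 ≡⟨ lem d m z ⟩
          d * d * (z * (+ 64 * (m * m)))     ≅⟨ *-congˡ (d * d) (≅-sym e) ⟩
          d * d * - (b * b)                  ≅⟨ by (- (b * b)) (trans (lem₂ b c d) (cong (λ p → β * β + - (b * b) * p) (sym p≡))) ⟩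
          β * β ∎
          where open ≅-Reasoning P
                lem : ∀ d m z → + 2 * d * m * (+ 2 * d * m) * (+ 16 * z) ≡ d * d * (z * (+ 64 * (m * m)))
                lem = solve-∀
                lem₂ : ∀ b c d → d * d * - (b * b) ≡ b * c * (b * c) + - (b * b) * (c * c + d * d)
                lem₂ = solve-∀

    -- With α and β exchanged, α has the symbol of b by `J-c`, and α + β is the same t as before:
    -- hence the two sides of the theorem agree. The product is now -d²B, and -1 is a square modulo
    -- p.
    S₂-value : ∀ {z} → Unit b P → - (m * m) ≅ z * (+ 4 * (b * b)) mod P →
      (J B h ≡ ⊕ → ⟦ J b h ⟧ * S N z ≅ ⟦ J t h ⟧ mod P) × (J B h ≡ ⊖ → ⟦ J b h ⟧ * S N z ≅ + 0 mod P)
    S₂-value {z} b-unit e = subst (λ s → (J B h ≡ ⊕ → ⟦ s ⟧ * S N z ≅ ⟦ J t h ⟧ mod P) × (J B h ≡ ⊖ → ⟦ s ⟧ * S N z ≅ + 0 mod P))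
        (trans (J-* h b-unit c-unit) (trans (cong (J b h ·_) J-c) (Signₚ.*-identityʳ (J b h))))
        (S-value {z} {α} {β} (J B h) (Unit-* b-unit c-unit) (Unit-≅ (≅-sym ±≅) (Unit-neg d²B-unit))
          (trans (J-cong h ±≅) (trans (J-neg N d²B-unit) J-d²B)) hyp)
      where
        α = b * c
        β = + 2 * (m * d)
        ±≅ : (α + β) * (α - β) ≅ - (d * d * B) mod P
        ±≅ = by (b * b) (trans (lem b c d m) (cong (λ p → - (d * d * B) + (b * b) * p) (sym p≡)))
          where lem : ∀ b c d m → (b * c + + 2 * (m * d)) * (b * c - + 2 * (m * d)) ≡ - (d * d * (b * b + + 4 * (m * m))) + (b * b) * (c * c + d * d)
                lem = solve-∀
        hyp : α * α * (+ 16 * z) ≅ β * β mod P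
        hyp = begin
          α * α * (+ 16 * z)                     ≡⟨ lem b c z ⟩
          + 4 * (c * c) * (z * (+ 4 * (b * b)))  ≅⟨ *-congˡ (+ 4 * (c * c)) (≅-sym e) ⟩
          + 4 * (c * c) * - (m * m)              ≅⟨ by (- (+ 4 * (m * m))) (trans (lem₂ m c d) (cong (λ p → β * β + - (+ 4 * (m * m)) * p) (sym p≡))) ⟩
          β * β ∎
          where open ≅-Reasoning P
                lem : ∀ b c z → b * c * (b * c) * (+ 16 * z) ≡ + 4 * (c * c) * (z * (+ 4 * (b * b)))
                lem = solve-∀
                lem₂ : ∀ m c d → + 4 * (c * c) * - (m * m) ≡ + 2 * (m * d) * (+ 2 * (m * d)) + - (+ 4 * (m * m)) * (c * c + d * d)
                lem₂ = solve-∀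

  -- Brahmagupta's identity t² + s² = p(u² + v²). The cases of the theorem use (u, v) = (b, 2m),
  -- (b/2, m) and (m, -b/2).
  module Composition (u v : ℤ) (uv : Unit u v) (B-unit : Unit (u * u + v * v) P) where
    B = u * u + v * v
    t = u * c + v * d
    s = v * c - u * d

    -- Multiplied by vd - uc, t becomes d²B modulo p.
    t-unit : Unit t P
    t-unit = Unit-factorˡ {t} {v * d - u * c} (Unit-≅ (≅-sym (by (- (u * u)) (trans (lem u v c d) (cong (λ p → d * d * B + - (u * u) * p) (sym p≡)))))
      (Unit-* (Unit-* d-unit d-unit) B-unit))
      where lem : ∀ u v c d → (u * c + v * d) * (v * d - u * c) ≡ d * d * (u * u + v * v) + - (u * u) * (c * c + d * d)
            lem = solve-∀

    s²≅ : s * s ≅ P * B mod t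
    s²≅ = by (- t) (trans (lem u v c d) (cong (λ p → p * B + - t * t) (sym p≡)))
      where lem : ∀ u v c d → (v * c - u * d) * (v * c - u * d) ≡ (c * c + d * d) * (u * u + v * v) + - (u * c + v * d) * (u * c + v * d)
            lem = solve-∀

    -- c t − d s = u p and d t + c s = v p, so a Bézout relation between u and v makes p a multiple of s modulo t.
    unit-B : Unit t B
    unit-B = bézout uv
     where
     bézout : Unit u v → Unit t B
     bézout (e , by k eq) = Unit-sym (Unit-factorˡ {B} {P * (w * w)} (Unit-≅ P²≅ (Unit-* P-unit P-unit)))
      where
        w = - (e * d + k * c)
        P-unit : Unit P t
        P-unit = Unit-sym t-unit
        P≅ : P ≅ w * s mod t
        P≅ = by (e * c - k * d) (trans (lem₁ P (k * v)) (trans (cong (λ z → P * z - P * (k * v)) (sym eq)) (trans (cong (λ p → p * (u * e) - p * (k * v)) p≡) (lem₂ u v c d e k))))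
          where lem₁ : ∀ p k → p ≡ p * (+ 1 + k) - p * k
                lem₁ = solve-∀
                lem₂ : ∀ u v c d e k → (c * c + d * d) * (u * e) - (c * c + d * d) * (k * v)
                     ≡ - (e * d + k * c) * (v * c - u * d) + (e * c - k * d) * (u * c + v * d)
                lem₂ = solve-∀
        -- Squaring brings in s² ≡ pB, so B is a factor of p² modulo t, and p² is a unit there.
        P²≅ : P * P ≅ B * (P * (w * w)) mod t
        P²≅ = begin
          P * P                ≅⟨ *-cong P≅ P≅ ⟩
          w * s * (w * s)      ≡⟨ lem₁ w s ⟩
          w * w * (s * s)      ≅⟨ *-congˡ (w * w) s²≅ ⟩
          w * w * (P * B)      ≡⟨ lem₂ w P B ⟩
          B * (P * (w * w)) ∎
          where open ≅-Reasoning t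
                lem₁ : ∀ w s → w * s * (w * s) ≡ w * w * (s * s)
                lem₁ = solve-∀
                lem₂ : ∀ w p b → w * w * (p * b) ≡ b * (p * (w * w))
                lem₂ = solve-∀

    jacobi-odd : Odd t → ∀ w → B ≡ + odd (double w) → jacobi t ∣ B ∣ ≡ ⟦ J t h ⟧
    jacobi-odd (r , t≡) w B≡ = trans (cong (jacobi t) (cong ∣_∣ B≡)) (trans (jacobi≡J (double w) unit) (cong ⟦_⟧ (sym (Signₚ.*-cancelʳ-≡ (J t (double w)) _ _
        (trans (square-relation N w r {t} {s} {+ 1} t≡ t-unit unit (Unit-1 t) (≅-trans s²≅ (≅-reflexive (trans (cong (P *_) B≡) (sym (ℤₚ.*-identityˡ (P * + odd (double w))))))))
               (trans (J-1 r) (sym (Signₚ.s*s≡+ (J t (double w))))))))))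
      where unit : Unit t (+ odd (double w))
            unit = subst (Unit t) B≡ unit-B

    -- Now s² ≡ 2p·(B/2) modulo t; the extra 2 leaves its symbol modulo |t|, that is (-1)^((t² -
    -- 1)/8).
    jacobi-even : ∀ (o : Odd t) w → B ≡ + 2 * + odd (double w) → jacobi t (odd (double w)) ≡ ⟦ par (triangle (proj₁ o)) · J t h ⟧
    jacobi-even o@(r , t≡) w B≡ = trans (jacobi≡J (double w) unit) (cong ⟦_⟧ (begin
        J t (double w)                                 ≡⟨ cong (_· J t (double w)) (sym (Signₚ.s*s≡+ (J t h))) ⟩
        (J t h · J t h) · J t (double w)               ≡⟨ trans (Signₚ.*-assoc (J t h) (J t h) (J t (double w))) (Signₚ.*-comm (J t h) _) ⟩
        (J t h · J t (double w)) · J t h               ≡⟨ cong (_· J t h) (square-relation N w r {t} {s} {+ 2} t≡ t-unit unit (Unit-2-Odd {t} o) s²≅′) ⟩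
        J (+ 2) r · J t h                              ≡⟨ cong (_· J t h) (J-2 r) ⟩
        par (triangle r) · J t h ∎))
      where
        open ≡-Reasoning
        unit : Unit t (+ odd (double w))
        unit = Unit-mod-factorʳ {m = + 2} (subst (Unit t) B≡ unit-B)
        s²≅′ : s * s ≅ + 2 * (P * + odd (double w)) mod t
        s²≅′ = ≅-trans s²≅ (≅-reflexive (trans (cong (P *_) B≡) (lem P (+ odd (double w)))))
          where lem : ∀ p b → p * (+ 2 * b) ≡ + 2 * (p * b)
                lem = solve-∀

-- The theorem

⟦⟧-injective : ∀ s t → ⟦ s ⟧ ≡ ⟦ t ⟧ → s ≡ t
⟦⟧-injective ⊕ ⊕ _ = refl
⟦⟧-injective ⊖ ⊖ _ = refl

series : ℕ → ℚ → ℚ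
series N x = sumTo N (λ k → toℚ (+ ((4 ℕ.* k) C (2 ℕ.* k))) ℚ.* x ^ℚ k)

module Cases (N : ℕ) (pr : Prime (odd (double N))) (c d : ℤ)
  (p≡ : + odd (double N) ≡ c * c + d * d) (2∣d : + 2 ∣ d) where

  open TwoSquares N pr c d p≡ 2∣d
  open Reduction pr

  jacobi-b-odd : ∀ {b m} → Unit b m → Odd b → Unit (b * b + + 4 * (m * m)) P →
    jacobi (b * c + + 2 * (m * d)) ∣ b * b + + 4 * (m * m) ∣ ≡ ⟦ J (b * c + + 2 * (m * d)) h ⟧
  jacobi-b-odd {b} {m} bm b-odd B-unit = subst₂ (λ t B → jacobi t ∣ B ∣ ≡ ⟦ J t h ⟧) (t≡ b c m d) (B≡ b m)
      (Composition.jacobi-odd b v bv B-unit′ t-odd (2 ℕ.* triangle (proj₁ b-odd) ℕ.+ proj₁ v-even ℕ.* proj₁ v-even) (odd-sum {b} {v} b-odd v-even))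
    where
      v = + 2 * m
      t≡ : ∀ b c m d → b * c + + 2 * m * d ≡ b * c + + 2 * (m * d)
      t≡ = solve-∀
      B≡ : ∀ b m → b * b + + 2 * m * (+ 2 * m) ≡ b * b + + 4 * (m * m)
      B≡ = solve-∀
      B-unit′ : Unit (b * b + v * v) P
      B-unit′ = subst (λ z → Unit z P) (sym (B≡ b m)) B-unit
      bv : Unit b v
      bv = Unit-sym (Unit-* (Unit-2-Odd {b} b-odd) (Unit-sym bm))
      v≅0 : v ≅ + 0 mod + 2
      v≅0 = by m (lem m)
        where lem : ∀ m → + 2 * m ≡ + 0 + m * + 2
              lem = solve-∀
      v-even : Even v
      v-even = ≅0⇒Even v≅0
      t-odd : Odd (b * c + v * d)
      t-odd = ≅1⇒Odd (+-cong (*-cong (Odd⇒≅1 {b} b-odd) (Odd⇒≅1 {c} c-odd)) (*-congʳ d v≅0))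

  module _ {η m : ℤ} (ηm : Unit η m) (m-odd : Odd m) (B-unit : Unit (η * η + m * m) P) where

    -- Of the two signs, (τ² - 1)/8 cancels the symbol of 2 modulo |τ| from `jacobi-even`, and d/2
    -- supplies the symbol of 2 modulo p that turns τ into 2τ = t.
    jacobi-b-2mod4 : Odd η → let τ = η * c + m * d in
      negOnePow ((τ * τ - + 1) / + 8 + d / + 2) * jacobi τ ∣ (η * η + m * m) / + 2 ∣ ≡ ⟦ J (+ 2 * τ) h ⟧
    jacobi-b-2mod4 η-odd = begin
        negOnePow ((τ * τ - + 1) / + 8 + d₀) * jacobi τ ∣ (η * η + m * m) / + 2 ∣
          ≡⟨ cong₂ _*_ (trans (negOnePow-par ((τ * τ - + 1) / + 8 + d₀)) (cong ⟦_⟧ (trans (par-∣+∣ ((τ * τ - + 1) / + 8) d₀) (cong (λ z → par ∣ z ∣ · par ∣ d₀ ∣) τ²)))) (cong (jacobi τ) B/2) ⟩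
        ⟦ par T · par ∣ d₀ ∣ ⟧ * jacobi τ (odd (double w))
          ≡⟨ cong (⟦ par T · par ∣ d₀ ∣ ⟧ *_) (jacobi-even τ-odd w B≡) ⟩
        ⟦ par T · par ∣ d₀ ∣ ⟧ * ⟦ par T · J τ h ⟧
          ≡⟨ trans (sym (⟦⟧-· (par T · par ∣ d₀ ∣) (par T · J τ h))) (cong ⟦_⟧ (cancel (par T) (par ∣ d₀ ∣) (J τ h))) ⟩
        ⟦ par ∣ d₀ ∣ · J τ h ⟧
          ≡⟨ cong ⟦_⟧ (trans (cong (_· J τ h) (sym J-2-h)) (sym (J-* h 2-unit t-unit))) ⟩
        ⟦ J (+ 2 * τ) h ⟧ ∎
      where
        open ≡-Reasoning
        open Composition η m ηm B-unit using (jacobi-even; t-unit)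
        τ = η * c + m * d
        w = triangle (proj₁ η-odd) ℕ.+ triangle (proj₁ m-odd)
        B≡ : η * η + m * m ≡ + 2 * + odd (double w)
        B≡ = even-sum {η} {m} η-odd m-odd
        B/2 : ∣ (η * η + m * m) / + 2 ∣ ≡ odd (double w)
        B/2 = cong ∣_∣ (trans (cong (_/ + 2) (trans B≡ (ℤₚ.*-comm (+ 2) (+ odd (double w))))) (/-exact 1 (+ odd (double w))))
        τ-odd : Odd τ
        τ-odd = ≅1⇒Odd (≅-trans (+-cong (*-cong (Odd⇒≅1 {η} η-odd) (Odd⇒≅1 {c} c-odd)) (*-congˡ m (Even⇒≅0 {d} d-even))) (≅-reflexive (cong (_+_ (+ 1)) (ℤₚ.*-zeroʳ m))))
        T = triangle (proj₁ τ-odd)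
        τ² : (τ * τ - + 1) / + 8 ≡ + T
        τ² = trans (cong (_/ + 8) (trans (cong (_- + 1) (Odd-square {τ} τ-odd)) (trans (cong (λ x → + 1 + x - + 1) (ℤₚ.pos-* 8 T)) (lem (+ T))))) (/-exact 7 (+ T))
          where lem : ∀ t → + 1 + + 8 * t - + 1 ≡ t * + 8
                lem = solve-∀
        cancel : ∀ a b c → (a · b) · (a · c) ≡ b · c
        cancel ⊕ b c = refl
        cancel ⊖ ⊕ ⊕ = refl
        cancel ⊖ ⊕ ⊖ = refl
        cancel ⊖ ⊖ ⊕ = refl
        cancel ⊖ ⊖ ⊖ = refl

    -- Modulo p, 2d(mc - ηd) ≡ c · 2(ηc + md), and both 2d and c have symbol 1. This trades the even
    -- ηc + md for a number to which reciprocity applies.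
    jacobi-b-0mod4 : Even η →
      jacobi (m * c - η * d) ∣ η * η + m * m ∣ ≡ ⟦ J (+ 2 * (η * c + m * d)) h ⟧
    jacobi-b-0mod4 η-even = trans (subst₂ (λ t B → jacobi t ∣ B ∣ ≡ ⟦ J t h ⟧) (t≡ m c η d) (B≡ m η)
        (jacobi-odd θ-odd (2 ℕ.* triangle (proj₁ m-odd) ℕ.+ proj₁ -η-even ℕ.* proj₁ -η-even) (odd-sum {m} { - η} m-odd -η-even))) (cong ⟦_⟧ Jθ)
      where
        t≡ : ∀ m c η d → m * c + (- η) * d ≡ m * c - η * d
        t≡ = solve-∀
        B≡ : ∀ m η → m * m + (- η) * (- η) ≡ η * η + m * m
        B≡ = solve-∀
        open Composition m (- η) (Unit-sym (Unit-neg ηm)) (subst (λ z → Unit z P) (sym (B≡ m η)) B-unit) using (jacobi-odd) renaming (t-unit to θ-unit′)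
        open Composition η m ηm B-unit using (t-unit)
        -η-even : Even (- η)
        -η-even = ≅0⇒Even (neg-cong (Even⇒≅0 {η} η-even))
        θ-odd : Odd (m * c + (- η) * d)
        θ-odd = ≅1⇒Odd (+-cong (*-cong (Odd⇒≅1 {m} m-odd) (Odd⇒≅1 {c} c-odd)) (*-cong (Even⇒≅0 { - η} -η-even) (Even⇒≅0 {d} d-even)))
        θ-unit : Unit (m * c - η * d) P
        θ-unit = subst (λ z → Unit z P) (t≡ m c η d) θ-unit′
        Jθ : J (m * c - η * d) h ≡ J (+ 2 * (η * c + m * d)) h
        Jθ = begin
          J (m * c - η * d) h                       ≡⟨ cong (_· J (m * c - η * d) h) (sym J-2d) ⟩
          J (+ 2 * d) h · J (m * c - η * d) h       ≡⟨ sym (J-* h (Unit-* 2-unit d-unit) θ-unit) ⟩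
          J (+ 2 * d * (m * c - η * d)) h           ≡⟨ J-cong h {+ 2 * d * (m * c - η * d)} {c * (+ 2 * (η * c + m * d))} (by (- (+ 2 * η)) (trans (lem η m c d) (cong (λ p → c * (+ 2 * (η * c + m * d)) + - (+ 2 * η) * p) (sym p≡)))) ⟩
          J (c * (+ 2 * (η * c + m * d))) h         ≡⟨ J-* h c-unit (Unit-* 2-unit t-unit) ⟩
          J c h · J (+ 2 * (η * c + m * d)) h       ≡⟨ cong (_· J (+ 2 * (η * c + m * d)) h) J-c ⟩
          J (+ 2 * (η * c + m * d)) h ∎
          where open ≡-Reasoning
                lem : ∀ η m c d → + 2 * d * (m * c - η * d) ≡ c * (+ 2 * (η * c + m * d)) + - (+ 2 * η) * (c * c + d * d)
                lem = solve-∀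

  residue : ∀ n {δ} (u : Unit δ P) → n ≅ n * Unit.inv u * δ mod P
  residue n {δ} (i , q) = ≅-sym (≅-trans (≅-reflexive (lem n i δ)) (≅-trans (*-congˡ n q) (≅-reflexive (ℤₚ.*-identityʳ n))))
    where lem : ∀ n i δ → n * i * δ ≡ n * (δ * i)
          lem = solve-∀

  module Sums (b m : ℤ) (B-unit : Unit (b * b + + 4 * (m * m)) P) where
    open Values b m B-unit public using (B; t; S₁-value; S₂-value)

    -- The rational x is left open, known only by its residue, to fit both the fraction -b²/(64m²)
    -- and the integer -a² of the special case.
    X-value : ∀ {x z} → Unit m P → x ↦ z → - (b * b) ≅ z * (+ 64 * (m * m)) mod P →
      (J B h ≡ ⊕ → (toℚ (legendre m (odd h)) ℚ.* series N x) ↦ ⟦ J t h ⟧) ×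
      (J B h ≡ ⊖ → (toℚ (legendre m (odd h)) ℚ.* series N x) ↦ (+ 0))
    X-value {x} {z} m-unit r e = (λ JB → ↦-≅ (proj₁ (S₁-value {z} m-unit e) JB) X↦) , (λ JB → ↦-≅ (proj₂ (S₁-value {z} m-unit e) JB) X↦)
      where X↦ : (toℚ (legendre m (odd h)) ℚ.* series N x) ↦ (⟦ J m h ⟧ * S N z)
            X↦ = ↦-* (subst (λ s → toℚ s ↦ ⟦ J m h ⟧) (sym (legendre≡J h pr m-unit)) (↦-toℚ ⟦ J m h ⟧)) (↦-series N r)

    Y-value : ∀ {x z} → Unit b P → x ↦ z → - (m * m) ≅ z * (+ 4 * (b * b)) mod P →
      (J B h ≡ ⊕ → (toℚ (legendre b (odd h)) ℚ.* series N x) ↦ ⟦ J t h ⟧) ×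
      (J B h ≡ ⊖ → (toℚ (legendre b (odd h)) ℚ.* series N x) ↦ (+ 0))
    Y-value {x} {z} b-unit r e = (λ JB → ↦-≅ (proj₁ (S₂-value {z} b-unit e) JB) Y↦) , (λ JB → ↦-≅ (proj₂ (S₂-value {z} b-unit e) JB) Y↦)
      where Y↦ : (toℚ (legendre b (odd h)) ℚ.* series N x) ↦ (⟦ J b h ⟧ * S N z)
            Y↦ = ↦-* (subst (λ s → toℚ s ↦ ⟦ J b h ⟧) (sym (legendre≡J h pr b-unit)) (↦-toℚ ⟦ J b h ⟧)) (↦-series N r)

    conclude : ∀ {x v} → x ↦ ⟦ J t h ⟧ → v ≡ ⟦ J t h ⟧ → x ≡ℚ toℚ v [mod odd h ]
    conclude r refl = ↦⇒≡ℚ r (↦-toℚ ⟦ J t h ⟧)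

  0↦0 : ℚ.0ℚ ↦ (+ 0)
  0↦0 = ↦-toℚ (+ 0)

  legendre-1 : ∀ {x} → Unit x P → legendre x (odd h) ≡ + 1 → J x h ≡ ⊕
  legendre-1 {x} u e = ⟦⟧-injective (J x h) ⊕ (trans (sym (legendre≡J h pr u)) e)

  legendre-minus-1 : ∀ {x} → Unit x P → legendre x (odd h) ≡ - + 1 → J x h ≡ ⊖
  legendre-minus-1 {x} u e = ⟦⟧-injective (J x h) ⊖ (trans (sym (legendre≡J h pr u)) e)

  64-unit : Unit (+ 64) P
  64-unit = Unit-* 2-unit (Unit-* 2-unit (Unit-* 2-unit (Unit-* 2-unit (Unit-* 2-unit 2-unit))))

  4-unit : Unit (+ 4) P
  4-unit = Unit-* 2-unit 2-unit

  module Congruence (b m : ℤ) (B-unit : Unit (b * b + + 4 * (m * m)) P) (m-unit : Unit m P) where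
    open Sums b m B-unit public

    X = toℚ (legendre m (odd h)) ℚ.* series N ((- (b * b)) // (+ 64 * (m * m)))
    Y = toℚ (legendre b (odd h)) ℚ.* series N ((- (m * m)) // (+ 4 * (b * b)))

    X-values : (J B h ≡ ⊕ → X ↦ ⟦ J t h ⟧) × (J B h ≡ ⊖ → X ↦ (+ 0))
    X-values = X-value m-unit (↦-// (- (b * b)) (+ 64 * (m * m)) (- (b * b) * Unit.inv u) u (residue (- (b * b)) u)) (residue (- (b * b)) u)
      where u : Unit (+ 64 * (m * m)) P
            u = Unit-* 64-unit (Unit-* m-unit m-unit)

    Y-values : ¬ (+ odd h ∣ b) → (J B h ≡ ⊕ → Y ↦ ⟦ J t h ⟧) × (J B h ≡ ⊖ → Y ↦ (+ 0))
    Y-values p∤b = Y-value b-unit (↦-// (- (m * m)) (+ 4 * (b * b)) (- (m * m) * Unit.inv u) u (residue (- (m * m)) u)) (residue (- (m * m)) u)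
      where b-unit : Unit b P
            b-unit = prime∤⇒Unit pr p∤b
            u : Unit (+ 4 * (b * b)) P
            u = Unit-* 4-unit (Unit-* b-unit b-unit)

    nonzero-case : ∀ {v} → legendre B (odd h) ≡ + 1 → v ≡ ⟦ J t h ⟧ →
      (X ≡ℚ toℚ v [mod odd h ]) × (¬ (+ odd h ∣ b) → Y ≡ℚ toℚ v [mod odd h ])
    nonzero-case L v≡ = conclude (proj₁ X-values JB) v≡ , (λ p∤b → conclude (proj₁ (Y-values p∤b) JB) v≡)
      where JB = legendre-1 B-unit L

    zero-case : legendre B (odd h) ≡ - + 1 →
      (X ≡ℚ ℚ.0ℚ [mod odd h ]) × (¬ (+ odd h ∣ b) → Y ≡ℚ ℚ.0ℚ [mod odd h ])
    zero-case L = ↦⇒≡ℚ (proj₂ X-values JB) 0↦0 , (λ p∤b → ↦⇒≡ℚ (proj₂ (Y-values p∤b) JB) 0↦0)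
      where JB = legendre-minus-1 B-unit L

-- (p − 1)/4 is replaced by a variable N, so that p = 4N + 1 can be substituted for p.
General Special : (p : ℕ) (c d : ℤ) (N : ℕ) → Set
General p c d N = ∀ (b m : ℤ) → gcd b m ≡ + 1 → ¬ (+ p ∣ m * (b * b + + 4 * (m * m))) →
  let X = toℚ (legendre m p) ℚ.* series N ((- (b * b)) // (+ 64 * (m * m)))
      Y = toℚ (legendre b p) ℚ.* series N ((- (m * m)) // (+ 4 * (b * b)))
      L = legendre (b * b + + 4 * (m * m)) p
      η = b / + 2
      τ = η * c + m * d
      holds : ℤ → Set
      holds v = (X ≡ℚ toℚ v [mod p ]) × (¬ (+ p ∣ b) → Y ≡ℚ toℚ v [mod p ])
  in (¬ (+ 2 ∣ b) → L ≡ + 1 → holds (jacobi (b * c + + 2 * (m * d)) ∣ b * b + + 4 * (m * m) ∣))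
   × (+ 2 ∣ b → ¬ (+ 4 ∣ b) → L ≡ + 1 →
        holds (negOnePow ((τ * τ - + 1) / + 8 + d / + 2) * jacobi τ ∣ (η * η + m * m) / + 2 ∣))
   × (+ 4 ∣ b → L ≡ + 1 → holds (jacobi (m * c - η * d) ∣ η * η + m * m ∣))
   × (L ≡ - (+ 1) → (X ≡ℚ ℚ.0ℚ [mod p ]) × (¬ (+ p ∣ b) → Y ≡ℚ ℚ.0ℚ [mod p ]))
Special p c d N = ∀ (a : ℤ) → ¬ (+ p ∣ + 16 * (a * a) + + 1) →
  let T₁ = series N (toℚ (- (a * a)))
      Y  = toℚ (legendre (+ 2 * a) p) ℚ.* series N (+ 1 // (- (+ 256 * (a * a))))
      L  = legendre (+ 16 * (a * a) + + 1) p
      v  = toℚ (jacobi (c - + 4 * (a * d)) ∣ + 16 * (a * a) + + 1 ∣)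
  in (L ≡ + 1 → (T₁ ≡ℚ v [mod p ]) × (¬ (+ p ∣ a) → Y ≡ℚ v [mod p ]))
   × (L ≡ - (+ 1) → (T₁ ≡ℚ ℚ.0ℚ [mod p ]) × (¬ (+ p ∣ a) → Y ≡ℚ ℚ.0ℚ [mod p ]))

general : ∀ p c d N → p ≡ odd (double N) → Prime p → + p ≡ c * c + d * d → + 2 ∣ d → General p c d N
general .(odd (double N)) c d N refl pr p≡ 2∣d b m gcd≡1 p∤mB =
    (λ b-odd L → nonzero-case L (jacobi-b-odd bm (b-isOdd b-odd) B-unit))
  , (λ 2∣b 4∤b L → nonzero-case L (trans (jacobi-b-2mod4 (ηm 2∣b) (m-odd 2∣b) (B₀-unit 2∣b) (η-odd 2∣b 4∤b)) (cong (λ z → ⟦ J z h ⟧) (t≡ 2∣b))))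
  , (λ 4∣b L → nonzero-case L (trans (jacobi-b-0mod4 (ηm (2∣ 4∣b)) (m-odd (2∣ 4∣b)) (B₀-unit (2∣ 4∣b)) (η-even 4∣b)) (cong (λ z → ⟦ J z h ⟧) (t≡ (2∣ 4∣b)))))
  , zero-case
  where
    open Cases N pr c d p≡ 2∣d
    open TwoSquares N pr c d p≡ 2∣d using (h; P)
    mB-unit : Unit (m * (b * b + + 4 * (m * m))) P
    mB-unit = prime∤⇒Unit pr p∤mB
    B-unit : Unit (b * b + + 4 * (m * m)) P
    B-unit = Unit-factorʳ {m} {b * b + + 4 * (m * m)} mB-unit
    open Congruence b m B-unit (Unit-factorˡ {m} {b * b + + 4 * (m * m)} mB-unit)
    bm : Unit b m
    bm = coprime⇒Unit (Coprimality.gcd≡1⇒coprime (ℤₚ.+-injective gcd≡1))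
    b-isOdd : ¬ (+ 2 ∣ b) → Odd b
    b-isOdd 2∤b = [ (λ e → ⊥-elim (2∤b (≅0⇒∣ (Even⇒≅0 {b} e)))) , (λ o → o) ]′ (parityℤ b)
    η = b / + 2
    2∣ : + 4 ∣ b → + 2 ∣ b
    2∣ 4∣b = ℕD.∣-trans (ℕD.divides 2 refl) 4∣b
    b≡ : + 2 ∣ b → η * + 2 ≡ b
    b≡ = half {b}
    b-unit : + 2 ∣ b → Unit (η * + 2) m
    b-unit 2∣b = subst (λ z → Unit z m) (sym (b≡ 2∣b)) bm
    ηm : + 2 ∣ b → Unit η m
    ηm 2∣b = Unit-factorˡ {η} {+ 2} (b-unit 2∣b)
    m-odd : + 2 ∣ b → Odd m
    m-odd 2∣b = Unit-2⇒Odd (Unit-factorʳ {η} {+ 2} (b-unit 2∣b))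
    B₀-unit : + 2 ∣ b → Unit (η * η + m * m) P
    B₀-unit 2∣b = Unit-factorʳ {+ 4} {η * η + m * m} (subst (λ z → Unit z P) (trans (cong (λ b → b * b + + 4 * (m * m)) (sym (b≡ 2∣b))) (lem η m)) B-unit)
      where lem : ∀ η m → η * + 2 * (η * + 2) + + 4 * (m * m) ≡ + 4 * (η * η + m * m)
            lem = solve-∀
    t≡ : + 2 ∣ b → + 2 * (η * c + m * d) ≡ b * c + + 2 * (m * d)
    t≡ 2∣b = trans (lem η c m d) (cong (λ b → b * c + + 2 * (m * d)) (b≡ 2∣b))
      where lem : ∀ η c m d → + 2 * (η * c + m * d) ≡ η * + 2 * c + + 2 * (m * d)
            lem = solve-∀
    η-even : + 4 ∣ b → Even η
    η-even 4∣b with ∣⇒≅0 {+ 4} {b} 4∣b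
    ... | by q e = ≅0⇒Even (by q (ℤₚ.*-cancelʳ-≡ η (+ 0 + q * + 2) (+ 2) (trans (b≡ (2∣ 4∣b)) (trans e (lem q)))))
      where lem : ∀ q → + 0 + q * + 4 ≡ (+ 0 + q * + 2) * + 2
            lem = solve-∀
    η-odd : + 2 ∣ b → ¬ (+ 4 ∣ b) → Odd η
    η-odd 2∣b 4∤b = [ (λ e → ⊥-elim (4∤b (4∣ (Even⇒≅0 {η} e)))) , (λ o → o) ]′ (parityℤ η)
      where
        4∣ : η ≅ + 0 mod + 2 → + 4 ∣ b
        4∣ (by q e) = ≅0⇒∣ {+ 4} {b} (by q (trans (sym (b≡ 2∣b)) (trans (cong (_* + 2) e) (lem q))))
          where lem : ∀ q → (+ 0 + q * + 2) * + 2 ≡ + 0 + q * + 4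
                lem = solve-∀

-- The pair (b, m) = (8a, 1).
special : ∀ p c d N → p ≡ odd (double N) → Prime p → + p ≡ c * c + d * d → + 2 ∣ d → Special p c d N
special .(odd (double N)) c d N refl pr p≡ 2∣d a p∤A =
    (λ L → let JB = trans J-B (legendre-1 A-unit L) in
       conclude (T₁-plain (proj₁ T₁-values JB)) v≡ , (λ p∤a → conclude (Y-plain p∤a (proj₁ (T₂-values p∤a) JB)) v≡))
  , (λ L → let JB = trans J-B (legendre-minus-1 A-unit L) in
       ↦⇒≡ℚ (T₁-plain (proj₂ T₁-values JB)) 0↦0 , (λ p∤a → ↦⇒≡ℚ (Y-plain p∤a (proj₂ (T₂-values p∤a) JB)) 0↦0))
  where
    open Cases N pr c d p≡ 2∣d
    open TwoSquares N pr c d p≡ 2∣d using (h; P; J-4; 2-unit)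
    open Reduction pr
    A = + 16 * (a * a) + + 1
    b = + 8 * a
    η = + 4 * a
    x₂ = + 1 // (- (+ 256 * (a * a)))
    A-unit : Unit A P
    A-unit = prime∤⇒Unit pr p∤A
    B≡ : ∀ a → + 2 * (+ 2 * (+ 16 * (a * a) + + 1)) ≡ + 8 * a * (+ 8 * a) + + 4 * (+ 1 * + 1)
    B≡ = solve-∀
    B-unit : Unit (b * b + + 4 * (+ 1 * + 1)) P
    B-unit = subst (λ z → Unit z P) (B≡ a) (Unit-* 2-unit (Unit-* 2-unit A-unit))
    open Sums b (+ 1) B-unit
    -- Here (8a)² + 4 = 4(16a² + 1).
    J-B : J B h ≡ J A h
    J-B = trans (cong (λ z → J z h) (sym (B≡ a))) (J-4 A-unit)
    η²+1 : ∀ a → + 4 * a * (+ 4 * a) + + 1 * + 1 ≡ + 16 * (a * a) + + 1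
    η²+1 = solve-∀
    θ≡ : ∀ a c d → + 1 * c - + 4 * a * d ≡ c - + 4 * (a * d)
    θ≡ = solve-∀
    t≡ : ∀ a c d → + 2 * (+ 4 * a * c + + 1 * d) ≡ + 8 * a * c + + 2 * (+ 1 * d)
    t≡ = solve-∀
    η-even : Even η
    η-even = ≅0⇒Even (by (+ 2 * a) (lem a))
      where lem : ∀ a → + 4 * a ≡ + 0 + + 2 * a * + 2
            lem = solve-∀
    -- As 4 divides 8a, the third case with b/2 = 4a always applies.
    v≡ : jacobi (c - + 4 * (a * d)) ∣ A ∣ ≡ ⟦ J t h ⟧
    v≡ = trans (sym (cong₂ (λ x y → jacobi x ∣ y ∣) (θ≡ a c d) (η²+1 a)))
      (trans (jacobi-b-0mod4 {η} {+ 1} (Unit-sym (Unit-1 η)) (0 , refl) (subst (λ z → Unit z P) (sym (η²+1 a)) A-unit) η-even)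
             (cong (λ z → ⟦ J z h ⟧) (t≡ a c d)))
    T₁-values : (J B h ≡ ⊕ → (toℚ (legendre (+ 1) (odd h)) ℚ.* series N (toℚ (- (a * a)))) ↦ ⟦ J t h ⟧)
              × (J B h ≡ ⊖ → (toℚ (legendre (+ 1) (odd h)) ℚ.* series N (toℚ (- (a * a)))) ↦ (+ 0))
    T₁-values = X-value (Unit-1 P) (↦-toℚ (- (a * a))) (≅-reflexive (lem a))
      where lem : ∀ a → - (+ 8 * a * (+ 8 * a)) ≡ - (a * a) * (+ 64 * (+ 1 * + 1))
            lem = solve-∀
    T₁-plain : ∀ {z} → (toℚ (legendre (+ 1) (odd h)) ℚ.* series N (toℚ (- (a * a)))) ↦ z → series N (toℚ (- (a * a))) ↦ z
    T₁-plain {z} r = subst (_↦ z) (trans (cong (λ s → toℚ s ℚ.* series N (toℚ (- (a * a)))) (trans (legendre≡J h pr (Unit-1 P)) (cong ⟦_⟧ (J-1 h)))) (ℚₚ.*-identityˡ (series N (toℚ (- (a * a)))))) r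
    a-unit : ¬ (+ odd h ∣ a) → Unit a P
    a-unit = prime∤⇒Unit pr
    T₂-values : ¬ (+ odd h ∣ a) → (J B h ≡ ⊕ → (toℚ (legendre b (odd h)) ℚ.* series N x₂) ↦ ⟦ J t h ⟧)
                                × (J B h ≡ ⊖ → (toℚ (legendre b (odd h)) ℚ.* series N x₂) ↦ (+ 0))
    T₂-values p∤a = Y-value (Unit-* 8-unit ua) (↦-// (+ 1) (- (+ 256 * (a * a))) (+ 1 * Unit.inv u) u (residue (+ 1) u))
        (≅-trans (neg-cong (residue (+ 1) u)) (≅-reflexive (lem (+ 1 * Unit.inv u) a)))
      where
        ua = a-unit p∤a
        8-unit : Unit (+ 8) P
        8-unit = Unit-* 2-unit 4-unit
        u : Unit (- (+ 256 * (a * a))) P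
        u = Unit-neg (Unit-* (Unit-* 4-unit 64-unit) (Unit-* ua ua))
        lem : ∀ i a → - (i * - (+ 256 * (a * a))) ≡ i * (+ 4 * (+ 8 * a * (+ 8 * a)))
        lem = solve-∀
    -- Since 8a = 4 · 2a, the symbols of 8a and 2a agree.
    Y-plain : ¬ (+ odd h ∣ a) → ∀ {z} → (toℚ (legendre b (odd h)) ℚ.* series N x₂) ↦ z → (toℚ (legendre (+ 2 * a) (odd h)) ℚ.* series N x₂) ↦ z
    Y-plain p∤a {z} r = subst (_↦ z) (cong (λ s → toℚ s ℚ.* series N x₂) legendre-8a) r
      where
        u2a : Unit (+ 2 * a) P
        u2a = Unit-* 2-unit (a-unit p∤a)
        8a : ∀ a → + 8 * a ≡ + 2 * (+ 2 * (+ 2 * a))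
        8a = solve-∀
        legendre-8a : legendre b (odd h) ≡ legendre (+ 2 * a) (odd h)
        legendre-8a = trans (cong (λ x → legendre x (odd h)) (8a a)) (trans (legendre≡J h pr (Unit-* 2-unit (Unit-* 2-unit u2a)))
          (trans (cong ⟦_⟧ (J-4 u2a)) (sym (legendre≡J h pr u2a))))

1mod4 : ∀ p → p ℕ.% 4 ≡ 1 → p ≡ odd (double ((p ℕ.∸ 1) ℕ./ 4))
1mod4 p e = trans p≡ (cong (λ q → suc (double (double q))) (sym q≡))
  where
    q = p ℕ./ 4
    p≡1+q*4 : p ≡ 1 ℕ.+ q ℕ.* 4
    p≡1+q*4 = trans (ℕDM.m≡m%n+[m/n]*n p 4) (cong (ℕ._+ q ℕ.* 4) e)
    lem : ∀ q → q ℕ.* 4 ≡ q ℕ.+ q ℕ.+ (q ℕ.+ q)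
    lem = ℕ-Solver.solve-∀
    p≡ : p ≡ odd (double q)
    p≡ = trans p≡1+q*4 (cong suc (lem q))
    q≡ : (p ℕ.∸ 1) ℕ./ 4 ≡ q
    q≡ = trans (cong (λ x → (x ℕ.∸ 1) ℕ./ 4) p≡1+q*4) (ℕDM.m*n/n≡m q 4)

theorem2p10 :
  ∀ (p : ℕ) (c d : ℤ) →
  Prime p → p ℕ.% 4 ≡ 1 → + p ≡ c * c + d * d → + 2 ∣ d →
  (∀ (b m : ℤ) → gcd b m ≡ + 1 → ¬ (+ p ∣ m * (b * b + + 4 * (m * m))) →
    let N   = (p ℕ.∸ 1) ℕ./ 4
        S₁  = sumTo N (λ k → toℚ (+ ((4 ℕ.* k) C (2 ℕ.* k))) ℚ.* ((- (b * b)) // (+ 64 * (m * m))) ^ℚ k)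
        S₂  = sumTo N (λ k → toℚ (+ ((4 ℕ.* k) C (2 ℕ.* k))) ℚ.* ((- (m * m)) // (+ 4 * (b * b))) ^ℚ k)
        X   = toℚ (legendre m p) ℚ.* S₁
        Y   = toℚ (legendre b p) ℚ.* S₂
        L   = legendre (b * b + + 4 * (m * m)) p
        h   = b / + 2
        t   = h * c + m * d
    in (¬ (+ 2 ∣ b) → L ≡ + 1 →
          let v = toℚ (jacobi (b * c + + 2 * (m * d)) ∣ b * b + + 4 * (m * m) ∣) in
          (X ≡ℚ v [mod p ]) × (¬ (+ p ∣ b) → Y ≡ℚ v [mod p ]))
     × (+ 2 ∣ b → ¬ (+ 4 ∣ b) → L ≡ + 1 →
          let v = toℚ (negOnePow ((t * t - + 1) / + 8 + d / + 2)
                            * jacobi t ∣ (h * h + m * m) / + 2 ∣) in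
          (X ≡ℚ v [mod p ]) × (¬ (+ p ∣ b) → Y ≡ℚ v [mod p ]))
     × (+ 4 ∣ b → L ≡ + 1 →
          let v = toℚ (jacobi (m * c - h * d) ∣ h * h + m * m ∣) in
          (X ≡ℚ v [mod p ]) × (¬ (+ p ∣ b) → Y ≡ℚ v [mod p ]))
     × (L ≡ - (+ 1) →
          (X ≡ℚ ℚ.0ℚ [mod p ]) × (¬ (+ p ∣ b) → Y ≡ℚ ℚ.0ℚ [mod p ])))
  ×
  (∀ (a : ℤ) → ¬ (+ p ∣ + 16 * (a * a) + + 1) →
    let N   = (p ℕ.∸ 1) ℕ./ 4
        T₁  = sumTo N (λ k → toℚ (+ ((4 ℕ.* k) C (2 ℕ.* k))) ℚ.* (toℚ (- (a * a))) ^ℚ k)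
        T₂  = sumTo N (λ k → toℚ (+ ((4 ℕ.* k) C (2 ℕ.* k))) ℚ.* (+ 1 // (- (+ 256 * (a * a)))) ^ℚ k)
        Y   = toℚ (legendre (+ 2 * a) p) ℚ.* T₂
        L   = legendre (+ 16 * (a * a) + + 1) p
    in (L ≡ + 1 →
          let v = toℚ (jacobi (c - + 4 * (a * d)) ∣ + 16 * (a * a) + + 1 ∣) in
          (T₁ ≡ℚ v [mod p ]) × (¬ (+ p ∣ a) → Y ≡ℚ v [mod p ]))
     × (L ≡ - (+ 1) →
          (T₁ ≡ℚ ℚ.0ℚ [mod p ]) × (¬ (+ p ∣ a) → Y ≡ℚ ℚ.0ℚ [mod p ])))
theorem2p10 p c d pr p%4≡1 p≡ 2∣d =
    general p c d ((p ℕ.∸ 1) ℕ./ 4) (1mod4 p p%4≡1) pr p≡ 2∣d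
  , special p c d ((p ℕ.∸ 1) ℕ./ 4) (1mod4 p p%4≡1) pr p≡ 2∣d
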